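{- There is an implementation of the Longest Processing Time First (LPT) heuristic for the uniform machine scheduling problem with $n$ jobs and $m$ machines that runs in $O((n+m)(\log^2 m+\log n))$ time.
   Context: Uniform machine scheduling problem: we are given $n$ jobs $P_1,\dots,P_n$ with sizes $\ell_1,\dots,\ell_n>0$ and $m$ machines $D_1,\dots,D_m$ with speeds $v_1,\dots,v_m>0$. A valid schedule assigns each job to exactly one machine; the completion time of machine $D_j$ is $\sum_{i: P_i \text{ assigned to } D_j} \ell_i/v_j$, and the makespan is the maximum completion time over all machines. The LPT heuristic: sort the jobs in non-increasing order of size; initialize $T_j=0$ for all $j\in[m]$; then, for each job $P_i$ in this order, choose a machine $D_\alpha$ with $\alpha\in\arg\min_{j\in[m]}\left(T_j+\ell_i/v_j\right)$ (ties broken arbitrarily), assign $P_i$ to $D_\alpha$, and set $T_\alpha\leftarrow T_\alpha+\ell_i/v_\alpha$; finally output the schedule (and its makespan $\max_j T_j$). An implementation of LPT is an algorithm producing exactly this output. Arithmetic operations and comparisons on real numbers are assumed to take constant time. -}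

module Defs where

open import Algebra.Structures using (IsCommutativeRing)
open import Data.Bool.Base using (Bool; true; false; if_then_else_; _∧_; not)
open import Data.Fin.Base using (Fin; toℕ)
open import Data.List.Base using (List; []; _∷_; allFin)
open import Data.List.Relation.Binary.Permutation.Propositional using (_↭_)
open import Data.List.Relation.Unary.Linked using (Linked)
open import Data.Nat.Base as ℕ using (ℕ; suc; ⌊_/2⌋; NonZero; _≡ᵇ_; _≤ᵇ_)
open import Data.Product.Base using (∃-syntax; _×_)
open import Data.Vec.Functional using (Vector; updateAt; replicate)
open import Level using (Level; _⊔_) renaming (suc to lsuc)
open import Relation.Binary.Core using (Rel)
open import Relation.Binary.PropositionalEquality using (_≡_; _≢_)
open import Relation.Binary.Structures using (IsDecTotalOrder)
open import Relation.Nullary.Decidable.Core using (⌊_⌋)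
import Relation.Binary.Construct.NonStrictToStrict as Strict

-- The numbers of the real RAM. The standard library has no real numbers; ℝ
-- with its unit-cost comparisons enters as an ordered field with decidable
-- order.
record OrderedField (c ℓ : Level) : Set (lsuc (c ⊔ ℓ)) where
  infix  8 _⁻¹
  infix  8 -_
  infixl 7 _*_ _/_
  infixl 6 _+_ _-_
  infix  4 _≤_
  field
    Carrier           : Set c
    _≤_               : Rel Carrier ℓ
    _+_ _*_           : Carrier → Carrier → Carrier
    -_ _⁻¹            : Carrier → Carrier
    0# 1#             : Carrier
    isCommutativeRing : IsCommutativeRing _≡_ _+_ _*_ -_ 0# 1#
    0≢1               : 0# ≢ 1#
    *-inverseʳ        : ∀ x → x ≢ 0# → x * x ⁻¹ ≡ 1#
    0⁻¹               : 0# ⁻¹ ≡ 0#  -- makes _⁻¹ total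
    isDecTotalOrder   : IsDecTotalOrder _≡_ _≤_
    +-monoˡ-≤         : ∀ z {x y} → x ≤ y → x + z ≤ y + z
    *-nonneg          : ∀ {x y} → 0# ≤ x → 0# ≤ y → 0# ≤ x * y

  open IsDecTotalOrder isDecTotalOrder public using (_≤?_; _≟_)
  open Strict _≡_ _≤_ public using (_<_)

  _-_ _/_ : Carrier → Carrier → Carrier
  x - y = x + (- y)
  x / y = x * y ⁻¹

-- Programs of a real RAM with one memory for naturals (counters and
-- indices) and one for numbers. A memory is a family of blocks; the block
-- of an access is a literal of the program, the offset inside the block is
-- computed. As usual, numbers cannot be rounded to naturals, and naturals have
-- only additive unit-cost operations and halving.

infixl 6 _⊕_ _⊖_
infixl 7 _⊗_ _⊘_
infixl 6 _+ₙ_ _∸ₙ_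
infix  5 _≤ₙ_ _≤ᴿ_
infixr 4 _∧ₜ_
infix  4.5 ¬ₜ_
infix  4 nat[_,_]≔_ num[_,_]≔_

data NatExp : Set where
  lit      : ℕ → NatExp
  nat[_,_] : (block : ℕ) (offset : NatExp) → NatExp
  _+ₙ_ _∸ₙ_ : NatExp → NatExp → NatExp
  half     : NatExp → NatExp

data NumExp : Set where
  zeroᴿ oneᴿ : NumExp
  num[_,_]   : (block : ℕ) (offset : NatExp) → NumExp
  _⊕_ _⊖_ _⊗_ _⊘_ : NumExp → NumExp → NumExp

data Test : Set where
  _≤ₙ_  : NatExp → NatExp → Test
  _≤ᴿ_  : NumExp → NumExp → Test
  ¬ₜ_   : Test → Test
  _∧ₜ_  : Test → Test → Test

infixr 3 _⨾_

data Program : Set where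
  skip            : Program
  nat[_,_]≔_      : (block : ℕ) (offset value : NatExp) → Program
  num[_,_]≔_      : (block : ℕ) (offset : NatExp) (value : NumExp) → Program
  _⨾_             : Program → Program → Program
  when_then_else_  : Test → Program → Program → Program
  while_loop_     : Test → Program → Program

Memory : ∀ {a} → Set a → Set a
Memory A = (block offset : ℕ) → A

_[_,_≔_] : ∀ {a} {A : Set a} → Memory A → ℕ → ℕ → A → Memory A
(μ [ b , i ≔ x ]) b′ i′ = if (b ≡ᵇ b′) ∧ (i ≡ᵇ i′) then x else μ b′ i′

module RealRAM {c ℓ} (F : OrderedField c ℓ) where
  open OrderedField F

  record State : Set c where
    constructor ⟨_,_⟩
    field
      nats : Memory ℕ
      nums : Memory Carrier
  open State public

  evalₙ : NatExp → State → ℕ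
  evalₙ (lit k)        s = k
  evalₙ nat[ b , e ]   s = nats s b (evalₙ e s)
  evalₙ (e +ₙ f)       s = evalₙ e s ℕ.+ evalₙ f s
  evalₙ (e ∸ₙ f)       s = evalₙ e s ℕ.∸ evalₙ f s
  evalₙ (half e)       s = ⌊ evalₙ e s /2⌋

  evalᴿ : NumExp → State → Carrier
  evalᴿ zeroᴿ        s = 0#
  evalᴿ oneᴿ         s = 1#
  evalᴿ num[ b , e ] s = nums s b (evalₙ e s)
  evalᴿ (e ⊕ f)      s = evalᴿ e s + evalᴿ f s
  evalᴿ (e ⊖ f)      s = evalᴿ e s - evalᴿ f s
  evalᴿ (e ⊗ f)      s = evalᴿ e s * evalᴿ f s
  evalᴿ (e ⊘ f)      s = evalᴿ e s / evalᴿ f s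

  test : Test → State → Bool
  test (e ≤ₙ f) s = evalₙ e s ≤ᵇ evalₙ f s
  test (e ≤ᴿ f) s = ⌊ evalᴿ e s ≤? evalᴿ f s ⌋
  test (¬ₜ b)   s = not (test b s)
  test (a ∧ₜ b) s = test a s ∧ test b s

  -- p , s ⇓[ t ] s′ : started in s, p halts in s′ after t steps. An
  -- assignment or a test is one step: the size of an expression is fixed by
  -- the program text, hence a constant.
  infix 2 _,_⇓[_]_

  data _,_⇓[_]_ : Program → State → ℕ → State → Set c where
    skip⇓  : ∀ {s} → skip , s ⇓[ 1 ] s
    nat≔⇓  : ∀ {b i e s} →
             (nat[ b , i ]≔ e) , s ⇓[ 1 ]
               ⟨ nats s [ b , evalₙ i s ≔ evalₙ e s ] , nums s ⟩
    num≔⇓  : ∀ {b i e s} →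
             (num[ b , i ]≔ e) , s ⇓[ 1 ]
               ⟨ nats s , nums s [ b , evalₙ i s ≔ evalᴿ e s ] ⟩
    seq⇓   : ∀ {p q s s′ s″ t u} →
             p , s ⇓[ t ] s′ → q , s′ ⇓[ u ] s″ →
             (p ⨾ q) , s ⇓[ t ℕ.+ u ] s″
    then⇓  : ∀ {b p q s s′ t} → test b s ≡ true →
             p , s ⇓[ t ] s′ → (when b then p else q) , s ⇓[ suc t ] s′
    else⇓  : ∀ {b p q s s′ t} → test b s ≡ false →
             q , s ⇓[ t ] s′ → (when b then p else q) , s ⇓[ suc t ] s′
    exit⇓  : ∀ {b p s} → test b s ≡ false →
             (while b loop p) , s ⇓[ 1 ] s
    again⇓ : ∀ {b p s s′ s″ t u} → test b s ≡ true →
             p , s ⇓[ t ] s′ → (while b loop p) , s′ ⇓[ u ] s″ →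
             (while b loop p) , s ⇓[ suc (t ℕ.+ u) ] s″

module Scheduling {c ℓ} (F : OrderedField c ℓ) where
  open OrderedField F
  open RealRAM F

  record Instance (n m : ℕ) : Set (c ⊔ ℓ) where
    field
      size    : Vector Carrier n
      speed   : Vector Carrier m
      0<size  : ∀ i → 0# < size i
      0<speed : ∀ j → 0# < speed j

  Schedule : ℕ → ℕ → Set
  Schedule n m = Fin n → Fin m

  module _ {n m} (I : Instance n m) where
    open Instance I

    -- Greedy σ is T T′ : starting from the loads T, the LPT rule can place
    -- the jobs is, in this order, where σ says, and this leads to the loads
    -- T′. Ties may be broken either way.
    data Greedy (σ : Schedule n m) :
                List (Fin n) → Vector Carrier m → Vector Carrier m → Set (c ⊔ ℓ) where
      []  : ∀ {T} → Greedy σ [] T T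
      _∷_ : ∀ {i is T T′} →
            (∀ j → T (σ i) + size i / speed (σ i) ≤ T j + size i / speed j) →
            Greedy σ is (updateAt T (σ i) (_+ size i / speed (σ i))) T′ →
            Greedy σ (i ∷ is) T T′

    record IsLPTOutput (σ : Schedule n m) (makespan : Carrier) : Set (c ⊔ ℓ) where
      field
        order         : List (Fin n)
        allJobs       : order ↭ allFin n
        nonIncreasing : Linked (λ i i′ → size i′ ≤ size i) order
        loads         : Vector Carrier m
        greedy        : Greedy σ order (replicate m 0#) loads
        upperBound    : ∀ j → loads j ≤ makespan
        attained      : ∃[ j ] makespan ≡ loads j

    -- Jobs and machines are numbered from 0. Cells not mentioned may hold
    -- anything.
    record InputIn (s : State) : Set c where
      field
        n-cell : nats s 0 0 ≡ n
        m-cell : nats s 1 0 ≡ m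
        sizes  : ∀ i → nums s 0 (toℕ i) ≡ size i
        speeds : ∀ j → nums s 1 (toℕ j) ≡ speed j

    record OutputIn (s : State) : Set (c ⊔ ℓ) where
      field
        σ        : Schedule n m
        schedule : ∀ i → nats s 2 (toℕ i) ≡ toℕ (σ i)
        lpt      : IsLPTOutput σ (nums s 2 0)

  ImplementsLPT_InTime_ : Program → (ℕ → ℕ → ℕ) → Set (c ⊔ ℓ)
  ImplementsLPT p InTime f =
    ∀ n m → .{{NonZero n}} → .{{NonZero m}} →
    (I : Instance n m) (s : State) → InputIn I s →
    ∃[ t ] ∃[ s′ ] (p , s ⇓[ t ] s′) × OutputIn I s′ × t ℕ.≤ f n m

-- The threshold N is needed: the bounds of interest may vanish at n = m = 1.
infix 4 _∈O_

_∈O_ : (f g : ℕ → ℕ → ℕ) → Set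
f ∈O g = ∃[ C ] ∃[ N ] ∀ n m → .{{NonZero n}} → .{{NonZero m}} →
         N ℕ.≤ n ℕ.+ m → f n m ℕ.≤ C ℕ.* g n m

{-# OPTIONS --safe #-}

-- At job size y the finishing time of machine p is the value at y of a line with
-- slope 1 / vₚ, and the job sizes y decrease. Keep the machines, sorted by speed,
-- at the leaves of a tournament tree. In every inner node all lines of the left
-- subtree are flatter than those of the right one, so as long as no load changes
-- the winner of the node moves from the left to the right subtree at most once.
-- Every node stores a failure size, from which on downwards some winner in its
-- subtree may be wrong; a job of size y first repairs the nodes whose failure
-- size is at least y. Each repair is paid for by the potential, the number of
-- nodes whose winner comes from the left: it drops with every repair, and an
-- assignment, which raises one load, affects O(log m) nodes only. This gives
-- O(m + n log m) repairs of O(log m) steps each. Jobs and machines are sorted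
-- with a plain tournament.
module Submission where

open import Defs
open import Algebra.Bundles using (CommutativeRing)
open import Algebra.Structures using (IsCommutativeRing)
open import Data.Nat.Base as ℕ using (ℕ; zero; suc)
open import Data.Product.Base using (Σ-syntax; ∃-syntax; _×_; _,_; proj₁; proj₂)
open import Data.Sum.Base using (_⊎_; inj₁; inj₂)
open import Data.Unit.Base using (⊤; tt)
open import Function.Base using (_∘_; id)
open import Level using (Level; _⊔_)
open import Relation.Binary.PropositionalEquality hiding ([_]; J)
open import Relation.Binary.Structures using (IsDecTotalOrder)
open import Relation.Nullary using (¬_; yes; no; contradiction)

-- The winner stored at an undecided node means nothing, so the potential cannot be read off the
-- memory. It is kept as a bit `side` per inner node that exists only in the proof. The bit `false`
-- asserts `TakenOver`: from `now` downwards every leaf on the left is beaten or equalled by some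
-- leaf on the right. This speaks of lines, not of stored winners, and a steeper line that is below
-- stays below. Hence it survives all repairs, even while the node is undecided, and between two
-- load changes no bit returns to `true`. A repair starts at a lowest failing node. As its children
-- do not fail, `Caused` traces the failure to its own crossing: the bit is `true`, the right winner
-- is ahead, and recomputing the node clears the bit. A load change invalidates the bits of the
-- ancestors of one leaf only, and each is charged one unit. Two conventions avoid special cases:
-- leaves have failure size `0#`, below every job size, and parallel lines cross at `0#`, the value
-- of a division by zero.

-- Ordered fields, and lines that cross.

module OrderedFieldProperties {c ℓ} (F : OrderedField c ℓ) where
  open OrderedField F
  open IsCommutativeRing isCommutativeRing
    using (+-assoc; +-identityˡ; +-identityʳ; -‿inverseˡ; -‿inverseʳ;
           *-comm; *-assoc; *-identityˡ; *-identityʳ; distribˡ; distribʳ; zeroˡ; zeroʳ)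
  open IsDecTotalOrder isDecTotalOrder public
    using () renaming (refl to ≤-refl; trans to ≤-trans; antisym to ≤-antisym;
                       total to ≤-total; reflexive to ≤-reflexive)

  commutativeRing : CommutativeRing c c
  commutativeRing = record { isCommutativeRing = isCommutativeRing }

  open import Algebra.Solver.Ring.NaturalCoefficients.Default
    (CommutativeRing.commutativeSemiring commutativeRing)
    using (solve; _:+_; _:*_; _:=_)

  private variable
    x y z s s′ t t′ : Carrier

  <⇒≱ : x < y → ¬ y ≤ x
  <⇒≱ (x≤y , x≢y) y≤x = x≢y (≤-antisym x≤y y≤x)

  ≰⇒> : ¬ x ≤ y → y < x
  ≰⇒> {x} {y} x≰y with ≤-total x y
  ... | inj₁ x≤y = contradiction x≤y x≰y
  ... | inj₂ y≤x = y≤x , λ { refl → x≰y ≤-refl }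

  ≰⇒≥ : ¬ x ≤ y → y ≤ x
  ≰⇒≥ = proj₁ ∘ ≰⇒>

  <-≤-trans : x < y → y ≤ z → x < z
  <-≤-trans x<y y≤z = ≤-trans (proj₁ x<y) y≤z , λ { refl → <⇒≱ x<y y≤z }

  ≤-<-trans : x ≤ y → y < z → x < z
  ≤-<-trans x≤y y<z = ≤-trans x≤y (proj₁ y<z) , λ { refl → <⇒≱ y<z x≤y }

  <-irrefl : ¬ x < x
  <-irrefl (_ , x≢x) = x≢x refl

  x-y+y : ∀ x y → (x - y) + y ≡ x
  x-y+y x y = trans (+-assoc x (- y) y) (trans (cong (x +_) (-‿inverseˡ y)) (+-identityʳ x))

  +-cancelʳ-≤ : ∀ z → x + z ≤ y + z → x ≤ y
  +-cancelʳ-≤ {x} {y} z le = subst₂ _≤_ (undo x) (undo y) (+-monoˡ-≤ (- z) le)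
    where
    undo : ∀ u → (u + z) + - z ≡ u
    undo u = trans (+-assoc u z (- z)) (trans (cong (u +_) (-‿inverseʳ z)) (+-identityʳ u))

  0≤y-x : x ≤ y → 0# ≤ y - x
  0≤y-x {x} {y} le = subst (_≤ y - x) (-‿inverseʳ x) (+-monoˡ-≤ (- x) le)

  x≤y+x : ∀ x → 0# ≤ y → x ≤ y + x
  x≤y+x {y} x le = subst (_≤ y + x) (+-identityˡ x) (+-monoˡ-≤ x le)

  *-monoˡ-≤ : 0# ≤ z → x ≤ y → x * z ≤ y * z
  *-monoˡ-≤ {z} {x} {y} 0≤z x≤y =
    subst (x * z ≤_) (trans (sym (distribʳ z (y - x) x)) (cong (_* z) (x-y+y y x)))
      (x≤y+x (x * z) (*-nonneg (0≤y-x x≤y) 0≤z))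

  -- Otherwise `0# - 1#` would be nonnegative, and so would its square, which is `1#`.
  1≰0 : ¬ 1# ≤ 0#
  1≰0 1≤0 = 0≢1 (≤-antisym (subst (0# ≤_) m*m≡1 (*-nonneg 0≤m 0≤m)) 1≤0)
    where
    m = 0# - 1#
    0≤m : 0# ≤ m
    0≤m = 0≤y-x 1≤0
    m+1≡0 : m + 1# ≡ 0#
    m+1≡0 = x-y+y 0# 1#
    open ≡-Reasoning
    m*m≡1 : m * m ≡ 1#
    m*m≡1 = begin
      m * m                 ≡⟨ +-identityʳ _ ⟨
      m * m + 0#            ≡⟨ cong (m * m +_) m+1≡0 ⟨
      m * m + (m + 1#)      ≡⟨ +-assoc _ _ _ ⟨
      m * m + m + 1#        ≡⟨ cong (λ z → m * m + z + 1#) (*-identityʳ m) ⟨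
      m * m + m * 1# + 1#   ≡⟨ cong (_+ 1#) (distribˡ m m 1#) ⟨
      m * (m + 1#) + 1#     ≡⟨ cong (λ z → m * z + 1#) m+1≡0 ⟩
      m * 0# + 1#           ≡⟨ cong (_+ 1#) (zeroʳ m) ⟩
      0# + 1#               ≡⟨ +-identityˡ 1# ⟩
      1#                    ∎

  0<x⇒0≤x⁻¹ : 0# < x → 0# ≤ x ⁻¹
  0<x⇒0≤x⁻¹ {x} (0≤x , 0≢x) with ≤-total 0# (x ⁻¹)
  ... | inj₁ le = le
  ... | inj₂ ge = contradiction
    (subst₂ _≤_ (trans (*-comm _ _) (*-inverseʳ x (0≢x ∘ sym))) (zeroˡ x) (*-monoˡ-≤ 0≤x ge)) 1≰0

  ⁻¹-anti-≤ : 0# < x → x ≤ y → y ⁻¹ ≤ x ⁻¹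
  ⁻¹-anti-≤ {x} {y} 0<x x≤y =
    subst₂ _≤_
      (cancel x (y ⁻¹) (proj₂ 0<x ∘ sym))
      (trans (cong (_* x ⁻¹) (*-inverseʳ y (proj₂ 0<y ∘ sym))) (*-identityˡ _))
      (*-monoˡ-≤ (0<x⇒0≤x⁻¹ 0<x) (*-monoˡ-≤ (0<x⇒0≤x⁻¹ 0<y) x≤y))
    where
    0<y = <-≤-trans 0<x x≤y
    cancel : ∀ u w → u ≢ 0# → u * w * u ⁻¹ ≡ w
    cancel u w u≢0 = trans (solve 3 (λ a b c → a :* b :* c := (a :* c) :* b) refl u w (u ⁻¹))
                           (trans (cong (_* w) (*-inverseʳ u u≢0)) (*-identityˡ w))

  y/z*z≡y : ∀ y z → z ≢ 0# → y / z * z ≡ y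
  y/z*z≡y y z z≢0 =
    trans (*-assoc _ _ _)
      (trans (cong (y *_) (trans (*-comm _ _) (*-inverseʳ z z≢0))) (*-identityʳ y))

  x≤y/z⇒x*z≤y : 0# ≤ z → z ≢ 0# → x ≤ y / z → x * z ≤ y
  x≤y/z⇒x*z≤y {z} {x} {y} 0≤z z≢0 le = subst (x * z ≤_) (y/z*z≡y y z z≢0) (*-monoˡ-≤ 0≤z le)

  y/z≤x⇒y≤x*z : 0# ≤ z → z ≢ 0# → y / z ≤ x → y ≤ x * z
  y/z≤x⇒y≤x*z {z} {y} {x} 0≤z z≢0 le = subst (_≤ x * z) (y/z*z≡y y z z≢0) (*-monoˡ-≤ 0≤z le)

  y/0≡0 : z ≡ 0# → y / z ≡ 0#
  y/0≡0 {z} {y} refl = trans (cong (y *_) 0⁻¹) (zeroʳ y)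

  -- The lines y ↦ t + y * s below are compared at y decreasing: the steeper one
  -- falls faster.
  module _ (s≤s′ : s ≤ s′) where

    private
      d = s′ - s
      0≤d = 0≤y-x s≤s′
      s′≡ : d + s ≡ s′
      s′≡ = x-y+y s′ s

    -- Going down from `x` to `y` lowers the two lines by `e * s′` and `e * s` with `e = x - y`, and
    -- the first amount is at least the second.
    steeper-stays-below : y ≤ x → t′ + x * s′ ≤ t + x * s → t′ + y * s′ ≤ t + y * s
    steeper-stays-below {y} {x} {t′} {t} y≤x le =
      +-cancelʳ-≤ (e * s) (≤-trans
        (subst (t′ + y * s′ + e * s ≤_)
          (trans (solve 6 (λ e d s t y s′ → e :* d :+ (t :+ y :* s′ :+ e :* s)
                            := t :+ (y :* s′ :+ e :* (d :+ s))) refl e d s t′ y s′)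
                 (trans (cong (λ z → t′ + (y * s′ + e * z)) s′≡)
                 (trans (solve 4 (λ e t y s′ → t :+ (y :* s′ :+ e :* s′) := t :+ (e :+ y) :* s′)
                                refl e t′ y s′)
                        (cong (λ z → t′ + z * s′) (x-y+y x y)))))
          (x≤y+x (t′ + y * s′ + e * s) (*-nonneg (0≤y-x y≤x) 0≤d)))
        (subst (t′ + x * s′ ≤_)
          (trans (cong (λ z → t + z * s) (sym (x-y+y x y)))
                 (solve 4 (λ e t y s → t :+ (e :+ y) :* s := t :+ y :* s :+ e :* s) refl e t y s))
          le))
      where e = x - y

    steeper-below-before-crossing :
      0# < y → y ≤ (t - t′) / (s′ - s) → t′ + y * s′ ≤ t + y * s
    steeper-below-before-crossing {y} {t} {t′} 0<y le with d ≟ 0#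
    -- Parallel lines: the crossing is `0#`, and no positive `y` is at most that.
    ... | yes d≡0 = contradiction (subst (y ≤_) (y/0≡0 d≡0) le) (<⇒≱ 0<y)
    ... | no d≢0  = subst₂ _≤_
      (trans (solve 4 (λ y d s t → y :* d :+ (t :+ y :* s) := t :+ y :* (d :+ s)) refl y d s t′)
             (cong (λ u → t′ + y * u) s′≡))
      (trans (solve 4 (λ z t y s → z :+ (t :+ y :* s) := z :+ t :+ y :* s) refl (t - t′) t′ y s)
             (cong (_+ y * s) (x-y+y t t′)))
      (+-monoˡ-≤ (t′ + y * s) (x≤y/z⇒x*z≤y 0≤d d≢0 le))

    -- For parallel lines the crossing is the default `0#` and carries no information. There the
    -- comparison at `x` decides, since parallel lines keep their order everywhere.
    flatter-below-after-crossing :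
      t + x * s ≤ t′ + x * s′ → (t - t′) / (s′ - s) ≤ y → t + y * s ≤ t′ + y * s′
    flatter-below-after-crossing {t} {x} {t′} {y} le₀ le with d ≟ 0#
    ... | yes d≡0 rewrite sym (trans (sym (+-identityˡ s)) (trans (cong (_+ s) (sym d≡0)) s′≡)) =
      +-monoˡ-≤ (y * s) (+-cancelʳ-≤ (x * s) le₀)
    ... | no d≢0  = subst₂ _≤_
      (trans (solve 4 (λ z t y s → z :+ (t :+ y :* s) := z :+ t :+ y :* s) refl (t - t′) t′ y s)
             (cong (_+ y * s) (x-y+y t t′)))
      (trans (solve 4 (λ y d s t → y :* d :+ (t :+ y :* s) := t :+ y :* (d :+ s)) refl y d s t′)
             (cong (λ u → t′ + y * u) s′≡))
      (+-monoˡ-≤ (t′ + y * s) (y/z≤x⇒y≤x*z 0≤d d≢0 le))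

  1/x≡x⁻¹ : ∀ x → 1# / x ≡ x ⁻¹
  1/x≡x⁻¹ x = *-identityˡ (x ⁻¹)

-- Binary heaps with an arbitrary number of leaves.

-- Nodes are numbered as in a binary heap: the children of k are k + k and
-- 1 + (k + k), and with N leaves the leaves are N, …, N + N - 1.
module HeapTree where
  open import Data.Nat.Base
  open import Data.Nat.Properties

  infix 4 _≼_

  -- `u` is `a` or an ancestor of `a`. Halving the root gives 0, which is no node and has no node
  -- above it; a walk that has passed the root ends there.
  data _≼_ (u : ℕ) : ℕ → Set where
    here  : u ≼ u
    below : ∀ {a} → u ≼ ⌊ a /2⌋ → u ≼ a

  Leaf : ℕ → ℕ → Set
  Leaf N a = N ≤ a × a < N + N

  half-left : ∀ k → ⌊ k + k /2⌋ ≡ k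
  half-left k = sym (n≡⌊n+n/2⌋ k)

  half-right : ∀ k → ⌊ suc (k + k) /2⌋ ≡ k
  half-right k = sym (n≡⌈n+n/2⌉ k)

  left≼ : ∀ {k} → k ≼ k + k
  left≼ {k} = below (subst (k ≼_) (sym (half-left k)) here)

  right≼ : ∀ {k} → k ≼ suc (k + k)
  right≼ {k} = below (subst (k ≼_) (sym (half-right k)) here)

  ≼-trans : ∀ {u v w} → u ≼ v → v ≼ w → u ≼ w
  ≼-trans p here      = p
  ≼-trans p (below q) = below (≼-trans p q)

  ≼⇒≤ : ∀ {u a} → u ≼ a → u ≤ a
  ≼⇒≤ here      = ≤-refl
  ≼⇒≤ {a = a} (below p) = ≤-trans (≼⇒≤ p) (⌊n/2⌋≤n a)

  ≼-parent : ∀ {u a} → u ≼ a → u ≢ a → u ≼ ⌊ a /2⌋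
  ≼-parent here      u≢a = contradiction refl u≢a
  ≼-parent (below p) _   = p

  double-half : ∀ a → a ≡ ⌊ a /2⌋ + ⌊ a /2⌋ ⊎ a ≡ suc (⌊ a /2⌋ + ⌊ a /2⌋)
  double-half zero          = inj₁ refl
  double-half (suc zero)    = inj₂ refl
  double-half (suc (suc a)) with double-half a
  ... | inj₁ eq = inj₁ (cong suc (trans (cong suc eq) (sym (+-suc _ _))))
  ... | inj₂ eq = inj₂ (cong suc (trans (cong suc eq) (cong suc (sym (+-suc _ _)))))

  ≼-child : ∀ {k a} → k ≼ a → k ≢ a → k + k ≼ a ⊎ suc (k + k) ≼ a
  ≼-child here k≢a = contradiction refl k≢a
  ≼-child {k} {a} (below p) _ with k ≟ ⌊ a /2⌋
  ... | yes refl with double-half a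
  ...   | inj₁ eq = inj₁ (subst (k + k ≼_) (sym eq) here)
  ...   | inj₂ eq = inj₂ (subst (suc (k + k) ≼_) (sym eq) here)
  ≼-child {k} {a} (below p) _ | no k≢ with ≼-child p k≢
  ... | inj₁ q = inj₁ (below q)
  ... | inj₂ q = inj₂ (below q)

  k<k+k : ∀ {k} → 1 ≤ k → k < k + k
  k<k+k {suc k} _ = s≤s (m≤n+m (suc k) k)

  left<2N : ∀ {k N} → k < N → k + k < N + N
  left<2N k<N = +-mono-< k<N k<N

  right<2N : ∀ {k N} → k < N → suc (k + k) < N + N
  right<2N {k} {suc N} (s≤s k≤N) =
    s≤s (subst (suc (k + k) ≤_) (sym (+-suc N N)) (s≤s (+-mono-≤ k≤N k≤N)))

  right⋠ : ∀ {k} → 1 ≤ k → ¬ suc (k + k) ≼ k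
  right⋠ 1≤k p = <⇒≱ (k<k+k 1≤k) (≤-trans (n≤1+n _) (≼⇒≤ p))

  left⋠ : ∀ {k} → 1 ≤ k → ¬ k + k ≼ k
  left⋠ 1≤k p = <⇒≱ (k<k+k 1≤k) (≼⇒≤ p)

  half<N : ∀ N {a} → a < N + N → ⌊ a /2⌋ < N
  half<N (suc N) {a} lt = s≤s (≤-trans (⌊n/2⌋-mono (s≤s⁻¹ lt))
    (≤-reflexive (trans (cong ⌊_/2⌋ (+-suc N N)) (half-right N))))

  leaf-≼ : ∀ {N u a} → 1 ≤ N → Leaf N u → Leaf N a → u ≼ a → u ≡ a
  leaf-≼ 1≤N _ _ here = refl
  leaf-≼ {N} {u} {a} 1≤N (N≤u , _) (_ , a<2N) (below p) = contradiction
    (≤-trans N≤u (≼⇒≤ p))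
    (<⇒≱ (half<N N a<2N))
  ⋠0 : ∀ {u} → 1 ≤ u → ¬ u ≼ 0
  ⋠0 () here
  ⋠0 1≤u (below p) = ⋠0 1≤u p

  1≼ : ∀ n {a} → a ≤ n → 1 ≤ a → 1 ≼ a
  1≼ _ {1} _ _ = here
  1≼ (suc n) {suc (suc a)} (s≤s le) _ = below (1≼ n (≤-trans (s≤s (⌊n/2⌋≤n a)) le) (s≤s z≤n))

  root≼ : ∀ {a} → 1 ≤ a → 1 ≼ a
  root≼ {a} = 1≼ a ≤-refl

  2^suc : ∀ d → 2 ^ suc d ≡ 2 ^ d + 2 ^ d
  2^suc d = cong (2 ^ d +_) (+-identityʳ (2 ^ d))

  half-< : ∀ {k l} → k < 2 ^ suc l → ⌊ k /2⌋ < 2 ^ l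
  half-< {k} {l} lt = half<N (2 ^ l) (subst (k <_) (2^suc l) lt)

  *-2^suc : ∀ u d → u * 2 ^ suc d ≡ (u + u) * 2 ^ d
  *-2^suc u d = trans (cong (u *_) (2^suc d))
    (trans (*-distribˡ-+ u (2 ^ d) (2 ^ d)) (sym (*-distribʳ-+ (2 ^ d) u u)))

  -- With M = 2 ^ h, a node u at depth h - d covers the nodes u * 2 ^ d, …,
  -- suc u * 2 ^ d - 1 of the bottom level; the subtree relation becomes inclusion
  -- of these intervals.
  record Span (M u d : ℕ) : Set where
    field
      lower : M ≤ u * 2 ^ d
      upper : suc u * 2 ^ d ≤ M + M

  module _ {M : ℕ} where

    left-span : ∀ {u d} → Span M u (suc d) → Span M (u + u) d
    left-span {u} {d} sp = record
      { lower = subst (M ≤_) (*-2^suc u d) lower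
      ; upper = ≤-trans (*-monoˡ-≤ (2 ^ d) (s≤s (+-monoʳ-≤ u (n≤1+n u))))
                        (subst (_≤ M + M) (*-2^suc (suc u) d) upper)
      } where open Span sp

    right-span : ∀ {u d} → Span M u (suc d) → Span M (suc (u + u)) d
    right-span {u} {d} sp = record
      { lower = ≤-trans (subst (M ≤_) (*-2^suc u d) lower) (*-monoˡ-≤ (2 ^ d) (n≤1+n (u + u)))
      ; upper = subst (_≤ M + M) (trans (*-2^suc (suc u) d) (cong (λ z → suc z * 2 ^ d) (+-suc u u))) upper
      } where open Span sp

    span-child : ∀ {u d} → Span M u d → u + u < M + M → ∃[ d′ ] d ≡ suc d′
    span-child {u} {zero}  sp lt = contradiction
      (+-mono-≤ le le) (<⇒≱ lt)
      where
      le : M ≤ u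
      le = subst (M ≤_) (*-identityʳ u) (Span.lower sp)
    span-child {u} {suc d} sp lt = d , refl

    -- Each step down halves the interval, so it stays inside that of the ancestor. The bound on `p`
    -- keeps the exponent from running out before `p` is reached.
    span-≼ : ∀ {u d p} → Span M u d → u ≼ p → p < M + M →
             ∃[ e ] Span M p e × u * 2 ^ d ≤ p * 2 ^ e × suc p * 2 ^ e ≤ suc u * 2 ^ d
    span-≼ {d = d} sp here _ = d , sp , ≤-refl , ≤-refl
    span-≼ {u} {d} {p} sp (below q) p<2M
      with span-≼ sp q (≤-<-trans (⌊n/2⌋≤n p) p<2M)
    ... | e , sp′ , lo , hi
      with span-child sp′ (≤-<-trans (half+half≤ p) p<2M)
      where
      half+half≤ : ∀ p → ⌊ p /2⌋ + ⌊ p /2⌋ ≤ p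
      half+half≤ p with double-half p
      ... | inj₁ eq = ≤-reflexive (sym eq)
      ... | inj₂ eq = ≤-trans (n≤1+n _) (≤-reflexive (sym eq))
    ... | e′ , refl with double-half p
    ... | inj₁ eq = e′ , subst (λ z → Span M z e′) (sym eq) sp″
        , ≤-trans lo (≤-reflexive (trans (*-2^suc ⌊ p /2⌋ e′) (cong (_* 2 ^ e′) (sym eq))))
        , ≤-trans (subst (λ z → suc z * 2 ^ e′ ≤ suc ⌊ p /2⌋ * 2 ^ suc e′) (sym eq)
                    (≤-trans (*-monoˡ-≤ (2 ^ e′) (s≤s (+-monoʳ-≤ ⌊ p /2⌋ (n≤1+n _))))
                             (≤-reflexive (sym (*-2^suc (suc ⌊ p /2⌋) e′))))) hi
        where sp″ = left-span sp′
    ... | inj₂ eq = e′ , subst (λ z → Span M z e′) (sym eq) sp″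
        , ≤-trans lo (≤-trans (≤-reflexive (*-2^suc ⌊ p /2⌋ e′))
                       (*-monoˡ-≤ (2 ^ e′) (≤-trans (n≤1+n _) (≤-reflexive (sym eq)))))
        , ≤-trans (subst (λ z → suc z * 2 ^ e′ ≤ suc ⌊ p /2⌋ * 2 ^ suc e′) (sym eq)
                    (≤-reflexive (trans (cong (λ z → suc z * 2 ^ e′) (sym (+-suc ⌊ p /2⌋ ⌊ p /2⌋)))
                                        (sym (*-2^suc (suc ⌊ p /2⌋) e′))))) hi
        where sp″ = right-span sp′

    -- The position of a leaf from left to right: the leaves of the bottom level,
    -- which are those from M on, come first.
    pos : ℕ → ℕ → ℕ
    pos N p with M ≤? p
    ... | yes _ = p ∸ M
    ... | no  _ = (p + N) ∸ M

    module _ {N h} (M≡2^h : M ≡ 2 ^ h) (N≤M : N ≤ M) (M<2N : M < N + N) where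

      root-span : Span M 1 h
      root-span = record
        { lower = ≤-reflexive (trans M≡2^h (sym (*-identityˡ (2 ^ h))))
        ; upper = ≤-reflexive (cong₂ _+_ (sym M≡2^h) (trans (+-identityʳ _) (sym M≡2^h)))
        }

      leaf-span : ∀ {p d} → Leaf N p → Span M p d →
                  (M ≤ p × d ≡ 0) ⊎ (p < M × d ≡ 1)
      leaf-span {p} {zero} _ sp = inj₁ (subst (M ≤_) (*-identityʳ p) (Span.lower sp) , refl)
      leaf-span {p} {suc zero} _ sp = inj₂ (p<M , refl)
        where
        p<M : p < M
        p<M with p <? M
        ... | yes lt = lt
        ... | no ≮ = contradiction (Span.upper sp) (<⇒≱ (≤-trans
              (+-mono-<-≤ (s≤s (≮⇒≥ ≮)) (≤-trans (≮⇒≥ ≮) (n≤1+n p)))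
              (≤-reflexive (sym (trans (*-2^suc (suc p) 0) (*-identityʳ (suc p + suc p)))))))
      -- The interval would end at `4 * suc p` or later, but `2 * suc p` exceeds `M` for a leaf, so
      -- it would reach past `M + M`.
      leaf-span {p} {suc (suc d)} (N≤p , _) sp = contradiction (Span.upper sp)
        (<⇒≱ (<-≤-trans (+-mono-< M<2p+2 M<2p+2) (≤-trans
          (≤-trans (≤-reflexive (sym (*-identityʳ _))) (*-monoʳ-≤ (suc p + suc p + (suc p + suc p)) (m^n>0 2 d)))
          (≤-reflexive (sym (trans (*-2^suc (suc p) (suc d)) (*-2^suc (suc p + suc p) d)))))))
        where
        M<2p+2 : M < suc p + suc p
        M<2p+2 = <-≤-trans M<2N (+-mono-≤ (≤-trans N≤p (n≤1+n p)) (≤-trans N≤p (n≤1+n p)))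

      private
        pos-mono : ∀ {a b d e} → Leaf N a → Leaf N b → Span M a d → Span M b e →
                   suc a * 2 ^ d ≤ b * 2 ^ e → pos N a ≤ pos N b
        pos-mono {a} {b} la lb sa sb le with leaf-span la sa | leaf-span lb sb | M ≤? a | M ≤? b
        ... | inj₁ (M≤a , _) | _ | no M≰a | _ = contradiction M≤a M≰a
        ... | inj₂ (a<M , _) | _ | yes M≤a | _ = contradiction M≤a (<⇒≱ a<M)
        ... | _ | inj₁ (M≤b , _) | _ | no M≰b = contradiction M≤b M≰b
        ... | _ | inj₂ (b<M , _) | _ | yes M≤b = contradiction M≤b (<⇒≱ b<M)
        ... | inj₁ (M≤a , refl) | inj₁ (M≤b , refl) | yes _ | yes _ =
          ∸-monoˡ-≤ M (≤-trans (n≤1+n a) (subst₂ _≤_ (*-identityʳ (suc a)) (*-identityʳ b) le))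
        ... | inj₁ (M≤a , refl) | inj₂ (b<M , refl) | yes _ | no _ =
          ∸-monoˡ-≤ M (≤-trans (<⇒≤ (proj₂ la)) (+-monoˡ-≤ N (proj₁ lb)))
        -- No leaf above the bottom level lies to the left of one on it: its interval ends at
        -- `2 * suc a`, which is larger than every leaf number.
        ... | inj₂ (a<M , refl) | inj₁ (M≤b , refl) | no _ | yes _ = contradiction
          (subst₂ _≤_ (trans (*-2^suc (suc a) 0) (*-identityʳ (suc a + suc a))) (*-identityʳ b) le)
          (<⇒≱ (<-≤-trans (proj₂ lb) (+-mono-≤ (≤-trans (proj₁ la) (n≤1+n a)) (≤-trans (proj₁ la) (n≤1+n a)))))
        ... | inj₂ (a<M , refl) | inj₂ (b<M , refl) | no _ | no _ =
          ∸-monoˡ-≤ M (+-monoˡ-≤ N (≤-trans (n≤1+n a) (*-cancelʳ-≤ (suc a) b 2 le)))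

      leaf<2M : ∀ {a} → Leaf N a → a < M + M
      leaf<2M (_ , lt) = <-≤-trans lt (+-mono-≤ N≤M N≤M)

      -- The intervals of the two children of `u` are adjacent, the left one first. The leaves below
      -- inherit this order, and `pos` is monotone along it.
      pos-ordered : ∀ {u a b} → 1 ≤ u → u < N → Leaf N a → Leaf N b →
                    u + u ≼ a → suc (u + u) ≼ b → pos N a ≤ pos N b
      pos-ordered {u} {a} {b} 1≤u u<N la lb ul ur
        with span-≼ root-span (root≼ 1≤u) (<-≤-trans u<N (≤-trans N≤M (m≤m+n M M)))
      ... | d , su , _ , _ with span-child su (left<2N (<-≤-trans u<N N≤M))
      ... | d′ , refl with span-≼ (left-span su) ul (leaf<2M la) | span-≼ (right-span su) ur (leaf<2M lb)
      ... | _ , sa , _ , hi | _ , sb , lo , _ = pos-mono la lb sa sb (≤-trans hi lo)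

      pos< : ∀ {p} → Leaf N p → pos N p < N
      pos< {p} (N≤p , p<2N) with M ≤? p
      ... | yes M≤p = +-cancelʳ-< M _ _ (subst (_< N + M) (sym (m∸n+n≡m M≤p)) (<-≤-trans p<2N (+-monoʳ-≤ N N≤M)))
      ... | no M≰p = +-cancelʳ-< M _ _ (subst (_< N + M) (sym (m∸n+n≡m M≤p+N))
              (subst (p + N <_) (+-comm M N) (+-monoˡ-< N (≰⇒> M≰p))))
        where M≤p+N = ≤-trans (<⇒≤ M<2N) (+-monoˡ-≤ N N≤p)

      pos-injective : ∀ {p q} → Leaf N p → Leaf N q → pos N p ≡ pos N q → p ≡ q
      pos-injective {p} {q} (N≤p , p<2N) (N≤q , q<2N) eq with M ≤? p | M ≤? q
      ... | yes M≤p | yes M≤q = ∸-cancelʳ-≡ M≤p M≤q eq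
      ... | no _ | no _ = +-cancelʳ-≡ N p q (∸-cancelʳ-≡ (M≤ N≤p) (M≤ N≤q) eq)
        where
        M≤ : ∀ {p} → N ≤ p → M ≤ p + N
        M≤ N≤p = ≤-trans (<⇒≤ M<2N) (+-monoˡ-≤ N N≤p)
      ... | yes M≤p | no _ = contradiction
        (∸-cancelʳ-≡ M≤p (≤-trans (<⇒≤ M<2N) (+-monoˡ-≤ N N≤q)) eq)
        (<⇒≢ (<-≤-trans p<2N (+-monoˡ-≤ N N≤q)))
      ... | no _ | yes M≤q = contradiction
        (∸-cancelʳ-≡ M≤q (≤-trans (<⇒≤ M<2N) (+-monoˡ-≤ N N≤p)) (sym eq))
        (<⇒≢ (<-≤-trans q<2N (+-monoˡ-≤ N N≤p)))

      pos-surjective : ∀ {i} → i < N → ∃[ p ] Leaf N p × pos N p ≡ i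
      pos-surjective {i} i<N with M + i <? N + N
      ... | yes lt = M + i , (≤-trans N≤M (m≤m+n M i) , lt) , eq
        where
        eq : pos N (M + i) ≡ i
        eq with M ≤? M + i
        ... | yes _ = m+n∸m≡n M i
        ... | no ≰ = contradiction (m≤m+n M i) ≰
      ... | no ≮ = p , (N≤p , <-≤-trans p<M (<⇒≤ M<2N)) , eq
        where
        p = (M + i) ∸ N
        N≤M+i = ≤-trans N≤M (m≤m+n M i)
        p+N≡ : p + N ≡ M + i
        p+N≡ = m∸n+n≡m N≤M+i
        N≤p : N ≤ p
        N≤p = +-cancelʳ-≤ N N p (≤-trans (≮⇒≥ ≮) (≤-reflexive (sym p+N≡)))
        p<M : p < M
        p<M = +-cancelʳ-< N p M (subst (_< M + N) (sym p+N≡) (+-monoʳ-< M i<N))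
        eq : pos N p ≡ i
        eq with M ≤? p
        ... | yes M≤p = contradiction M≤p (<⇒≱ p<M)
        ... | no _ = trans (cong (_∸ M) p+N≡) (m+n∸m≡n M i)

    pos-bottom : ∀ {N p} → M ≤ p → pos N p ≡ p ∸ M
    pos-bottom {p = p} M≤p with M ≤? p
    ... | yes _  = refl
    ... | no M≰p = contradiction M≤p M≰p

    pos-upper : ∀ {N p} → ¬ M ≤ p → pos N p ≡ (p + N) ∸ M
    pos-upper {p = p} M≰p with M ≤? p
    ... | yes M≤p = contradiction M≤p M≰p
    ... | no _    = refl

-- Which nodes are correct while others are replayed.

module Replaying (N : ℕ) where
  open import Data.Nat.Base
  open import Data.Nat.Properties
  open HeapTree

  -- Replaying k turns the set Done of correct nodes into Done′. The parent of k
  -- depends on k, so it is not in Done′.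
  record Step (Done Done′ : ℕ → Set) (k : ℕ) : Set where
    field
      1≤k        : 1 ≤ k
      k<N        : k < N
      left-done  : Done (k + k)
      right-done : Done (suc (k + k))
      earlier    : ∀ {u} → 1 ≤ u → Done′ u → u ≢ k → Done u × k ≢ u + u × k ≢ suc (u + u)

  Everywhere : ℕ → Set
  Everywhere _ = ⊤

  -- Starting from the parent of `p` makes `p` itself count as correct: once `p` has been replayed,
  -- only its proper ancestors are suspect.
  Beside : ℕ → ℕ → Set
  Beside p u = ¬ u ≼ ⌊ p /2⌋

  ascend-step : ∀ {p} → 2 ≤ p → p < N + N → Step (Beside p) (Beside ⌊ p /2⌋) ⌊ p /2⌋
  ascend-step {p} 2≤p p<2N = record
    { 1≤k = 1≤k
    ; k<N = half<N N p<2N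
    ; left-done = left⋠ 1≤k
    ; right-done = right⋠ 1≤k
    ; earlier = λ {u} 1≤u beside u≢k →
        (λ u≼k → beside (≼-parent u≼k u≢k)) ,
        (λ eq → beside (subst (u ≼_) (sym (trans (cong ⌊_/2⌋ eq) (half-left u))) here)) ,
        (λ eq → beside (subst (u ≼_) (sym (trans (cong ⌊_/2⌋ eq) (half-right u))) here))
    }
    where 1≤k = ⌊n/2⌋-mono 2≤p

  -- Children have larger numbers than their parent, so with falling `k` both children are done
  -- before `k` is.
  build-step : ∀ {k} → 1 ≤ k → k < N → Step (suc k ≤_) (k ≤_) k
  build-step {k} 1≤k k<N = record
    { 1≤k = 1≤k ; k<N = k<N ; left-done = k<k+k 1≤k ; right-done = m≤n⇒m≤1+n (k<k+k 1≤k)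
    ; earlier = λ 1≤u k≤u u≢k → ≤∧≢⇒< k≤u (≢-sym u≢k) ,
        <⇒≢ (≤-<-trans k≤u (k<k+k 1≤u)) , <⇒≢ (≤-<-trans k≤u (m≤n⇒m≤1+n (k<k+k 1≤u))) }

-- Updates of functions, and counting bits.

module Update where
  open import Data.Bool.Base using (Bool; true; false; if_then_else_; T)
  open import Data.Nat.Base
  open import Data.Nat.Properties

  infixl 9 _[_↦_]

  -- Written like the update of a memory, so that a block of an updated memory is, by mere
  -- computation, an update in this sense.
  _[_↦_] : ∀ {a} {A : Set a} → (ℕ → A) → ℕ → A → ℕ → A
  (f [ k ↦ x ]) j = if k ≡ᵇ j then x else f j

  module _ {a} {A : Set a} {f : ℕ → A} {x : A} where

    ↦-at : ∀ k → (f [ k ↦ x ]) k ≡ x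
    ↦-at k with k ≡ᵇ k in eq
    ... | true  = refl
    ... | false = contradiction (subst T eq (≡⇒≡ᵇ k k refl)) id

    ↦-off : ∀ {k j} → k ≢ j → (f [ k ↦ x ]) j ≡ f j
    ↦-off {k} {j} k≢j with k ≡ᵇ j in eq
    ... | false = refl
    ... | true  = contradiction (≡ᵇ⇒≡ k j (subst T (sym eq) _)) k≢j

  bit : Bool → ℕ
  bit true  = 1
  bit false = 0

  bit≤1 : ∀ b → bit b ≤ 1
  bit≤1 true  = ≤-refl
  bit≤1 false = z≤n

  count : (ℕ → Bool) → ℕ → ℕ
  count f zero    = 0
  count f (suc n) = bit (f n) + count f n

  count-mono : ∀ {f g} n → (∀ u → u < n → bit (f u) ≤ bit (g u)) → count f n ≤ count g n
  count-mono zero    _  = z≤n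
  count-mono (suc n) le = +-mono-≤ (le n ≤-refl) (count-mono n (λ u u<n → le u (m≤n⇒m≤1+n u<n)))

  count≤ : ∀ f n → count f n ≤ n
  count≤ f zero    = z≤n
  count≤ f (suc n) = +-mono-≤ (bit≤1 (f n)) (count≤ f n)

  bit-↦-≤ : ∀ {f : ℕ → Bool} {k b} → bit b ≤ bit (f k) → ∀ u → bit ((f [ k ↦ b ]) u) ≤ bit (f u)
  bit-↦-≤ {f} {k} {b} le u with k ≟ u
  ... | yes refl = ≤-trans (≤-reflexive (cong bit (↦-at {f = f} k))) le
  ... | no k≢u   = ≤-reflexive (cong bit (↦-off {f = f} k≢u))

  count-↦ : ∀ f k b n → count (f [ k ↦ b ]) n ≤ suc (count f n)
  count-↦ f k b zero = z≤n
  count-↦ f k b (suc n) with k ≟ n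
  ... | yes refl = +-mono-≤ (bit≤1 ((f [ k ↦ b ]) k)) (≤-trans (count-mono n below) (m≤n+m _ (bit (f n))))
    where
    below : ∀ u → u < n → bit ((f [ k ↦ b ]) u) ≤ bit (f u)
    below u u<n = ≤-reflexive (cong bit (↦-off {f = f} (≢-sym (<⇒≢ u<n))))
  ... | no k≢n = ≤-trans
    (+-mono-≤ (≤-reflexive (cong bit (↦-off {f = f} k≢n))) (count-↦ f k b n))
    (≤-reflexive (+-suc (bit (f n)) _))

  count-↦-drop : ∀ f k n → k < n → f k ≡ true → suc (count (f [ k ↦ false ]) n) ≤ count f n
  count-↦-drop f k (suc n) k<1+n fk with k ≟ n
  ... | yes refl rewrite ↦-at {f = f} {false} k | fk =
    s≤s (count-mono k λ u u<k → ≤-reflexive (cong bit (↦-off {f = f} (≢-sym (<⇒≢ u<k)))))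
  ... | no k≢n = ≤-trans
    (≤-reflexive (sym (+-suc _ _)))
    (+-mono-≤ (≤-reflexive (cong bit (↦-off {f = f} k≢n)))
              (count-↦-drop f k n (≤∧≢⇒< (s≤s⁻¹ k<1+n) k≢n) fk))

-- The kinetic tournament: invariants and potential.

module KineticTournament {c ℓ} (F : OrderedField c ℓ) (N : ℕ) where
  open import Data.Bool.Base using (Bool; true; false)
  open import Data.Nat.Base hiding (_/_; _⊔_)
  open import Data.Nat.Properties
  open OrderedField F using (Carrier; 0#; 1#; _/_; _-_)
    renaming (_≤_ to _≤ᶠ_; _<_ to _<ᶠ_; _+_ to _+ᶠ_)
  private module Fᴾ = OrderedFieldProperties F
  open HeapTree
  open Replaying N
  open Update

  record Contest : Set c where
    field
      load speed : ℕ → Carrier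
      winner     : ℕ → ℕ
      failure    : ℕ → Carrier
      now        : Carrier

    val : Carrier → ℕ → Carrier
    val y p = load p +ᶠ y / speed p

    -- The job size at which `p` and `q` would finish together. Slopes appear as `1# / speed`, the
    -- expression that the program evaluates.
    crossing : ℕ → ℕ → Carrier
    crossing p q = (load p - load q) / (1# / speed q - 1# / speed p)

  open Contest

  -- A winner is trusted as long as the job size stays above the failure size of
  -- its node.
  record Trusted (D : Contest) (u : ℕ) : Set (c ⊔ ℓ) where
    field
      leaf  : Leaf N (winner D u)
      under : u ≼ winner D u
      best  : ∀ {y} → failure D u <ᶠ y → y ≤ᶠ now D → ∀ {a} → Leaf N a → u ≼ a →
              val D y (winner D u) ≤ᶠ val D y a

  -- The possible reasons for a failure: a child fails, or the left winner has been overtaken. In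
  -- the second case the bit is still set, so the repair of a node whose children are sound can be
  -- paid for by clearing it.
  Caused : Contest → Bool → ℕ → Set (c ⊔ ℓ)
  Caused D b u = ∀ {y} → 0# <ᶠ y → y ≤ᶠ now D → y ≤ᶠ failure D u →
    y ≤ᶠ failure D (u + u) ⊎ y ≤ᶠ failure D (suc (u + u)) ⊎
    (b ≡ true × val D y (winner D (suc (u + u))) ≤ᶠ val D y (winner D (u + u)))

  -- b ≡ false records that the right subtree has taken over for good.
  TakenOver : Contest → Bool → ℕ → Set (c ⊔ ℓ)
  TakenOver D b u = b ≡ false → ∀ {y} → y ≤ᶠ now D → ∀ {a} → Leaf N a → u + u ≼ a →
    ∃[ p ] Leaf N p × suc (u + u) ≼ p × val D y p ≤ᶠ val D y a

  record LeavesSet (D : Contest) : Set (c ⊔ ℓ) where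
    field
      1≤N       : 1 ≤ N
      0<speed   : ∀ {p} → Leaf N p → 0# <ᶠ speed D p
      sorted    : ∀ {u a b} → 1 ≤ u → u < N → Leaf N a → Leaf N b →
                  u + u ≼ a → suc (u + u) ≼ b → speed D b ≤ᶠ speed D a
      winner≡   : ∀ {p} → Leaf N p → winner D p ≡ p
      failure≡0 : ∀ {p} → Leaf N p → failure D p ≡ 0#

  -- One constructor for each way through a recomputation, with the results of the tests on that
  -- way. Only `left` involves the crossing: a steeper line that is below needs no further watching
  -- as jobs get smaller.
  data Outcome (D : Contest) (k w : ℕ) (f : Carrier) : Set (c ⊔ ℓ) where
    stalled : w ≡ winner D (k + k) → now D ≤ᶠ f →
              f ≡ failure D (k + k) ⊎ f ≡ failure D (suc (k + k)) → Outcome D k w f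
    right   : w ≡ winner D (suc (k + k)) → ¬ now D ≤ᶠ f →
              f ≡ failure D (k + k) ⊎ f ≡ failure D (suc (k + k)) →
              failure D (k + k) ≤ᶠ f → failure D (suc (k + k)) ≤ᶠ f →
              val D (now D) (winner D (suc (k + k))) ≤ᶠ val D (now D) (winner D (k + k)) →
              Outcome D k w f
    left    : w ≡ winner D (k + k) →
              ¬ now D ≤ᶠ failure D (k + k) → ¬ now D ≤ᶠ failure D (suc (k + k)) →
              failure D (k + k) ≤ᶠ f → failure D (suc (k + k)) ≤ᶠ f →
              crossing D (winner D (k + k)) (winner D (suc (k + k))) ≤ᶠ f →
              f ≡ failure D (k + k) ⊎ f ≡ failure D (suc (k + k)) ⊎
                f ≡ crossing D (winner D (k + k)) (winner D (suc (k + k))) →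
              ¬ val D (now D) (winner D (suc (k + k))) ≤ᶠ val D (now D) (winner D (k + k)) →
              Outcome D k w f

  -- An undecided node keeps its bit: the stored winner is meaningless, and setting the bit would
  -- raise the potential with nothing to pay for it.
  sideAfter : ∀ {D k w f} → Bool → Outcome D k w f → Bool
  sideAfter b (stalled _ _ _)         = b
  sideAfter b (right _ _ _ _ _ _)     = false
  sideAfter b (left _ _ _ _ _ _ _ _)  = true

  replay : Contest → ℕ → ℕ → Carrier → Contest
  replay D k w f = record
    { load = load D ; speed = speed D ; now = now D
    ; winner = winner D [ k ↦ w ] ; failure = failure D [ k ↦ f ] }

  module _ {D : Contest} (L : LeavesSet D) where
    open LeavesSet L
    open Trusted

    leaf-trusted : ∀ {p} → Leaf N p → Trusted D p
    leaf-trusted {p} lp = record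
      { leaf = subst (Leaf N) (sym (winner≡ lp)) lp
      ; under = subst (p ≼_) (sym (winner≡ lp)) here
      ; best = λ _ _ {a} la p≼a → Fᴾ.≤-reflexive
          (cong (val D _) (trans (winner≡ lp) (leaf-≼ 1≤N lp la p≼a)))
      }

    slopes : ∀ {u a b} → 1 ≤ u → u < N → Leaf N a → Leaf N b →
             u + u ≼ a → suc (u + u) ≼ b → OrderedField._⁻¹ F (speed D a) ≤ᶠ OrderedField._⁻¹ F (speed D b)
    slopes 1≤u u<N la lb ua ub = Fᴾ.⁻¹-anti-≤ (0<speed lb) (sorted 1≤u u<N la lb ua ub)

    crossing≡ : ∀ p q → crossing D p q ≡
      (load D p - load D q) / (OrderedField._⁻¹ F (speed D q) - OrderedField._⁻¹ F (speed D p))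
    crossing≡ p q = cong₂ (λ a b → (load D p - load D q) / (a - b)) (Fᴾ.1/x≡x⁻¹ _) (Fᴾ.1/x≡x⁻¹ _)

    module _ {k} (1≤k : 1 ≤ k) (k<N : k < N)
             (tl : Trusted D (k + k)) (tr : Trusted D (suc (k + k))) where

      private
        l = winner D (k + k)
        r = winner D (suc (k + k))
        sl = slopes 1≤k k<N (leaf tl) (leaf tr) (under tl) (under tr)

      module _ {w : ℕ} {f : Carrier} where

        private D′ = replay D k w f

        private
          winner′ : winner D′ k ≡ w
          winner′ = ↦-at {f = winner D} k
          failure′ : failure D′ k ≡ f
          failure′ = ↦-at {f = failure D} k

          under-left : ∀ {a} → k + k ≼ a → k ≼ a
          under-left = ≼-trans left≼
          under-right : ∀ {a} → suc (k + k) ≼ a → k ≼ a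
          under-right = ≼-trans right≼

          split : ∀ {a} → Leaf N a → k ≼ a → k + k ≼ a ⊎ suc (k + k) ≼ a
          split la k≼a = ≼-child k≼a (<⇒≢ (<-≤-trans k<N (proj₁ la)))

          trusted-w : Leaf N w → k ≼ w →
                      (∀ {y} → f <ᶠ y → y ≤ᶠ now D → ∀ {a} → Leaf N a → k ≼ a → val D y w ≤ᶠ val D y a) →
                      Trusted D′ k
          trusted-w lw uw bw = record
            { leaf  = subst (Leaf N) (sym winner′) lw
            ; under = subst (k ≼_) (sym winner′) uw
            ; best  = λ f<y y≤x {a} la ua → subst (λ z → val D _ z ≤ᶠ val D _ a) (sym winner′)
                        (bw (subst (_<ᶠ _) failure′ f<y) y≤x la ua) }

          best-of : ∀ {y} → f <ᶠ y → y ≤ᶠ now D →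
                    failure D (k + k) ≤ᶠ f → failure D (suc (k + k)) ≤ᶠ f →
                    val D y w ≤ᶠ val D y l → val D y w ≤ᶠ val D y r →
                    ∀ {a} → Leaf N a → k ≼ a → val D y w ≤ᶠ val D y a
          best-of f<y y≤x fl fr wl wr la ua with split la ua
          ... | inj₁ q = Fᴾ.≤-trans wl (best tl (Fᴾ.≤-<-trans fl f<y) y≤x la q)
          ... | inj₂ q = Fᴾ.≤-trans wr (best tr (Fᴾ.≤-<-trans fr f<y) y≤x la q)

        trusted-after : Outcome D k w f → Trusted D′ k
        -- No size lies above `f` and at most at `now`, so the stored winner has nothing to satisfy.
        trusted-after (stalled refl x≤f _) = trusted-w (leaf tl) (under-left (under tl))
          (λ f<y y≤x → contradiction (Fᴾ.≤-trans y≤x x≤f) (Fᴾ.<⇒≱ f<y))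
        trusted-after (right refl _ _ fl fr r≤l) = trusted-w (leaf tr) (under-right (under tr))
          (λ f<y y≤x → best-of f<y y≤x fl fr (Fᴾ.steeper-stays-below sl y≤x r≤l) Fᴾ.≤-refl)
        trusted-after (left refl _ _ fl fr fc _ r≰l) = trusted-w (leaf tl) (under-left (under tl))
          (λ f<y y≤x → best-of f<y y≤x fl fr Fᴾ.≤-refl
            (Fᴾ.flatter-below-after-crossing sl (Fᴾ.≰⇒≥ r≰l)
              (Fᴾ.≤-trans (Fᴾ.≤-reflexive (sym (crossing≡ l r))) (Fᴾ.≤-trans fc (proj₁ f<y)))))

        private
          child-failure : ∀ {j} → j ≢ k → failure D′ j ≡ failure D j
          child-failure j≢k = ↦-off {f = failure D} (≢-sym j≢k)
          child-winner : ∀ {j} → j ≢ k → winner D′ j ≡ winner D j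
          child-winner j≢k = ↦-off {f = winner D} (≢-sym j≢k)
          l≢ : k + k ≢ k
          l≢ = ≢-sym (<⇒≢ (k<k+k 1≤k))
          r≢ : suc (k + k) ≢ k
          r≢ = ≢-sym (<⇒≢ (m≤n⇒m≤1+n (k<k+k 1≤k)))

        -- A failure size that is not inherited from a child is the crossing, and this occurs only
        -- in the outcome `left`, which sets the bit.
        caused-after : (o : Outcome D k w f) → ∀ b → Caused D′ (sideAfter b o) k
        caused-after o b {y} 0<y y≤x y≤f
          rewrite child-failure l≢ | child-failure r≢ | child-winner l≢ | child-winner r≢ | failure′
          = from o
          where
          from : (o : Outcome D k w f) →
            y ≤ᶠ failure D (k + k) ⊎ y ≤ᶠ failure D (suc (k + k)) ⊎
            (sideAfter b o ≡ true × val D y r ≤ᶠ val D y l)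
          from (stalled _ _ (inj₁ refl))          = inj₁ y≤f
          from (stalled _ _ (inj₂ refl))          = inj₂ (inj₁ y≤f)
          from (right _ _ (inj₁ refl) _ _ _)      = inj₁ y≤f
          from (right _ _ (inj₂ refl) _ _ _)      = inj₂ (inj₁ y≤f)
          from (left _ _ _ _ _ _ (inj₁ refl) _)         = inj₁ y≤f
          from (left _ _ _ _ _ _ (inj₂ (inj₁ refl)) _)  = inj₂ (inj₁ y≤f)
          from (left _ _ _ _ _ _ (inj₂ (inj₂ refl)) _)  = inj₂ (inj₂ (refl ,
            Fᴾ.steeper-below-before-crossing sl 0<y (Fᴾ.≤-trans y≤f (Fᴾ.≤-reflexive (crossing≡ l r)))))

        takenOver-after : (o : Outcome D k w f) → ∀ {b} → TakenOver D b k → TakenOver D′ (sideAfter b o) k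
        takenOver-after (stalled _ _ _) t eq = t eq
        takenOver-after (left _ _ _ _ _ _ _ _) t ()
        -- At `now` the right winner beats the left one, which is trusted there and beats every left
        -- leaf. The slopes carry this down to all smaller sizes.
        takenOver-after (right refl x≰f _ fl fr r≤l) t _ y≤x la ua = w , leaf tr , under tr ,
          Fᴾ.steeper-stays-below (slopes 1≤k k<N la (leaf tr) ua (under tr)) y≤x
            (Fᴾ.≤-trans r≤l (best tl (Fᴾ.≤-<-trans fl (Fᴾ.≰⇒> x≰f)) Fᴾ.≤-refl la ua))

        -- The outcome `left` cannot follow a takeover: some right leaf does at least as well as the
        -- left winner, hence so does the right winner, which is trusted at `now`.
        side-decreases : (o : Outcome D k w f) → ∀ {b} → TakenOver D b k → bit (sideAfter b o) ≤ bit b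
        side-decreases (stalled _ _ _)         t = ≤-refl
        side-decreases (right _ _ _ _ _ _)     t = z≤n
        side-decreases (left _ _ _ _ _ _ _ _) {true} t = ≤-refl
        side-decreases (left _ _ x≰fr _ _ _ _ r≰l) {false} t
          with t refl Fᴾ.≤-refl (leaf tl) (under tl)
        ... | p , lp , up , p≤l = contradiction
          (Fᴾ.≤-trans (best tr (Fᴾ.≰⇒> x≰fr) Fᴾ.≤-refl lp up) p≤l) r≰l

        -- A node that fails while its children do not is handed over to the right.
        hand-over : (o : Outcome D k w f) → ∀ {b} →
                    0# <ᶠ now D → Caused D b k → now D ≤ᶠ failure D k →
                    ¬ now D ≤ᶠ failure D (k + k) → ¬ now D ≤ᶠ failure D (suc (k + k)) →
                    b ≡ true × sideAfter b o ≡ false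
        hand-over o 0<x caused x≤f x≰fl x≰fr with caused 0<x Fᴾ.≤-refl x≤f
        ... | inj₁ x≤fl        = contradiction x≤fl x≰fl
        ... | inj₂ (inj₁ x≤fr) = contradiction x≤fr x≰fr
        ... | inj₂ (inj₂ (b≡ , r≤l)) = b≡ , to-right o
          where
          to-right : ∀ {b} (o : Outcome D k w f) → sideAfter b o ≡ false
          to-right (stalled _ x≤f′ (inj₁ refl)) = contradiction x≤f′ x≰fl
          to-right (stalled _ x≤f′ (inj₂ refl)) = contradiction x≤f′ x≰fr
          to-right (right _ _ _ _ _ _)          = refl
          to-right (left _ _ _ _ _ _ _ r≰l)     = contradiction r≤l r≰l
  record Nodes (Done : ℕ → Set) (D : Contest) (side : ℕ → Bool) : Set (c ⊔ ℓ) where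
    field
      trusted : ∀ {u} → 1 ≤ u → u < N → Done u → Trusted D u
      caused  : ∀ {u} → 1 ≤ u → u < N → Done u → Caused D (side u) u

  Takeovers : (Done : ℕ → Set) → Contest → (ℕ → Bool) → Set (c ⊔ ℓ)
  Takeovers Done D side = ∀ {u} → 1 ≤ u → u < N → Done u → TakenOver D (side u) u

  open Nodes

  trusted-node : ∀ {Done D side} → LeavesSet D → Nodes Done D side →
                 ∀ {u} → 1 ≤ u → u < N + N → (u < N → Done u) → Trusted D u
  trusted-node L ns {u} 1≤u u<2N done with u <? N
  ... | yes u<N = trusted ns 1≤u u<N (done u<N)
  ... | no u≮N  = leaf-trusted L (≮⇒≥ u≮N , u<2N)

  replay-leaves : ∀ {D k w f} → k < N → LeavesSet D → LeavesSet (replay D k w f)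
  replay-leaves {D} {k} k<N L = record
    { 1≤N = 1≤N ; 0<speed = 0<speed ; sorted = sorted
    ; winner≡ = λ lp → trans (↦-off {f = winner D} (k≢ lp)) (winner≡ lp)
    ; failure≡0 = λ lp → trans (↦-off {f = failure D} (k≢ lp)) (failure≡0 lp) }
    where
    open LeavesSet L
    k≢ : ∀ {p} → Leaf N p → k ≢ p
    k≢ (N≤p , _) = <⇒≢ (<-≤-trans k<N N≤p)

  module _ {Done Done′ : ℕ → Set} {D side k w f} (L : LeavesSet D) (ns : Nodes Done D side)
           (st : Step Done Done′ k) (o : Outcome D k w f) where
    open Step st

    private
      tl = trusted-node L ns (≤-trans 1≤k (m≤m+n k k)) (left<2N k<N) (λ _ → left-done)
      tr = trusted-node L ns (s≤s z≤n) (right<2N k<N) (λ _ → right-done)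

    module _ (b : Bool) where

      private
        D′    = replay D k w f
        side′ = side [ k ↦ sideAfter b o ]

      replay-nodes : Nodes Done′ D′ side′
      replay-nodes = record { trusted = trusted′ ; caused = caused′ }
        where
        trusted′ : ∀ {u} → 1 ≤ u → u < N → Done′ u → Trusted D′ u
        trusted′ {u} 1≤u u<N done with k ≟ u
        ... | yes refl = trusted-after L 1≤k k<N tl tr o
        ... | no k≢u = record
          { leaf  = subst (Leaf N) (sym w≡) leaf
          ; under = subst (u ≼_) (sym w≡) under
          ; best  = λ f<y y≤x {a} la ua → subst (λ z → val D _ z ≤ᶠ val D _ a) (sym w≡)
              (best (subst (_<ᶠ _) f≡ f<y) y≤x la ua) }
          where
          open Trusted (trusted ns 1≤u u<N (proj₁ (earlier 1≤u done (≢-sym k≢u))))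
          w≡ = ↦-off {f = winner D} {w} k≢u
          f≡ = ↦-off {f = failure D} {f} k≢u
        caused′ : ∀ {u} → 1 ≤ u → u < N → Done′ u → Caused D′ (side′ u) u
        caused′ {u} 1≤u u<N done with k ≟ u
        ... | yes refl rewrite ↦-at {f = side} {sideAfter b o} k =
          caused-after L 1≤k k<N tl tr o b
        ... | no k≢u with earlier 1≤u done (≢-sym k≢u)
        ... | done-u , k≢l , k≢r
          rewrite ↦-off {f = side} {sideAfter b o} k≢u
                | ↦-off {f = winner D} {w} k≢l | ↦-off {f = winner D} {w} k≢r
                | ↦-off {f = failure D} {f} k≢l | ↦-off {f = failure D} {f} k≢r
                | ↦-off {f = failure D} {f} k≢u
          = caused ns 1≤u u<N done-u

      -- `TakenOver` does not mention stored winners, so replaying a node leaves it intact at all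
      -- others. This is why `Far` is independent of the set `Done` of correct nodes.
      replay-takeovers : ∀ {Far Far′ : ℕ → Set} → (∀ {u} → 1 ≤ u → Far′ u → u ≢ k → Far u) →
                         TakenOver D b k →
                         Takeovers Far D side → Takeovers Far′ D′ side′
      replay-takeovers far tk ts {u} 1≤u u<N done with k ≟ u
      ... | yes refl rewrite ↦-at {f = side} {sideAfter b o} k =
        takenOver-after L 1≤k k<N tl tr o {b} tk
      ... | no k≢u rewrite ↦-off {f = side} {sideAfter b o} k≢u =
        ts 1≤u u<N (far 1≤u done (≢-sym k≢u))

    replay-count : TakenOver D (side k) k →
                   count (side [ k ↦ sideAfter (side k) o ]) N ≤ count side N
    replay-count tk = count-mono N (λ u _ → bit-↦-≤ {f = side} {k}
      (side-decreases L 1≤k k<N tl tr o {side k} tk) u)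

    hand-over-count : 0# <ᶠ now D → Caused D (side k) k → now D ≤ᶠ failure D k →
                      ¬ now D ≤ᶠ failure D (k + k) → ¬ now D ≤ᶠ failure D (suc (k + k)) →
                      suc (count (side [ k ↦ sideAfter (side k) o ]) N) ≤ count side N
    hand-over-count 0<x ca x≤f x≰fl x≰fr
      with hand-over L 1≤k k<N tl tr o {side k} 0<x ca x≤f x≰fl x≰fr
    ... | side≡ , after≡ rewrite after≡ = count-↦-drop side k N k<N side≡

  slowDown : Contest → Carrier → Contest
  slowDown D x = record
    { load = load D ; speed = speed D ; winner = winner D ; failure = failure D ; now = x }

  module _ {D : Contest} {x : Carrier} (x≤ : x ≤ᶠ now D) where

    -- The invariants are claimed for all sizes up to `now`, so lowering `now` weakens them.
    slowDown-nodes : ∀ {Done side} → Nodes Done D side → Nodes Done (slowDown D x) side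
    slowDown-nodes ns = record
      { trusted = λ 1≤u u<N d → let open Trusted (trusted ns 1≤u u<N d) in record
          { leaf = leaf ; under = under ; best = λ f<y y≤x → best f<y (Fᴾ.≤-trans y≤x x≤) }
      ; caused = λ 1≤u u<N d 0<y y≤x → caused ns 1≤u u<N d 0<y (Fᴾ.≤-trans y≤x x≤) }

    slowDown-takeovers : ∀ {Done side} → Takeovers Done D side → Takeovers Done (slowDown D x) side
    slowDown-takeovers ts 1≤u u<N d eq y≤x = ts 1≤u u<N d eq (Fᴾ.≤-trans y≤x x≤)

  setLoad : Contest → ℕ → Carrier → Contest
  setLoad D p t = record
    { load = load D [ p ↦ t ] ; speed = speed D ; winner = winner D ; failure = failure D ; now = now D }

  module _ {D : Contest} {p : ℕ} {t : Carrier} (L : LeavesSet D) (N≤p : N ≤ p) where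

    private
      D′ = setLoad D p t

      val≡ : ∀ {y u a} → u < N → Beside p u → u ≼ a → val D′ y a ≡ val D y a
      val≡ {y} {u} {a} u<N beside u≼a = cong (_+ᶠ y / speed D a) (↦-off {f = load D} p≢a)
        where
        p≢a : p ≢ a
        p≢a refl = beside (≼-parent u≼a (<⇒≢ (<-≤-trans u<N N≤p)))

    setLoad-leaves : LeavesSet D′
    setLoad-leaves = record
      { 1≤N = 1≤N ; 0<speed = 0<speed ; sorted = sorted ; winner≡ = winner≡ ; failure≡0 = failure≡0 }
      where open LeavesSet L

    -- An inner node compares only leaves of its own subtree, so those not above `p` still see the
    -- old values.
    setLoad-nodes : ∀ {side} → Nodes Everywhere D side → Nodes (Beside p) D′ side
    setLoad-nodes ns = record
      { trusted = λ 1≤u u<N beside → let open Trusted (trusted ns 1≤u u<N tt) in record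
          { leaf = leaf ; under = under
          ; best = λ f<y y≤x la ua → subst₂ _≤ᶠ_
              (sym (val≡ u<N beside under)) (sym (val≡ u<N beside ua)) (best f<y y≤x la ua) }
      ; caused = λ {u} 1≤u u<N beside 0<y y≤x y≤f → reword u<N beside
          (Trusted.under (trusted-node L ns (≤-trans 1≤u (m≤m+n u u)) (left<2N u<N) (λ _ → tt)))
          (Trusted.under (trusted-node L ns (s≤s z≤n) (right<2N u<N) (λ _ → tt)))
          (caused ns 1≤u u<N tt 0<y y≤x y≤f)
      }
      where
      reword : ∀ {a b} {A : Set a} {B : Set b} {P : Set} {u y} → u < N → Beside p u →
        u + u ≼ winner D (u + u) → suc (u + u) ≼ winner D (suc (u + u)) →
        A ⊎ B ⊎ (P × val D y (winner D (suc (u + u))) ≤ᶠ val D y (winner D (u + u))) →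
        A ⊎ B ⊎ (P × val D′ y (winner D (suc (u + u))) ≤ᶠ val D′ y (winner D (u + u)))
      reword _ _ _ _ (inj₁ a) = inj₁ a
      reword _ _ _ _ (inj₂ (inj₁ b)) = inj₂ (inj₁ b)
      reword u<N bs ul ur (inj₂ (inj₂ (q , le))) = inj₂ (inj₂ (q , subst₂ _≤ᶠ_
        (sym (val≡ u<N bs (≼-trans right≼ ur))) (sym (val≡ u<N bs (≼-trans left≼ ul))) le))

    setLoad-takeovers : ∀ {side} → Takeovers Everywhere D side → Takeovers (Beside p) D′ side
    setLoad-takeovers ts 1≤u u<N beside eq y≤x la ua with ts 1≤u u<N tt eq y≤x la ua
    ... | q , lq , uq , le = q , lq , uq , subst₂ _≤ᶠ_
      (sym (val≡ u<N beside (≼-trans right≼ uq))) (sym (val≡ u<N beside (≼-trans left≼ ua))) le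

-- The tournament used for sorting.

module MaxTournament {c ℓ} (F : OrderedField c ℓ) (N : ℕ) where
  open import Data.Nat.Base
  open import Data.Nat.Properties
  open OrderedField F using (Carrier) renaming (_≤_ to _≤ᶠ_)
  private module Fᴾ = OrderedFieldProperties F
  open HeapTree
  open Replaying N
  open Update

  record Best (key : ℕ → Carrier) (winner : ℕ → ℕ) (u : ℕ) : Set ℓ where
    field
      leaf  : Leaf N (winner u)
      under : u ≼ winner u
      best  : ∀ {a} → Leaf N a → u ≼ a → key a ≤ᶠ key (winner u)

  record Bests (Done : ℕ → Set) (key : ℕ → Carrier) (winner : ℕ → ℕ) : Set ℓ where
    field
      1≤N     : 1 ≤ N
      winner≡ : ∀ {p} → Leaf N p → winner p ≡ p
      best-at : ∀ {u} → 1 ≤ u → u < N → Done u → Best key winner u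

  open Best
  open Bests

  module _ {key : ℕ → Carrier} {winner : ℕ → ℕ} where

    best-node : ∀ {Done} → Bests Done key winner →
                ∀ {u} → 1 ≤ u → u < N + N → (u < N → Done u) → Best key winner u
    best-node bs {u} 1≤u u<2N done with u <? N
    ... | yes u<N = best-at bs 1≤u u<N (done u<N)
    ... | no u≮N  = record
      { leaf = subst (Leaf N) (sym w≡) lu ; under = subst (u ≼_) (sym w≡) here
      ; best = λ la ua → Fᴾ.≤-reflexive (cong key (trans (sym (leaf-≼ (1≤N bs) lu la ua)) (sym w≡))) }
      where
      lu = ≮⇒≥ u≮N , u<2N
      w≡ = winner≡ bs lu

    module _ {Done Done′ : ℕ → Set} {k w : ℕ} (bs : Bests Done key winner) (st : Step Done Done′ k) where
      open Step st

      private
        l = winner (k + k)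
        r = winner (suc (k + k))
        bl = best-node bs (≤-trans 1≤k (m≤m+n k k)) (left<2N k<N) (λ _ → left-done)
        br = best-node bs (s≤s z≤n) (right<2N k<N) (λ _ → right-done)

      replay-bests : (w ≡ l × key r ≤ᶠ key l) ⊎ (w ≡ r × key l ≤ᶠ key r) →
                     Bests Done′ key (winner [ k ↦ w ])
      replay-bests o = record
        { 1≤N = 1≤N bs
        ; winner≡ = λ lp → trans (↦-off {f = winner} (<⇒≢ (<-≤-trans k<N (proj₁ lp)))) (winner≡ bs lp)
        ; best-at = at }
        where
        choose : (w ≡ l × key r ≤ᶠ key l) ⊎ (w ≡ r × key l ≤ᶠ key r) →
                 Leaf N w × k ≼ w × key l ≤ᶠ key w × key r ≤ᶠ key w
        choose (inj₁ (refl , r≤l)) = leaf bl , ≼-trans left≼ (under bl) , Fᴾ.≤-refl , r≤l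
        choose (inj₂ (refl , l≤r)) = leaf br , ≼-trans right≼ (under br) , l≤r , Fᴾ.≤-refl
        at : ∀ {u} → 1 ≤ u → u < N → Done′ u → Best key (winner [ k ↦ w ]) u
        at {u} 1≤u u<N done with k ≟ u
        ... | no k≢u = record
          { leaf = subst (Leaf N) w≡ (leaf b) ; under = subst (u ≼_) w≡ (under b)
          ; best = λ {a} la ua → subst (λ z → key a ≤ᶠ key z) w≡ (best b la ua) }
          where
          b  = best-at bs 1≤u u<N (proj₁ (earlier 1≤u done (≢-sym k≢u)))
          w≡ = sym (↦-off {f = winner} {w} k≢u)
        ... | yes refl with choose o
        ...   | lw , uw , l≤w , r≤w = record
          { leaf = subst (Leaf N) w≡ lw ; under = subst (k ≼_) w≡ uw
          ; best = λ {a} la ua → subst (λ z → key a ≤ᶠ key z) w≡ (beats la (≼-child ua (<⇒≢ (<-≤-trans k<N (proj₁ la))))) }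
          where
          w≡ = sym (↦-at {f = winner} {w} k)
          beats : ∀ {a} → Leaf N a → k + k ≼ a ⊎ suc (k + k) ≼ a → key a ≤ᶠ key w
          beats la (inj₁ q) = Fᴾ.≤-trans (best bl la q) l≤w
          beats la (inj₂ q) = Fᴾ.≤-trans (best br la q) r≤w

    rekey-bests : ∀ {p t} → N ≤ p → Bests Everywhere key winner →
                  Bests (Beside p) (key [ p ↦ t ]) winner
    rekey-bests {p} {t} N≤p bs = record
      { 1≤N = 1≤N bs ; winner≡ = winner≡ bs
      ; best-at = λ {u} 1≤u u<N beside → let b = best-at bs 1≤u u<N tt in record
          { leaf = leaf b ; under = under b
          ; best = λ la ua → subst₂ _≤ᶠ_ (same u<N beside ua) (same u<N beside (under b)) (best b la ua) } }
      where
      same : ∀ {u a} → u < N → Beside p u → u ≼ a → key a ≡ (key [ p ↦ t ]) a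
      same {u} {a} u<N beside u≼a = sym (↦-off {f = key} {t} p≢a)
        where
        p≢a : p ≢ a
        p≢a refl = beside (≼-parent u≼a (<⇒≢ (<-≤-trans u<N N≤p)))

-- Runs of programs on a credit of steps.

module TimedRuns {c ℓ} (F : OrderedField c ℓ) where
  open import Data.Bool.Base using (true; false; T)
  open import Data.Nat.Base hiding (_/_; _⊔_)
  open import Data.Nat.Properties renaming (_≤?_ to _≤ⁿ?_)
  open OrderedField F using (_≤?_) renaming (_≤_ to _≤ᶠ_)
  open RealRAM F
  open import Relation.Nullary.Decidable.Core using () renaming (⌊_⌋ to ⌊_⌋ᵈ)

  -- Time is handled as credit: Q receives the steps that are left over.
  Run : ∀ {q} → Program → State → ℕ → (ℕ → State → Set q) → Set (c ⊔ q)
  Run p s T Q = ∃[ t ] ∃[ s′ ] ∃[ r ] (p , s ⇓[ t ] s′) × t + r ≤ T × Q r s′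

  private variable
    q : Level
    Q R : ℕ → State → Set q
    p p′ : Program
    s : State
    b i r t : ℕ
    e : NatExp
    g : NumExp

  more-time : t ≤ r → Run p s t Q → Run p s r Q
  more-time le (u , s′ , k , ex , le′ , q) = u , s′ , k , ex , ≤-trans le′ le , q

  run-skip : Q r s → Run skip s (suc r) Q
  run-skip q = 1 , _ , _ , skip⇓ , ≤-refl , q

  run-nat : ∀ {i} → Q r ⟨ nats s [ b , evalₙ i s ≔ evalₙ e s ] , nums s ⟩ →
            Run (nat[ b , i ]≔ e) s (suc r) Q
  run-nat q = 1 , _ , _ , nat≔⇓ , ≤-refl , q

  run-num : ∀ {i} → Q r ⟨ nats s , nums s [ b , evalₙ i s ≔ evalᴿ g s ] ⟩ →
            Run (num[ b , i ]≔ g) s (suc r) Q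
  run-num q = 1 , _ , _ , num≔⇓ , ≤-refl , q

  -- The postcondition of the first program is a run of the second on the remaining credit. With
  -- such nesting a proof follows the program text.
  run-seq : Run p s t (λ r s′ → Run p′ s′ r Q) → Run (p ⨾ p′) s t Q
  run-seq {t = T} (t , s′ , r , ex , le , (u , s″ , k , ex′ , le′ , q)) =
    t + u , s″ , k , seq⇓ ex ex′ ,
    ≤-trans (≤-reflexive (+-assoc t u k)) (≤-trans (+-monoʳ-≤ t le′) le) , q

  module _ {b : Test} where

    run-then : test b s ≡ true → Run p s r Q → Run (when b then p else p′) s (suc r) Q
    run-then eq (t , s′ , k , ex , le , q) = suc t , s′ , k , then⇓ eq ex , s≤s le , q

    run-else : test b s ≡ false → Run p′ s r Q → Run (when b then p else p′) s (suc r) Q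
    run-else eq (t , s′ , k , ex , le , q) = suc t , s′ , k , else⇓ eq ex , s≤s le , q

    run-exit : test b s ≡ false → Q r s → Run (while b loop p) s (suc r) Q
    run-exit eq q = 1 , _ , _ , exit⇓ eq , ≤-refl , q

    run-again : test b s ≡ true → Run p s r (λ r′ s′ → Run (while b loop p) s′ r′ Q) →
                Run (while b loop p) s (suc r) Q
    run-again eq (t , s′ , r , ex , le , (u , s″ , k , ex′ , le′ , q)) =
      suc (t + u) , s″ , k , again⇓ eq ex ex′ ,
      s≤s (≤-trans (≤-reflexive (+-assoc t u k)) (≤-trans (+-monoʳ-≤ t le′) le)) , q

  ≤⇒test : ∀ {m n} → m ≤ n → (m ≤ᵇ n) ≡ true
  ≤⇒test {m} {n} le with m ≤ᵇ n in eq
  ... | true  = refl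
  ... | false = contradiction (subst T eq (≤⇒≤ᵇ le)) id

  ≰⇒test : ∀ {m n} → ¬ m ≤ n → (m ≤ᵇ n) ≡ false
  ≰⇒test {m} {n} ≰ with m ≤ᵇ n in eq
  ... | false = refl
  ... | true  = contradiction (≤ᵇ⇒≤ m n (subst T (sym eq) _)) ≰

  run-whenₙ : ∀ {e f} → (evalₙ e s ≤ evalₙ f s → Run p s r Q) →
              (¬ evalₙ e s ≤ evalₙ f s → Run p′ s r Q) →
              Run (when e ≤ₙ f then p else p′) s (suc r) Q
  run-whenₙ {s = s} {e = e} {f = f} yes? no? with evalₙ e s ≤ⁿ? evalₙ f s
  ... | yes le = run-then (≤⇒test le) (yes? le)
  ... | no  ≰  = run-else (≰⇒test ≰) (no? ≰)

  test-yes : ∀ {x y} → x ≤ᶠ y → ⌊ x ≤? y ⌋ᵈ ≡ true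
  test-yes {x} {y} le with x ≤? y
  ... | yes _ = refl
  ... | no ≰  = contradiction le ≰

  test-no : ∀ {x y} → ¬ x ≤ᶠ y → ⌊ x ≤? y ⌋ᵈ ≡ false
  test-no {x} {y} ≰ with x ≤? y
  ... | yes le = contradiction le ≰
  ... | no _   = refl

  run-whenᴿ : ∀ {e f} → (evalᴿ e s ≤ᶠ evalᴿ f s → Run p s r Q) →
              (¬ evalᴿ e s ≤ᶠ evalᴿ f s → Run p′ s r Q) →
              Run (when e ≤ᴿ f then p else p′) s (suc r) Q
  run-whenᴿ {s = s} {e = e} {f = f} yes? no? with evalᴿ e s ≤? evalᴿ f s
  ... | yes le = run-then (test-yes le) (yes? le)
  ... | no  ≰  = run-else (test-no ≰) (no? ≰)

-- Step counts.

module Time where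
  open import Data.Nat.Base

  -- L bounds the height of the tournament tree in question.
  extract event job : ℕ → ℕ
  extract L = 3 + (L * 4 + 1)
  -- A replay takes at most 11 steps, and 13 together with the test and the halving of an ascent;
  -- one level of the descent takes 3.
  event L   = 1 + (1 + (L * 3 + 1) + (11 + (L * 13 + 1)))
  -- The first summand pays in advance for the repairs that the raised load may cause, one for each
  -- level.
  job L     = L * event L + (L * 13 + 8)

  sort : ℕ → ℕ → ℕ
  sort n L = 2 + (n * 4 + (2 + (n * 4 + (2 + (n * (2 + extract L) + 1)))))

  place reset makespan : ℕ → ℕ
  place m    = 1 + (m * 2 + (2 + (m * 6 + 1)))
  reset m    = 2 + (m * 5 + (3 + (m * 13 + 1)))
  makespan m = 2 + (m * 4 + 1)

  lpt : (n m Lₙ Lₘ : ℕ) → ℕ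
  lpt n m Lₙ Lₘ =
    sort m Lₘ + (place m + (sort n Lₙ + (reset m +
      -- The potential is at most `m + m` after the build; the additional event is the one that
      -- `run-advance` holds in reserve.
      suc (suc (m + m) * event Lₘ + (n * job Lₘ + suc (makespan m))))))

-- The program.

module LPTProgram where

  -- Blocks 0 to 2 hold input and output, blocks from 10 on are working memory. `size#` is the
  -- number of leaves of the current tree and `ptr` the node at hand.
  size# ptr idx bottom scratch : NatExp
  size#   = nat[ 10 , lit 0 ]
  ptr     = nat[ 11 , lit 0 ]
  idx     = nat[ 12 , lit 0 ]
  bottom  = nat[ 16 , lit 0 ]
  scratch = nat[ 17 , lit 0 ]

  winner order machine : NatExp → NatExp
  winner  = nat[ 13 ,_]
  order   = nat[ 14 ,_]
  machine = nat[ 15 ,_]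

  load speed failure : NatExp → NumExp
  load    = num[ 10 ,_]
  speed   = num[ 11 ,_]
  failure = num[ 12 ,_]

  now fail cross : NumExp
  now   = num[ 13 , lit 0 ]
  fail  = num[ 14 , lit 0 ]
  cross = num[ 15 , lit 0 ]

  leftOf rightOf : NatExp
  leftOf  = ptr +ₙ ptr
  rightOf = lit 1 +ₙ (ptr +ₙ ptr)

  next : Program
  next = nat[ 12 , lit 0 ]≔ (lit 1 +ₙ idx)

  forUpTo : NatExp → Program → Program
  forUpTo bound body = while lit 1 +ₙ idx ≤ₙ bound loop (body ⨾ next)

  forLeaves : Program → Program
  forLeaves body = nat[ 12 , lit 0 ]≔ size# ⨾ forUpTo (size# +ₙ size#) body

  ascend build : Program → Program
  ascend replay = while lit 2 ≤ₙ ptr loop (nat[ 11 , lit 0 ]≔ half ptr ⨾ replay)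
  build replay =
    nat[ 11 , lit 0 ]≔ size# ⨾
    while lit 2 ≤ₙ ptr loop (nat[ 11 , lit 0 ]≔ (ptr ∸ₙ lit 1) ⨾ replay)

  replayMax : Program
  replayMax =
    when load (winner rightOf) ≤ᴿ load (winner leftOf)
      then nat[ 13 , ptr ]≔ winner leftOf
      else (nat[ 13 , ptr ]≔ winner rightOf)

  loadKeys : ℕ → Program
  loadKeys b =
    nat[ 10 , lit 0 ]≔ nat[ b , lit 0 ] ⨾
    forLeaves (num[ 10 , idx ]≔ num[ b , idx ∸ₙ size# ] ⨾ nat[ 13 , idx ]≔ idx)

  extract : Program
  extract =
    nat[ 14 , idx ]≔ (winner (lit 1) ∸ₙ size#) ⨾
    -- All keys are positive, so zero marks the removed ones.
    num[ 10 , winner (lit 1) ]≔ zeroᴿ ⨾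
    nat[ 11 , lit 0 ]≔ winner (lit 1) ⨾
    ascend replayMax

  sortDescending : ℕ → Program
  sortDescending b =
    loadKeys b ⨾ build replayMax ⨾ nat[ 12 , lit 0 ]≔ lit 0 ⨾ forUpTo size# extract

  -- `bottom` ends as the least power of two not below `size#`, the first node of the bottom level.
  -- The two branches compute the left-to-right position `pos`; since `order` lists the machines
  -- fastest first, flatter lines lie to the left.
  placeMachines : Program
  placeMachines =
    nat[ 16 , lit 0 ]≔ lit 1 ⨾
    (while lit 1 +ₙ bottom ≤ₙ size# loop (nat[ 16 , lit 0 ]≔ (bottom +ₙ bottom))) ⨾
    forLeaves
      ((when bottom ≤ₙ idx
          then nat[ 17 , lit 0 ]≔ order (idx ∸ₙ bottom)
          else (nat[ 17 , lit 0 ]≔ order (idx +ₙ size# ∸ₙ bottom))) ⨾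
       nat[ 15 , idx ]≔ scratch ⨾
       num[ 11 , idx ]≔ num[ 1 , scratch ])

  finish : NatExp → NumExp
  finish p = load p ⊕ now ⊘ speed p

  -- A node with a failing child stays undecided: it fails as well, and the winner
  -- stored there means nothing.
  replayKinetic : Program
  replayKinetic =
    num[ 14 , lit 0 ]≔ failure leftOf ⨾
    (when fail ≤ᴿ failure rightOf then num[ 14 , lit 0 ]≔ failure rightOf else skip) ⨾
    nat[ 17 , lit 0 ]≔ winner leftOf ⨾
    (when now ≤ᴿ fail then skip else
     (when finish (winner rightOf) ≤ᴿ finish (winner leftOf)
       then nat[ 17 , lit 0 ]≔ winner rightOf
       else (num[ 15 , lit 0 ]≔
               ((load (winner leftOf) ⊖ load (winner rightOf)) ⊘
                (oneᴿ ⊘ speed (winner rightOf) ⊖ oneᴿ ⊘ speed (winner leftOf))) ⨾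
             (when fail ≤ᴿ cross then num[ 14 , lit 0 ]≔ cross else skip)))) ⨾
    num[ 12 , ptr ]≔ fail ⨾
    nat[ 13 , ptr ]≔ scratch

  -- At a lowest failing node the winners of both children can be trusted, so the recomputation
  -- there is final. The guard is a disjunction in De Morgan form.
  descend : Program
  descend =
    nat[ 11 , lit 0 ]≔ lit 1 ⨾
    (while ¬ₜ (¬ₜ (now ≤ᴿ failure leftOf) ∧ₜ ¬ₜ (now ≤ᴿ failure rightOf)) loop
      (when now ≤ᴿ failure leftOf
         then nat[ 11 , lit 0 ]≔ leftOf
         else (nat[ 11 , lit 0 ]≔ rightOf)))

  -- A recomputed failure size is at least those of the children, so testing the root tests the
  -- whole tree.
  advance : Program
  advance =
    while now ≤ᴿ failure (lit 1) loop
      (descend ⨾ replayKinetic ⨾ ascend replayKinetic)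

  assign : Program
  assign =
    num[ 13 , lit 0 ]≔ num[ 0 , order idx ] ⨾
    advance ⨾
    nat[ 2 , order idx ]≔ machine (winner (lit 1)) ⨾
    num[ 10 , winner (lit 1) ]≔ finish (winner (lit 1)) ⨾
    nat[ 11 , lit 0 ]≔ winner (lit 1) ⨾
    ascend replayKinetic

  resetTournament : Program
  resetTournament =
    nat[ 10 , lit 0 ]≔ nat[ 1 , lit 0 ] ⨾
    forLeaves
      (num[ 10 , idx ]≔ zeroᴿ ⨾ nat[ 13 , idx ]≔ idx ⨾ num[ 12 , idx ]≔ zeroᴿ) ⨾
    -- The first job in the order is the largest, so the tournament never has to look at a greater
    -- size.
    num[ 13 , lit 0 ]≔ num[ 0 , order (lit 0) ] ⨾
    build replayKinetic

  computeMakespan : Program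
  computeMakespan =
    num[ 2 , lit 0 ]≔ load size# ⨾
    forLeaves (when num[ 2 , lit 0 ] ≤ᴿ load idx then num[ 2 , lit 0 ]≔ load idx else skip)

  lpt : Program
  lpt =
    sortDescending 1 ⨾ placeMachines ⨾ sortDescending 0 ⨾ resetTournament ⨾
    nat[ 12 , lit 0 ]≔ lit 0 ⨾ forUpTo nat[ 0 , lit 0 ] assign ⨾
    computeMakespan

-- Rules for the loops of the program.

module Loops {c ℓ} (F : OrderedField c ℓ) where
  open import Data.Nat.Base hiding (_/_; _⊔_)
  open import Data.Nat.Properties
  open import Data.Nat.Tactic.RingSolver using (solve-∀)
  open OrderedField F using (Carrier)
  open RealRAM F
  open TimedRuns F
  open HeapTree hiding (here)
  open Replaying
  module P = LPTProgram

  -- The cells that matter, so that scratch writes do not show: for the state after a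
  -- write, the view is definitionally an update of the view before.
  record View : Set c where
    field
      jobs machines        : ℕ
      sizes speeds         : ℕ → Carrier
      schedule             : ℕ → ℕ
      makespan             : Carrier
      size# ptr idx bottom : ℕ
      winner order machine : ℕ → ℕ
      load speed failure   : ℕ → Carrier
      now                  : Carrier

  view : State → View
  view s = record
    { jobs = nats s 0 0 ; machines = nats s 1 0 ; sizes = nums s 0 ; speeds = nums s 1
    ; schedule = nats s 2 ; makespan = nums s 2 0
    ; size# = nats s 10 0 ; ptr = nats s 11 0 ; idx = nats s 12 0 ; bottom = nats s 16 0
    ; winner = nats s 13 ; order = nats s 14 ; machine = nats s 15
    ; load = nums s 10 ; speed = nums s 11 ; failure = nums s 12 ; now = nums s 13 0 }

  open View public

  private variable
    q : Level
    Q : ℕ → State → Set q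

  module _ {j} (bound : NatExp) (body : Program) (hi cost : ℕ) (J : ℕ → State → Set j)
           (idx≡ : ∀ {i s} → J i s → idx (view s) ≡ i)
           (bound≡ : ∀ {i s} → J i s → evalₙ bound s ≡ hi)
           (run-body : ∀ {i s r q} {Q : ℕ → State → Set q} → J i s → i < hi →
             (∀ {s′} → J (suc i) ⟨ nats s′ [ 12 , 0 ≔ suc (idx (view s′)) ] , nums s′ ⟩ → Q r s′) →
             Run body s (cost + r) Q) where

    run-forUpTo : ∀ k {i s r} → k + i ≡ hi → J i s → (∀ {s′} → J hi s′ → Q r s′) →
                  Run (P.forUpTo bound body) s (k * (2 + cost) + suc r) Q
    run-forUpTo zero {s = s} refl ji q = run-exit
      (trans (cong₂ (λ a b → suc a ≤ᵇ b) (idx≡ ji) (bound≡ ji)) (≰⇒test {suc hi} {hi} (<⇒≱ ≤-refl))) (q ji)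
    run-forUpTo (suc k) {i} {s} {r} k+i≡ ji q = run-again
      (trans (cong₂ (λ a b → suc a ≤ᵇ b) (idx≡ ji) (bound≡ ji)) (≤⇒test i<hi))
      (more-time (≤-reflexive (time cost (k * (2 + cost)) r)) (run-seq (run-body ji i<hi λ j′ →
        run-nat (run-forUpTo k (trans (+-suc k i) k+i≡) j′ q))))
      where
      i<hi : i < hi
      i<hi = subst (suc i ≤_) k+i≡ (s≤s (m≤n+m i k))
      time : ∀ c d r → c + suc (d + suc r) ≡ suc (c + d + suc r)
      time = solve-∀

  module _ {j} (replay : Program) (cost : ℕ) (J : ℕ → State → Set j)
           (run-replay : ∀ {l s r q} {Q : ℕ → State → Set q} → J (suc l) s → 2 ≤ ptr (view s) →
             (∀ {s′} → ptr (view s′) ≡ ⌊ ptr (view s) /2⌋ → J l s′ → Q r s′) →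
             Run replay ⟨ nats s [ 11 , 0 ≔ ⌊ ptr (view s) /2⌋ ] , nums s ⟩ (cost + r) Q) where

    -- The invariant also depends on the number `l` of levels that may still be climbed; for the
    -- kinetic tournament this number is the slack of the potential.
    run-ascend : ∀ l {s r} → ptr (view s) < 2 ^ l → J l s →
                 (∀ {l′ s′} → ptr (view s′) < 2 → J l′ s′ → Q r s′) →
                 Run (P.ascend replay) s (l * (2 + cost) + suc r) Q
    run-ascend l {s} {r} ptr< jl q with 2 ≤? ptr (view s)
    ... | no ≱ = more-time (m≤n+m (suc r) (l * (2 + cost))) (run-exit (≰⇒test ≱) (q (≰⇒> ≱) jl))
    run-ascend zero {s} ptr< jl q | yes 2≤ = contradiction (<-≤-trans ptr< (≤-trans (s≤s z≤n) 2≤)) (<-irrefl refl)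
    run-ascend (suc l) {s} {r} ptr< jl q | yes 2≤ = run-again (≤⇒test 2≤) (run-seq (run-nat
      (more-time (≤-reflexive (time cost (l * (2 + cost)) r)) (run-replay jl 2≤ λ ptr≡ jl′ →
        run-ascend l (subst (_< 2 ^ l) (sym ptr≡) (half-< {ptr (view s)} {l} ptr<)) jl′ q))))
      where
      time : ∀ c d r → c + (d + suc r) ≡ c + d + suc r
      time = solve-∀

  module _ {j} (replay : Program) (cost N : ℕ) (J : State → Set j)
           (run-replay : ∀ {s r q} {Q : ℕ → State → Set q} → J s → 2 ≤ ptr (view s) →
             (∀ {s′} → ptr (view s′) ≡ ptr (view s) ∸ 1 → J s′ → Q r s′) →
             Run replay ⟨ nats s [ 11 , 0 ≔ ptr (view s) ∸ 1 ] , nums s ⟩ (cost + r) Q) where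

    run-build-loop : ∀ k {s r} → ptr (view s) ≡ suc k → J s →
                     (∀ {s′} → ptr (view s′) ≡ 1 → J s′ → Q r s′) →
                     Run (while lit 2 ≤ₙ P.ptr loop
                            (nat[ 11 , lit 0 ]≔ (P.ptr ∸ₙ lit 1) ⨾ replay))
                         s (k * (2 + cost) + suc r) Q
    run-build-loop zero ptr≡ js q = run-exit (trans (cong (2 ≤ᵇ_) ptr≡) refl) (q ptr≡ js)
    run-build-loop (suc k) {s} {r} ptr≡ js q = run-again (≤⇒test 2≤) (run-seq (run-nat
      (more-time (≤-reflexive (time cost (k * (2 + cost)) r)) (run-replay js 2≤ λ ptr≡′ js′ →
        run-build-loop k (trans ptr≡′ (cong (_∸ 1) ptr≡)) js′ q))))
      where
      2≤ : 2 ≤ ptr (view s)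
      2≤ = subst (2 ≤_) (sym ptr≡) (s≤s (s≤s z≤n))
      time : ∀ c d r → c + (d + suc r) ≡ c + d + suc r
      time = solve-∀

    run-build : ∀ {s r} → size# (view s) ≡ N → 1 ≤ N →
                J ⟨ nats s [ 11 , 0 ≔ size# (view s) ] , nums s ⟩ →
                (∀ {s′} → ptr (view s′) ≡ 1 → J s′ → Q r s′) →
                Run (P.build replay) s (suc (N * (2 + cost) + suc r)) Q
    run-build {s = s} {r} size≡ 1≤N js q = run-seq (run-nat (more-time
      (+-monoˡ-≤ (suc r) (*-monoˡ-≤ (2 + cost) (pred[n]≤n {N})))
      (run-build-loop (pred N) (trans size≡ (sym (suc-pred N {{>-nonZero 1≤N}}))) js q)))

-- Sorting by repeated extraction of the maximum.

module Sorting {c ℓ} (F : OrderedField c ℓ) where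
  open import Data.Fin.Base using (Fin; toℕ; fromℕ<)
  open import Data.Fin.Properties using (toℕ<n; toℕ-fromℕ<; toℕ-injective)
  import Data.Fin.Properties as Fin
  open import Data.List.Base using (List; []; _∷_; _++_; [_]; length; allFin)
  open import Data.List.Properties using (length-++; length-tabulate; ++-assoc; ++-identityʳ)
  open import Data.List.Membership.Propositional using (_∈_; _∉_)
  open import Data.List.Membership.Propositional.Properties using (∈-∃++; ∈-allFin)
  open import Data.List.Relation.Binary.Permutation.Propositional using (_↭_; refl; prep; swap; ↭-refl; ↭-sym; ↭-trans; ↭-reflexive)
  open import Data.List.Relation.Binary.Permutation.Propositional.Properties
    using (shift; ++⁺ˡ; ↭-length; ∈-resp-↭; All-resp-↭)
  open import Data.List.Relation.Unary.All as All using (All; []; _∷_)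
  import Data.List.Relation.Unary.All.Properties as All
  open import Data.List.Relation.Unary.AllPairs using (AllPairs; []; _∷_)
  import Data.List.Relation.Unary.AllPairs.Properties as AllPairs
  open import Data.List.Relation.Unary.Any using (here; there)
  open import Data.List.Relation.Unary.Unique.Propositional using (Unique)
  open import Data.List.Relation.Unary.Unique.Propositional.Properties using (allFin⁺)
  open import Data.Nat.Base hiding (_/_; _⊔_)
  open import Data.Nat.Properties
  open import Data.Nat.Tactic.RingSolver using (solve-∀)
  open OrderedField F using (Carrier; 0#) renaming (_≤_ to _≤ᶠ_; _<_ to _<ᶠ_)
  private module Fᴾ = OrderedFieldProperties F
  open RealRAM F
  open TimedRuns F
  open Loops F
  open HeapTree using (Leaf; root≼)
  open Replaying using (Step; Beside; Everywhere; ascend-step; build-step)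
  open Update

  Stored : ∀ {n} → List (Fin n) → ℕ → (ℕ → ℕ) → Set
  Stored []       k a = ⊤
  Stored (x ∷ xs) k a = a k ≡ toℕ x × Stored xs (suc k) a

  Stored-snoc : ∀ {n} (xs : List (Fin n)) {x k a i v} → Stored xs k a → k + length xs ≡ i → v ≡ toℕ x →
                Stored (xs ++ [ x ]) k (a [ i ↦ v ])
  Stored-snoc [] {k = k} {a} {v = v} st eq v≡ rewrite sym (trans (sym (+-identityʳ k)) eq) =
    trans (↦-at {f = a} {v} k) v≡ , tt
  Stored-snoc (y ∷ xs) {k = k} {a} {v = v} (ak , st) refl v≡ =
    trans (↦-off {f = a} {v} (≢-sym (<⇒≢ (m<m+n k (s≤s z≤n))))) ak ,
    Stored-snoc xs st (sym (+-suc k (length xs))) v≡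

  Unique-resp-↭ : ∀ {n} {xs ys : List (Fin n)} → xs ↭ ys → Unique xs → Unique ys
  Unique-resp-↭ refl u = u
  Unique-resp-↭ (prep x p) (x∉ ∷ u) = All-resp-↭ p x∉ ∷ Unique-resp-↭ p u
  Unique-resp-↭ (swap x y p) ((x≢y ∷ x∉) ∷ y∉ ∷ u) =
    (≢-sym x≢y ∷ All-resp-↭ p y∉) ∷ All-resp-↭ p x∉ ∷ Unique-resp-↭ p u
  Unique-resp-↭ (_↭_.trans p p′) u = Unique-resp-↭ p′ (Unique-resp-↭ p u)

  -- The cells that a sort preserves. `machine` and `speed` belong here because they are already
  -- filled when the jobs are sorted.
  record Frame : Set c where
    field
      jobs machines  : ℕ
      sizes speeds   : ℕ → Carrier
      machine        : ℕ → ℕ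
      speed          : ℕ → Carrier

  frame : View → Frame
  frame v = record
    { jobs = View.jobs v ; machines = View.machines v ; sizes = View.sizes v ; speeds = View.speeds v
    ; machine = View.machine v ; speed = View.speed v }

  -- Covers the jobs with `b = 0` and the machines with `b = 1`: in both blocks the first natural is
  -- the number of items and the numbers are the keys.
  module SortRun (b : ℕ) (f₀ : Frame) (n : ℕ) (1≤n : 1 ≤ n) (key : Fin n → Carrier)
    (0<key : ∀ j → 0# <ᶠ key j)
    (count-in : ∀ s → frame (view s) ≡ f₀ → nats s b 0 ≡ n)
    (key-in : ∀ s → frame (view s) ≡ f₀ → ∀ j → nums s b (toℕ j) ≡ key j) where

    open MaxTournament F n
    open import Data.List.Membership.DecPropositional (Fin._≟_ {n}) using (_∈?_)

    Descending : List (Fin n) → Set ℓ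
    Descending = AllPairs (λ i i′ → key i′ ≤ᶠ key i)

    IsSorted : (ℕ → ℕ) → Set ℓ
    IsSorted a = ∃[ xs ] (xs ↭ allFin n × Descending xs × Stored xs 0 a)

    private variable
      q : Level
      Q : ℕ → State → Set q
      s : State
      r : ℕ

    -- the part of the view that replaying leaves alone
    record Rows : Set c where
      field
        frameᴿ : Frame
        sizeᴿ idxᴿ : ℕ
        orderᴿ : ℕ → ℕ
        loadᴿ  : ℕ → Carrier

    rows : View → Rows
    rows v = record { frameᴿ = frame v ; sizeᴿ = size# v ; idxᴿ = idx v ; orderᴿ = order v ; loadᴿ = load v }

    run-replayMax : ∀ {Done Done′} → Bests Done (load (view s)) (winner (view s)) →
      Step n Done Done′ (ptr (view s)) →
      (∀ {s′} → ptr (view s′) ≡ ptr (view s) → rows (view s′) ≡ rows (view s) →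
         Bests Done′ (load (view s′)) (winner (view s′)) → Q r s′) →
      Run P.replayMax s (2 + r) Q
    run-replayMax bs st k = run-whenᴿ
      (λ le → run-nat (k refl refl (replay-bests bs st (inj₁ (refl , le)))))
      (λ ≰ → run-nat (k refl refl (replay-bests bs st (inj₂ (refl , Fᴾ.≰⇒≥ ≰)))))

    run-ascendMax : ∀ l → ptr (view s) < 2 ^ l → ptr (view s) < n + n →
      Bests (Beside n (ptr (view s))) (load (view s)) (winner (view s)) →
      (∀ {s′} → rows (view s′) ≡ rows (view s) →
         Bests (Everywhere n) (load (view s′)) (winner (view s′)) → Q r s′) →
      Run (P.ascend P.replayMax) s (l * 4 + suc r) Q
    run-ascendMax {s = s} l ptr<2^l ptr<2n bs k = run-ascend P.replayMax 2 J (λ {l} → run-replay {l}) l ptr<2^l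
      (ptr<2n , refl , bs)
      λ {_} {s′} ptr<2 (_ , rows≡ , bs′) → k rows≡ record
        { 1≤N = Bests.1≤N bs′ ; winner≡ = Bests.winner≡ bs′
        -- The ascent ends at a node below 2. Its half is 0, so no node is excluded any more.
        ; best-at = λ {u} 1≤u u<n _ → Bests.best-at bs′ 1≤u u<n
            (λ u≼ → HeapTree.⋠0 1≤u (subst (u HeapTree.≼_) (half0 ptr<2) u≼)) }
      where
      half0 : ∀ {p} → p < 2 → ⌊ p /2⌋ ≡ 0
      half0 {0} _ = refl
      half0 {1} _ = refl
      half0 {suc (suc p)} (s≤s (s≤s ()))
      J : ℕ → State → Set (c ⊔ ℓ)
      J _ s′ = ptr (view s′) < n + n × rows (view s′) ≡ rows (view s) ×
               Bests (Beside n (ptr (view s′))) (load (view s′)) (winner (view s′))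
      run-replay : ∀ {l s r q} {Q : ℕ → State → Set q} → J (suc l) s → 2 ≤ ptr (view s) →
        (∀ {s′} → ptr (view s′) ≡ ⌊ ptr (view s) /2⌋ → J l s′ → Q r s′) →
        Run P.replayMax ⟨ nats s [ 11 , 0 ≔ ⌊ ptr (view s) /2⌋ ] , nums s ⟩ (2 + r) Q
      run-replay {s = s} (p<2n , rows≡ , bs) 2≤p k = run-replayMax bs (ascend-step n 2≤p p<2n)
        λ {s′} ptr≡ rows≡′ bs′ → k ptr≡
          ( subst (_< n + n) (sym ptr≡) (≤-<-trans (⌊n/2⌋≤n (ptr (view s))) p<2n)
          , trans rows≡′ rows≡
          , subst (λ z → Bests (Beside n z) _ _) (sym ptr≡) bs′ )

    run-buildMax : size# (view s) ≡ n →
      (∀ {p} → Leaf n p → winner (view s) p ≡ p) →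
      (∀ {s′} → rows (view s′) ≡ rows (view s) →
         Bests (Everywhere n) (load (view s′)) (winner (view s′)) → Q r s′) →
      Run (P.build P.replayMax) s (suc (n * 4 + suc r)) Q
    run-buildMax {s = s} size≡ w≡ k = run-build P.replayMax 2 n J run-replay size≡ 1≤n
      (≤-reflexive size≡ , refl , record
        { 1≤N = 1≤n ; winner≡ = w≡
        ; best-at = λ _ u<n n≤u → contradiction (subst (_≤ _) size≡ n≤u) (<⇒≱ u<n) })
      λ ptr≡1 (_ , rows≡ , bs) → k rows≡ record
        { 1≤N = 1≤n ; winner≡ = Bests.winner≡ bs
        ; best-at = λ 1≤u u<n _ → Bests.best-at bs 1≤u u<n (≤-trans (≤-reflexive ptr≡1) 1≤u) }
      where
      J : State → Set (c ⊔ ℓ)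
      J s′ = ptr (view s′) ≤ n × rows (view s′) ≡ rows (view s) ×
             Bests (ptr (view s′) ≤_) (load (view s′)) (winner (view s′))
      run-replay : ∀ {s r q} {Q : ℕ → State → Set q} → J s → 2 ≤ ptr (view s) →
        (∀ {s′} → ptr (view s′) ≡ ptr (view s) ∸ 1 → J s′ → Q r s′) →
        Run P.replayMax ⟨ nats s [ 11 , 0 ≔ ptr (view s) ∸ 1 ] , nums s ⟩ (2 + r) Q
      run-replay {s = s} (p≤n , rows≡ , bs) 2≤p k =
        run-replayMax bs (subst (λ z → Step n (z ≤_) (ptr (view s) ∸ 1 ≤_) (ptr (view s) ∸ 1)) 1+p-1
            (build-step n (≤-pred 2≤p′) (≤-trans (≤-reflexive 1+p-1) p≤n)))
          λ {s′} ptr≡ rows≡′ bs′ → k ptr≡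
            ( ≤-trans (≤-reflexive ptr≡) (≤-trans (m∸n≤m (ptr (view s)) 1) p≤n)
            , trans rows≡′ rows≡
            , subst (λ z → Bests (z ≤_) (load (view s′)) (winner (view s′))) (sym ptr≡) bs′ )
        where
        1+p-1 : suc (ptr (view s) ∸ 1) ≡ ptr (view s)
        1+p-1 = trans (sym (+-∸-assoc 1 (≤-trans (s≤s z≤n) 2≤p))) refl
        2≤p′ : 2 ≤ suc (ptr (view s) ∸ 1)
        2≤p′ = subst (2 ≤_) (sym 1+p-1) 2≤p

    leafOf : Fin n → ℕ
    leafOf j = n + toℕ j

    leafOf-leaf : ∀ j → Leaf n (leafOf j)
    leafOf-leaf j = m≤m+n n (toℕ j) , +-monoʳ-< n (toℕ<n j)

    jobOf : ∀ {p} → Leaf n p → ∃[ j ] p ≡ leafOf j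
    jobOf {p} (n≤p , p<2n) = fromℕ< lt , sym (trans (cong (n +_) (toℕ-fromℕ< lt)) (m+[n∸m]≡n n≤p))
      where lt = +-cancelˡ-< n _ _ (subst (_< n + n) (sym (m+[n∸m]≡n n≤p)) p<2n)

    leafOf-injective : ∀ {i j} → leafOf i ≡ leafOf j → i ≡ j
    leafOf-injective eq = toℕ-injective (+-cancelˡ-≡ n _ _ eq)

    record Loading (i : ℕ) (s : State) : Set c where
      field
        frame≡ : frame (view s) ≡ f₀
        size≡  : size# (view s) ≡ n
        idx≡   : idx (view s) ≡ i
        load≡  : ∀ j → leafOf j < i → load (view s) (leafOf j) ≡ key j
        leaf≡  : ∀ {p} → n ≤ p → p < i → winner (view s) p ≡ p

    run-loadKeys : frame (view s) ≡ f₀ →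
      (∀ {s′} → Loading (n + n) s′ → Q r s′) →
      Run (P.loadKeys b) s (2 + (n * 4 + suc r)) Q
    run-loadKeys {s = s} {Q = Q} {r = r} fr k = run-seq (run-nat (run-seq (run-nat
      (run-forUpTo (P.size# +ₙ P.size#) _ (n + n) 2 Loading Loading.idx≡
        (λ L → cong₂ _+_ (Loading.size≡ L) (Loading.size≡ L))
        body n refl start k))))
      where
      start : Loading n _
      start = record
        { frame≡ = fr ; size≡ = count-in s fr ; idx≡ = count-in s fr
        ; load≡ = λ j lt → contradiction (m≤m+n n (toℕ j)) (<⇒≱ lt)
        ; leaf≡ = λ n≤p p<n → contradiction n≤p (<⇒≱ p<n) }
      body : ∀ {i s r q} {Q : ℕ → State → Set q} → Loading i s → i < n + n →
        (∀ {s′} → Loading (suc i) ⟨ nats s′ [ 12 , 0 ≔ suc (idx (view s′)) ] , nums s′ ⟩ → Q r s′) →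
        Run (num[ 10 , P.idx ]≔ num[ b , P.idx ∸ₙ P.size# ] ⨾ nat[ 13 , P.idx ]≔ P.idx) s (2 + r) Q
      body {i} {s} L i<2n k = run-seq (run-num (run-nat (k record
        { frame≡ = frame≡ ; size≡ = size≡ ; idx≡ = cong suc idx≡
        ; load≡ = load≡′
        ; leaf≡ = leaf≡′ })))
        where
        open Loading L
        load≡′ : ∀ j → leafOf j < suc i →
          (load (view s) [ idx (view s) ↦ nums s b (idx (view s) ∸ size# (view s)) ]) (leafOf j) ≡ key j
        load≡′ j lt with idx (view s) ≟ leafOf j
        ... | yes eq rewrite eq = trans (↦-at {f = load (view s)} (leafOf j)) (trans
                (cong (nums s b) (trans (cong (leafOf j ∸_) size≡) (m+n∸m≡n n (toℕ j)))) (key-in s frame≡ j))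
        ... | no ≢ = trans (↦-off {f = load (view s)} ≢)
                (load≡ j (≤∧≢⇒< (s≤s⁻¹ lt) λ eq → ≢ (trans idx≡ (sym eq))))
        leaf≡′ : ∀ {p} → n ≤ p → p < suc i → (winner (view s) [ idx (view s) ↦ idx (view s) ]) p ≡ p
        leaf≡′ {p} n≤p lt with idx (view s) ≟ p
        ... | yes refl = ↦-at {f = winner (view s)} p
        ... | no ≢ = trans (↦-off {f = winner (view s)} ≢)
                (leaf≡ n≤p (≤∧≢⇒< (s≤s⁻¹ lt) λ eq → ≢ (trans idx≡ (sym eq))))

    -- Stated about `Rows` instead of a state, so that it passes through the replays by rewriting
    -- with an equation of rows. `dominated` is what keeps the output sorted when the next item is
    -- appended.
    record Extracted (i : ℕ) (R : Rows) : Set (c ⊔ ℓ) where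
      open Rows R
      field
        frame≡    : frameᴿ ≡ f₀
        size≡     : sizeᴿ ≡ n
        idx≡      : idxᴿ ≡ i
        out rest  : List (Fin n)
        all       : out ++ rest ↭ allFin n
        length≡   : length out ≡ i
        ordered   : Descending out
        dominated : All (λ x → All (λ y → key y ≤ᶠ key x) rest) out
        stored    : Stored out 0 orderᴿ
        alive     : ∀ {j} → j ∈ rest → loadᴿ (leafOf j) ≡ key j
        dead      : ∀ {j} → j ∉ rest → loadᴿ (leafOf j) ≡ 0#
        distinct  : Unique rest

    Extraction : ℕ → State → Set (c ⊔ ℓ)
    Extraction i s =
      Extracted i (rows (view s)) × Bests (Everywhere n) (load (view s)) (winner (view s))

    -- The root holds a job that is still alive since removed keys are 0#, below all others.
    root-alive : ∀ {i} → Extraction i s → i < n → ∃[ j ]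
      winner (view s) 1 ≡ leafOf j ×
      Σ[ E ∈ Extracted i (rows (view s)) ] (j ∈ Extracted.rest E × All (λ y → key y ≤ᶠ key j) (Extracted.rest E))
    root-alive {s = s} {i} (E , bs) i<n with jobOf (Best.leaf root)
      where
      root = best-node bs ≤-refl (+-mono-≤ 1≤n 1≤n) (λ _ → tt)
    ... | j , w≡ = j , w≡ , E , j∈ , All.tabulate (λ y∈ →
        subst₂ _≤ᶠ_ (alive y∈) (trans (cong (load (view s)) w≡) (alive j∈)) (Best.best root (leafOf-leaf _) (root≼ (≤-trans 1≤n (m≤m+n n _)))))
      where
      open Extracted E
      root = best-node bs ≤-refl (+-mono-≤ 1≤n 1≤n) (λ _ → tt)
      nonempty : ∀ (xs : List (Fin n)) → out ++ xs ↭ allFin n → ∃[ x ] x ∈ xs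
      nonempty (x ∷ xs) _ = x , here refl
      nonempty [] p = contradiction
        (trans (sym length≡) (trans (sym (trans (length-++ out) (+-identityʳ _)))
               (trans (↭-length p) (length-tabulate id)))) (<⇒≢ i<n)
      j∈ : j ∈ rest
      j∈ with j ∈? rest
      ... | yes j∈ = j∈
      ... | no none with nonempty rest all
      ...   | x , x∈ = contradiction
              (subst₂ _≤ᶠ_ (alive x∈) (trans (cong (load (view s)) w≡) (dead none))
                (Best.best root (leafOf-leaf x) (root≼ (≤-trans 1≤n (m≤m+n n _)))))
              (Fᴾ.<⇒≱ (0<key x))

    extract-one : ∀ {i} {R : Rows} (E : Extracted i R) (let open Rows R) {j} → j ∈ Extracted.rest E →
      All (λ y → key y ≤ᶠ key j) (Extracted.rest E) → ∀ {v} → v ≡ toℕ j →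
      Extracted (suc i) (record R { idxᴿ = suc idxᴿ ; orderᴿ = orderᴿ [ idxᴿ ↦ v ] ; loadᴿ = loadᴿ [ leafOf j ↦ 0# ] })
    extract-one {i} {R} E {j} j∈ top v≡ with ∈-∃++ j∈
    ... | as , bs , rest≡ = record
      { frame≡ = frame≡ ; size≡ = size≡ ; idx≡ = cong suc idx≡
      ; out = out ++ [ j ] ; rest = rest′
      ; all = ↭-trans (↭-trans (↭-reflexive (++-assoc out [ j ] rest′)) (++⁺ˡ out (↭-sym rest↭))) all
      ; length≡ = trans (length-++ out) (trans (+-comm _ 1) (cong suc length≡))
      ; ordered = AllPairs.++⁺ ordered ([] ∷ []) (All.map (λ below → All.lookup below j∈ ∷ []) dominated)
      ; dominated = All.++⁺ (All.map (λ below → All.tail (All-resp-↭ rest↭ below)) dominated)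
                            (All.tail (All-resp-↭ rest↭ top) ∷ [])
      ; stored = subst (λ z → Stored (out ++ [ j ]) 0 (orderᴿ [ z ↦ _ ])) (sym idx≡)
                   (Stored-snoc out stored length≡ v≡)
      ; alive = alive′ ; dead = dead′
      ; distinct = AllPairs-tail distinct′ }
      where
      open Extracted E
      open Rows R
      rest′ = as ++ bs
      rest↭ : rest ↭ j ∷ rest′
      rest↭ = ↭-trans (↭-reflexive rest≡) (shift j as bs)
      distinct′ : Unique (j ∷ rest′)
      distinct′ = Unique-resp-↭ rest↭ distinct
      AllPairs-tail : ∀ {x xs} → Unique (x ∷ xs) → Unique xs
      AllPairs-tail (_ ∷ u) = u
      j∉ : ∀ {x xs} → Unique (x ∷ xs) → x ∉ xs
      j∉ (x∉ ∷ _) x∈ = All.lookup x∉ x∈ refl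
      alive′ : ∀ {k} → k ∈ rest′ → (loadᴿ [ leafOf j ↦ 0# ]) (leafOf k) ≡ key k
      alive′ {k} k∈ = trans (↦-off {f = loadᴿ} λ eq → j∉ distinct′ (subst (_∈ rest′) (sym (leafOf-injective eq)) k∈))
                            (alive (∈-resp-↭ (↭-sym rest↭) (there k∈)))
      dead′ : ∀ {k} → k ∉ rest′ → (loadᴿ [ leafOf j ↦ 0# ]) (leafOf k) ≡ 0#
      dead′ {k} k∉ with j Fin.≟ k
      ... | yes refl = ↦-at {f = loadᴿ} (leafOf j)
      ... | no j≢k   = trans (↦-off {f = loadᴿ} (j≢k ∘ leafOf-injective)) (dead not-in)
        where
        not-in : k ∉ rest
        not-in k∈ with ∈-resp-↭ rest↭ k∈
        ... | here k≡j  = j≢k (sym k≡j)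
        ... | there k∈′ = k∉ k∈′

    module _ {L : ℕ} (2n≤2^L : n + n ≤ 2 ^ L) where

      run-extract : ∀ {i s r q} {Q : ℕ → State → Set q} → Extraction i s → i < n →
        (∀ {s′} → Extraction (suc i) ⟨ nats s′ [ 12 , 0 ≔ suc (idx (view s′)) ] , nums s′ ⟩ → Q r s′) →
        Run P.extract s (Time.extract L + r) Q
      run-extract {i} {s} {r} ex@(_ , bs) i<n k with root-alive {s = s} ex i<n
      ... | j , w≡ , E , j∈ , top =
        run-seq (run-nat (run-seq (run-num (run-seq (run-nat
          (more-time (≤-reflexive (sym (+-assoc (L * 4) 1 r)))
          (run-ascendMax L (<-≤-trans w<2n 2n≤2^L) w<2n
            (rekey-bests n≤w bs)
            λ {s′} rows≡ bs′ → k {s′} (finished rows≡ , bs′))))))))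
        where
        w = winner (view s) 1
        w<2n : w < n + n
        w<2n = subst (_< n + n) (sym w≡) (proj₂ (leafOf-leaf j))
        n≤w : n ≤ w
        n≤w = subst (n ≤_) (sym w≡) (proj₁ (leafOf-leaf j))
        next : Rows → Rows
        next R = record R { idxᴿ = suc (Rows.idxᴿ R) }
        after : ℕ → Rows
        after p = record (rows (view s))
          { orderᴿ = order (view s) [ idx (view s) ↦ w ∸ size# (view s) ] ; loadᴿ = load (view s) [ p ↦ 0# ] }
        finished : ∀ {R} → R ≡ after w → Extracted (suc i) (next R)
        finished refl = subst (λ z → Extracted (suc i) (next (after z))) (sym w≡)
          (extract-one E j∈ top (trans (cong₂ _∸_ w≡ (Extracted.size≡ E)) (m+n∸m≡n n (toℕ j))))

      run-sort : frame (view s) ≡ f₀ →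
        (∀ {s′} → frame (view s′) ≡ f₀ → size# (view s′) ≡ n → IsSorted (order (view s′)) → Q r s′) →
        Run (P.sortDescending b) s (Time.sort n L + r) Q
      run-sort {s = s} {Q = Q} {r = r} fr k = more-time (≤-reflexive (sym (time (n * 4) (n * (2 + Time.extract L)) r)))
        (run-seq (run-loadKeys {s = s} fr λ {s₁} Ld → run-seq (run-buildMax {s = s₁} (Loading.size≡ Ld)
          (λ (n≤p , p<2n) → Loading.leaf≡ Ld n≤p p<2n)
          λ {s₂} rows≡ bs → run-seq (run-nat (run-forUpTo P.size# P.extract n (Time.extract L) Extraction
            (λ (E , _) → Extracted.idx≡ E) (λ (E , _) → Extracted.size≡ E)
            run-extract n (+-identityʳ n) (start s₁ s₂ Ld rows≡ , bs)
            λ (E , _) → done E)))))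
        where
        time : ∀ a b r → 2 + (a + (2 + (a + (2 + (b + 1))))) + r ≡ 2 + (a + suc (suc (a + suc (suc (b + suc r)))))
        time = solve-∀
        start : ∀ s₁ s₂ → Loading (n + n) s₁ → rows (view s₂) ≡ rows (view s₁) →
                Extracted 0 (record (rows (view s₂)) { idxᴿ = 0 })
        start s₁ s₂ Ld rows≡ = subst (λ R → Extracted 0 (record R { idxᴿ = 0 })) (sym rows≡) (record
          { frame≡ = frame≡ ; size≡ = size≡ ; idx≡ = refl
          ; out = [] ; rest = allFin n ; all = ↭-refl ; length≡ = refl
          ; ordered = [] ; dominated = [] ; stored = tt
          ; alive = λ {j} _ → load≡ j (proj₂ (leafOf-leaf j))
          ; dead = λ {j} j∉ → contradiction (∈-allFin j) j∉
          ; distinct = allFin⁺ n })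
          where open Loading Ld
        done : ∀ {s′} → Extracted n (rows (view s′)) → Q r s′
        done E = k frame≡ size≡ (out , subst (λ z → z ↭ allFin n) (trans (cong (out ++_) (empty rest all)) (++-identityʳ out)) all
                                , ordered , stored)
          where
          open Extracted E
          empty : ∀ (xs : List (Fin n)) → out ++ xs ↭ allFin n → xs ≡ []
          empty [] _ = refl
          empty (x ∷ xs) p = contradiction
            (trans (sym (length-tabulate {n = n} id)) (trans (sym (↭-length p)) (trans (length-++ out) (trans (cong (_+ suc (length xs)) length≡) (+-suc n _)))))
            (<⇒≢ (s≤s (m≤m+n n (length xs))))

-- Machines at the leaves, sorted by speed.

module Placing {c ℓ} (F : OrderedField c ℓ) (m : ℕ) (1≤m : 1 ℕ.≤ m) where
  open import Data.Fin.Base using (Fin; toℕ)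
  open import Data.Fin.Properties using (toℕ-injective)
  open import Data.List.Base using (List; []; _∷_; length; allFin)
  open import Data.List.Properties using (length-tabulate)
  open import Data.List.Membership.Propositional using (_∈_)
  open import Data.List.Membership.Propositional.Properties using (∈-allFin)
  open import Data.List.Relation.Binary.Permutation.Propositional using (_↭_; ↭-sym)
  open import Data.List.Relation.Binary.Permutation.Propositional.Properties using (↭-length; ∈-resp-↭)
  open import Data.List.Relation.Unary.All as All using ([]; _∷_)
  open import Data.List.Relation.Unary.AllPairs using (AllPairs; []; _∷_)
  open import Data.List.Relation.Unary.Any using (here; there)
  open import Data.List.Relation.Unary.Unique.Propositional.Properties using (allFin⁺)
  open import Data.Nat.Base hiding (_/_; _⊔_)
  open import Data.Nat.Properties
  open import Data.Nat.Tactic.RingSolver using (solve-∀)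
  open import Relation.Binary.Definitions using (tri<; tri≈; tri>)
  open OrderedField F using (Carrier) renaming (_≤_ to _≤ᶠ_)
  private module Fᴾ = OrderedFieldProperties F
  open RealRAM F
  open TimedRuns F
  open Loops F
  open HeapTree using (Leaf; _≼_; pos; pos-bottom; pos-upper; 2^suc)
  open Sorting F using (Stored; Unique-resp-↭)
  open Update

  stored-at : ∀ {n} (xs : List (Fin n)) {k a i} → Stored xs k a → k ≤ i → i < k + length xs →
              ∃[ x ] x ∈ xs × a i ≡ toℕ x
  stored-at [] {k} _ k≤i i< = contradiction k≤i (<⇒≱ (subst (_ <_) (+-identityʳ k) i<))
  stored-at (x ∷ xs) {k} {i = i} (eq , st) k≤i i< with k ≟ i
  ... | yes refl = x , here refl , eq
  ... | no k≢i with stored-at xs st (≤∧≢⇒< k≤i k≢i) (subst (i <_) (+-suc k _) i<)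
  ...   | y , y∈ , eq′ = y , there y∈ , eq′

  stored-pair : ∀ {n r} {R : Fin n → Fin n → Set r} {xs k a i j} → AllPairs R xs → Stored xs k a →
                k ≤ i → i < j → j < k + length xs →
                ∃[ x ] ∃[ y ] a i ≡ toℕ x × a j ≡ toℕ y × R x y
  stored-pair {k = k} [] _ k≤i i<j j< =
    contradiction (≤-trans k≤i (<⇒≤ i<j)) (<⇒≱ (subst (_ <_) (+-identityʳ k) j<))
  stored-pair {xs = x ∷ xs} {k} {i = i} {j} (Rx ∷ R) (eq , st) k≤i i<j j< with k ≟ i
  ... | no k≢i = stored-pair R st (≤∧≢⇒< k≤i k≢i) i<j (subst (j <_) (+-suc k _) j<)
  ... | yes refl with stored-at xs st i<j (subst (j <_) (+-suc k _) j<)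
  ...   | y , y∈ , eq′ = x , y , eq , eq′ , All.lookup Rx y∈

  stored-index : ∀ {n} {xs : List (Fin n)} {k a x} → Stored xs k a → x ∈ xs →
                 ∃[ i ] i < k + length xs × a i ≡ toℕ x
  stored-index {xs = x ∷ xs} {k} (eq , st) (here refl) = k , m<m+n k (s≤s z≤n) , eq
  stored-index {xs = _ ∷ xs} {k} (eq , st) (there x∈) with stored-index st x∈
  ... | i , i< , eq′ = i , subst (i <_) (sym (+-suc k _)) i< , eq′

  -- By `surjective` a winner among the leaves is a winner among all machines; by `injective`
  -- raising the load of a leaf changes the load of one machine only.
  record Placement (speedOf : Fin m → Carrier) (machine : ℕ → ℕ) (speed : ℕ → Carrier) : Set (c ⊔ ℓ) where
    field
      occupant   : ∀ {p} → Leaf m p → ∃[ j ] machine p ≡ toℕ j × speed p ≡ speedOf j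
      injective  : ∀ {p q} → Leaf m p → Leaf m q → machine p ≡ machine q → p ≡ q
      surjective : ∀ (j : Fin m) → ∃[ p ] Leaf m p × machine p ≡ toℕ j
      sorted     : ∀ {u a b} → 1 ≤ u → u < m → Leaf m a → Leaf m b → u + u ≼ a → suc (u + u) ≼ b →
                   speed b ≤ᶠ speed a

  module _ (speedOf : Fin m → Carrier) {speeds : ℕ → Carrier} (speeds≡ : ∀ j → speeds (toℕ j) ≡ speedOf j)
           {order : ℕ → ℕ} {xs : List (Fin m)} (perm : xs ↭ allFin m)
           (descending : AllPairs (λ i i′ → speedOf i′ ≤ᶠ speedOf i) xs) (stored : Stored xs 0 order)
           {M h : ℕ} (M≡ : M ≡ 2 ^ h) (m≤M : m ≤ M) (M<2m : M < m + m)
           {machine : ℕ → ℕ} {speed : ℕ → Carrier}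
           (machine≡ : ∀ {p} → Leaf m p → machine p ≡ order (pos {M} m p))
           (speed≡ : ∀ {p} → Leaf m p → speed p ≡ speeds (order (pos {M} m p))) where

    private
      length≡ : length xs ≡ m
      length≡ = trans (↭-length perm) (length-tabulate id)

      pos<length : ∀ {p} → Leaf m p → pos {M} m p < length xs
      pos<length lp = subst (_ <_) (sym length≡) (HeapTree.pos< {h = h} M≡ m≤M M<2m lp)

      distinct : AllPairs _≢_ xs
      distinct = Unique-resp-↭ (↭-sym perm) (allFin⁺ m)

      order-injective : ∀ {i j} → i < length xs → j < length xs → order i ≡ order j → i ≡ j
      order-injective {i} {j} i< j< eq with <-cmp i j
      ... | tri≈ _ i≡j _ = i≡j
      ... | tri< i<j _ _ with stored-pair distinct stored z≤n i<j j<
      ...   | x , y , ix , jy , x≢y = contradiction (toℕ-injective (trans (sym ix) (trans eq jy))) x≢y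
      order-injective {i} {j} i< j< eq | tri> _ _ j<i with stored-pair distinct stored z≤n j<i i<
      ...   | x , y , jx , iy , x≢y = contradiction (toℕ-injective (trans (sym jx) (trans (sym eq) iy))) x≢y

      speed-at : ∀ {p j} → Leaf m p → order (pos {M} m p) ≡ toℕ j → speed p ≡ speedOf j
      speed-at {j = j} lp eq = trans (speed≡ lp) (trans (cong speeds eq) (speeds≡ j))

    placement : Placement speedOf machine speed
    placement = record
      { occupant = occupant
      ; injective = λ lp lq eq → HeapTree.pos-injective {h = h} M≡ m≤M M<2m lp lq
          (order-injective (pos<length lp) (pos<length lq)
            (trans (sym (machine≡ lp)) (trans eq (machine≡ lq))))
      ; surjective = surjective
      ; sorted = sorted }
      where
      occupant : ∀ {p} → Leaf m p → ∃[ j ] machine p ≡ toℕ j × speed p ≡ speedOf j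
      occupant lp with stored-at xs stored z≤n (pos<length lp)
      ... | j , _ , eq = j , trans (machine≡ lp) eq , speed-at lp eq
      surjective : ∀ (j : Fin m) → ∃[ p ] Leaf m p × machine p ≡ toℕ j
      surjective j with stored-index stored (∈-resp-↭ (↭-sym perm) (∈-allFin j))
      ... | i , i< , eq with HeapTree.pos-surjective {h = h} M≡ m≤M M<2m (subst (i <_) length≡ i<)
      ...   | p , lp , pos≡ = p , lp , trans (machine≡ lp) (trans (cong order pos≡) eq)
      sorted : ∀ {u a b} → 1 ≤ u → u < m → Leaf m a → Leaf m b → u + u ≼ a → suc (u + u) ≼ b →
               speed b ≤ᶠ speed a
      sorted 1≤u u<m la lb ua ub
        with m≤n⇒m<n∨m≡n (HeapTree.pos-ordered {h = h} M≡ m≤M M<2m 1≤u u<m la lb ua ub)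
      ... | inj₂ eq = Fᴾ.≤-reflexive (trans (speed≡ lb) (trans (cong (speeds ∘ order) (sym eq)) (sym (speed≡ la))))
      ... | inj₁ lt with stored-pair descending stored z≤n lt (pos<length lb)
      ...   | x , y , ax , by , y≤x = subst₂ _≤ᶠ_ (sym (speed-at lb by)) (sym (speed-at la ax)) y≤x

  record Base : Set c where
    field
      jobs machines : ℕ
      sizes speeds  : ℕ → Carrier
      order         : ℕ → ℕ
      size#         : ℕ

  base : View → Base
  base v = record { jobs = View.jobs v ; machines = View.machines v ; sizes = View.sizes v
                  ; speeds = View.speeds v ; order = View.order v ; size# = View.size# v }

  record Placed (v : View) : Set c where
    field
      {h}      : ℕ
      {M}      : ℕ
      M≡       : M ≡ 2 ^ h
      m≤M      : m ≤ M
      M<2m     : M < m + m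
      machine≡ : ∀ {p} → Leaf m p → machine v p ≡ order v (pos {M} m p)
      speed≡   : ∀ {p} → Leaf m p → speed v p ≡ speeds v (order v (pos {M} m p))

  private variable
    q : Level
    Q : ℕ → State → Set q
    s : State
    r : ℕ

  -- `k` bounds the doublings still to come: each adds at least one to the power of two. This gives
  -- up to `m` of them, which linear time allows.
  run-doubling : ∀ k h → bottom (view s) ≡ 2 ^ h → 2 ^ h < m + m → m ≤ k + 2 ^ h →
    size# (view s) ≡ m →
    (∀ {s′} h → base (view s′) ≡ base (view s) → bottom (view s′) ≡ 2 ^ h → 2 ^ h < m + m → m ≤ 2 ^ h → Q r s′) →
    Run (while lit 1 +ₙ P.bottom ≤ₙ P.size# loop (nat[ 16 , lit 0 ]≔ (P.bottom +ₙ P.bottom))) s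
        (k * 2 + suc r) Q
  run-doubling {s = s} {r = r} k h M≡ M< m≤ size≡ q with suc (bottom (view s)) ≤? size# (view s)
  ... | no ≰ = more-time (m≤n+m (suc r) (k * 2)) (run-exit (≰⇒test ≰)
    (q h refl M≡ M< (subst₂ _≤_ size≡ M≡ (≮⇒≥ ≰))))
  run-doubling zero h M≡ M< m≤ size≡ q | yes lt =
    contradiction (≤-trans (subst₂ _<_ M≡ size≡ lt) m≤) (<-irrefl refl)
  run-doubling {s = s} (suc k) h M≡ M< m≤ size≡ q | yes lt = run-again (≤⇒test lt) (run-nat
    (run-doubling k (suc h)
      (trans (cong₂ _+_ M≡ M≡) (sym (2^suc h)))
      (subst (_< m + m) (sym (2^suc h)) (+-mono-< M<m M<m))
      (≤-trans m≤ (≤-trans (s≤s (≤-reflexive (+-comm k (2 ^ h))))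
        (≤-trans (+-monoˡ-≤ k (+-monoˡ-≤ (2 ^ h) (m^n>0 2 h)))
          (≤-reflexive (trans (+-comm _ k) (cong (k +_) (sym (2^suc h))))))))
      size≡ q))
    where
    M<m : 2 ^ h < m
    M<m = subst₂ _<_ M≡ size≡ lt

  run-place : size# (view s) ≡ m →
    (∀ {s′} → base (view s′) ≡ base (view s) → Placed (view s′) → Q r s′) →
    Run P.placeMachines s (Time.place m + r) Q
  run-place {s = s} {r = r} size≡ k = more-time (≤-reflexive (time (m * 2) (m * 6) r))
    (run-seq (run-nat (run-seq (run-doubling m 0 refl (+-mono-≤ 1≤m 1≤m) (m≤m+n m 1) size≡
      λ {s₁} h base≡ M≡ M< m≤ → run-seq (run-nat
        (run-forUpTo (P.size# +ₙ P.size#) _ (m + m) 4 (Filling (2 ^ h)) Filling.idx≡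
          (λ L → cong₂ _+_ (size L) (size L)) body
          m refl
          (record { base≡ = base≡ ; bottom≡ = M≡ ; idx≡ = trans (cong Base.size# base≡) size≡
                  ; machine≡ = λ m≤p p<m → contradiction m≤p (<⇒≱ p<m)
                  ; speed≡ = λ m≤p p<m → contradiction m≤p (<⇒≱ p<m) })
          λ Fl → k (Filling.base≡ Fl) (record
            { h = h ; M≡ = refl ; m≤M = m≤ ; M<2m = M<
            ; machine≡ = λ (a , b) → Filling.machine≡ Fl a b
            ; speed≡ = λ (a , b) → Filling.speed≡ Fl a b })))))))
    where
    time : ∀ a b r → suc (a + suc (suc (b + suc r))) ≡ 1 + (a + (2 + (b + 1))) + r
    time = solve-∀
    record Filling (M i : ℕ) (s′ : State) : Set c where
      field
        base≡    : base (view s′) ≡ base (view s)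
        bottom≡  : bottom (view s′) ≡ M
        idx≡     : idx (view s′) ≡ i
        machine≡ : ∀ {p} → m ≤ p → p < i → machine (view s′) p ≡ order (view s′) (pos {M} m p)
        speed≡   : ∀ {p} → m ≤ p → p < i → speed (view s′) p ≡ speeds (view s′) (order (view s′) (pos {M} m p))
    size : ∀ {M i s} → Filling M i s → size# (view s) ≡ m
    size L = trans (cong Base.size# (Filling.base≡ L)) size≡
    module _ {M i} {s} (L : Filling M i s) where
      open Filling L
      fill : ∀ {x s′} → x ≡ order (view s) (pos {M} m (idx (view s))) →
        base (view s′) ≡ base (view s) → bottom (view s′) ≡ bottom (view s) → idx (view s′) ≡ idx (view s) →
        machine (view s′) ≡ (machine (view s)) [ idx (view s) ↦ x ] →
        speed (view s′) ≡ (speed (view s)) [ idx (view s) ↦ speeds (view s) x ] →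
        Filling M (suc i) ⟨ nats s′ [ 12 , 0 ≔ suc (idx (view s′)) ] , nums s′ ⟩
      fill {x} {s′} x≡ b≡ bo≡ i≡ ma≡ sp≡ = record
        { base≡ = trans b≡ base≡ ; bottom≡ = trans bo≡ bottom≡ ; idx≡ = cong suc (trans i≡ idx≡)
        ; machine≡ = machine′ ; speed≡ = speed′ }
        where
        machine′ : ∀ {p} → m ≤ p → p < suc i → machine (view s′) p ≡ order (view s′) (pos {M} m p)
        machine′ {p} m≤p lt rewrite cong (λ f → f p) ma≡ | cong (λ b → Base.order b (pos {M} m p)) b≡ with idx (view s) ≟ p
        ... | yes refl = trans (↦-at {f = machine (view s)} p) x≡
        ... | no ≢ = trans (↦-off {f = machine (view s)} ≢)
                (machine≡ m≤p (≤∧≢⇒< (s≤s⁻¹ lt) λ eq → ≢ (trans idx≡ (sym eq))))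
        speed′ : ∀ {p} → m ≤ p → p < suc i → speed (view s′) p ≡ speeds (view s′) (order (view s′) (pos {M} m p))
        speed′ {p} m≤p lt rewrite cong (λ f → f p) sp≡ | cong (λ b → Base.speeds b (Base.order b (pos {M} m p))) b≡ with idx (view s) ≟ p
        ... | yes refl = trans (↦-at {f = speed (view s)} p) (cong (speeds (view s)) x≡)
        ... | no ≢ = trans (↦-off {f = speed (view s)} ≢)
                (speed≡ m≤p (≤∧≢⇒< (s≤s⁻¹ lt) λ eq → ≢ (trans idx≡ (sym eq))))
    body : ∀ {M i s r q} {Q : ℕ → State → Set q} → Filling M i s → i < m + m →
      (∀ {s′} → Filling M (suc i) ⟨ nats s′ [ 12 , 0 ≔ suc (idx (view s′)) ] , nums s′ ⟩ → Q r s′) →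
      Run ((when P.bottom ≤ₙ P.idx
              then nat[ 17 , lit 0 ]≔ P.order (P.idx ∸ₙ P.bottom)
              else (nat[ 17 , lit 0 ]≔ P.order (P.idx +ₙ P.size# ∸ₙ P.bottom))) ⨾
           nat[ 15 , P.idx ]≔ P.scratch ⨾
           num[ 11 , P.idx ]≔ num[ 1 , P.scratch ]) s (4 + r) Q
    body {M} {i} {s} L i< k = run-seq (run-whenₙ
      (λ le → run-nat (run-seq (run-nat (run-num (k (fill {s = s} L
        (cong (order (view s)) (trans (cong (idx (view s) ∸_) bottom≡) (sym (pos-bottom {M} (subst (_≤ _) bottom≡ le)))))
        refl refl refl refl refl))))))
      (λ ≰ → run-nat (run-seq (run-nat (run-num (k (fill {s = s} L
        (cong (order (view s)) (trans (cong₂ (λ a b → (idx (view s) + a) ∸ b) (size L) bottom≡)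
          (sym (pos-upper {M} (λ le → ≰ (subst (_≤ _) (sym bottom≡) le))))))
        refl refl refl refl refl)))))))
      where open Filling L

-- Running the kinetic tournament within its potential.

module KineticRuns {c ℓ} (F : OrderedField c ℓ) (m : ℕ) where
  open import Data.Bool.Base using (Bool; true; not; _∧_)
  open import Data.Nat.Base hiding (_/_; _⊔_)
  open import Data.Nat.Properties hiding (_≤?_)
  open import Data.Nat.Tactic.RingSolver using (solve-∀)
  open OrderedField F using (Carrier; 0#; _≤?_) renaming (_≤_ to _≤ᶠ_; _<_ to _<ᶠ_)
  private module Fᴾ = OrderedFieldProperties F
  open RealRAM F
  open TimedRuns F
  open Loops F
  open HeapTree using (_≼_; ⋠0; half-left; half-right; left<2N; right<2N; *-2^suc)
  open Replaying m
  open Update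
  open KineticTournament F m hiding (module Contest)
  private module C = KineticTournament.Contest

  private variable
    q : Level
    Q : ℕ → State → Set q
    s : State
    r : ℕ

  contest : View → Contest
  contest v = record { load = load v ; speed = speed v ; winner = winner v ; failure = failure v ; now = now v }

  -- the part of the view that replaying leaves alone
  record Rows : Set c where
    field
      jobs machines : ℕ
      sizes speeds  : ℕ → Carrier
      schedule      : ℕ → ℕ
      size# idx     : ℕ
      order machine : ℕ → ℕ
      load speed    : ℕ → Carrier
      now           : Carrier

  rows : View → Rows
  rows v = record
    { jobs = View.jobs v ; machines = View.machines v ; sizes = View.sizes v ; speeds = View.speeds v
    ; schedule = View.schedule v ; size# = View.size# v ; idx = View.idx v ; order = View.order v
    ; machine = View.machine v ; load = View.load v ; speed = View.speed v ; now = View.now v }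

  Replayed : ∀ {q} → State → ℕ → (ℕ → State → Set q) → Set (c ⊔ ℓ ⊔ q)
  Replayed s r Q = ∀ {w f s′} → ptr (view s′) ≡ ptr (view s) → rows (view s′) ≡ rows (view s) →
    contest (view s′) ≡ replay (contest (view s)) (ptr (view s)) w f →
    Outcome (contest (view s)) (ptr (view s)) w f → Q r s′

  -- The longest way, which compares the winners and then stores the crossing, takes 11 steps; on
  -- shorter ways the rest of the credit is given up.
  run-replayKinetic : Replayed s r Q → Run P.replayKinetic s (11 + r) Q
  run-replayKinetic {s} {r} {Q = Q} k = run-seq (run-num (run-seq (run-whenᴿ
      (λ fl≤fr → run-num (run-seq (run-nat (run-choice k (inj₂ refl) fl≤fr Fᴾ.≤-refl))))
      (λ fl≰fr → run-skip (run-seq (run-nat (run-choice k (inj₁ refl) Fᴾ.≤-refl (Fᴾ.≰⇒≥ fl≰fr))))))))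
    where
    run-store : ∀ {s r q} {Q : ℕ → State → Set q} → Replayed s r Q →
      Outcome (contest (view s)) (ptr (view s)) (nats s 17 0) (nums s 14 0) →
      Run (num[ 12 , P.ptr ]≔ P.fail ⨾ nat[ 13 , P.ptr ]≔ P.scratch) s (2 + r) Q
    run-store k o = run-seq (run-num (run-nat (k refl refl refl o)))
    run-choice : ∀ {s r q} {Q : ℕ → State → Set q} → let v = view s; p = ptr v in Replayed s r Q →
      nums s 14 0 ≡ failure v (p + p) ⊎ nums s 14 0 ≡ failure v (suc (p + p)) →
      failure v (p + p) ≤ᶠ nums s 14 0 → failure v (suc (p + p)) ≤ᶠ nums s 14 0 →
      Run ((when P.now ≤ᴿ P.fail then skip else
             (when P.finish (P.winner P.rightOf) ≤ᴿ P.finish (P.winner P.leftOf)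
               then nat[ 17 , lit 0 ]≔ P.winner P.rightOf
               else (num[ 15 , lit 0 ]≔
                       ((P.load (P.winner P.leftOf) ⊖ P.load (P.winner P.rightOf)) ⊘
                        (oneᴿ ⊘ P.speed (P.winner P.rightOf) ⊖ oneᴿ ⊘ P.speed (P.winner P.leftOf))) ⨾
                     (when P.fail ≤ᴿ P.cross then num[ 14 , lit 0 ]≔ P.cross else skip)))) ⨾
           num[ 12 , P.ptr ]≔ P.fail ⨾ nat[ 13 , P.ptr ]≔ P.scratch)
        ⟨ nats s [ 17 , 0 ≔ winner v (p + p) ] , nums s ⟩ (7 + r) Q
    run-choice k f≡ fl≤ fr≤ = run-seq (run-whenᴿ
      (λ x≤f → run-skip (more-time (m≤n+m _ 3) (run-store k (stalled refl x≤f f≡))))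
      (λ x≰f → run-whenᴿ
        (λ r≤l → run-nat (more-time (m≤n+m _ 2) (run-store k (right refl x≰f f≡ fl≤ fr≤ r≤l))))
        (λ r≰l → run-seq (run-num (run-whenᴿ
          (λ f≤c → run-num (run-store k (left refl
            (λ x≤ → x≰f (Fᴾ.≤-trans x≤ fl≤)) (λ x≤ → x≰f (Fᴾ.≤-trans x≤ fr≤))
            (Fᴾ.≤-trans fl≤ f≤c) (Fᴾ.≤-trans fr≤ f≤c) Fᴾ.≤-refl (inj₂ (inj₂ refl)) r≰l)))
          (λ f≰c → run-skip (run-store k (left refl
            (λ x≤ → x≰f (Fᴾ.≤-trans x≤ fl≤)) (λ x≤ → x≰f (Fᴾ.≤-trans x≤ fr≤))
            fl≤ fr≤ (Fᴾ.≰⇒≥ f≰c) (widen f≡) r≰l))))))))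
      where
      widen : ∀ {a b c} {A : Set a} {B : Set b} {C : Set c} → A ⊎ B → A ⊎ B ⊎ C
      widen (inj₁ a) = inj₁ a
      widen (inj₂ b) = inj₂ (inj₁ b)

  -- `Done` are the nodes whose winner and failure size are reliable, `Taken` those whose bit is.
  -- The sets differ during a repair: no load changes, so all bits stay valid while nodes above the
  -- repaired one are not yet recomputed. `slack` is the amount by which the potential may still
  -- rise.
  record Kinetic (Done Taken : ℕ → Set) (slack B : ℕ) (D : Contest) : Set (c ⊔ ℓ) where
    field
      leaves    : LeavesSet D
      side      : ℕ → Bool
      nodes     : Nodes Done D side
      takeovers : Takeovers Taken D side
      bound     : count side m + slack ≤ B

  Settled : ℕ → Contest → Set (c ⊔ ℓ)
  Settled = Kinetic Everywhere Everywhere 0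

  module _ {D : Contest} {k w f} (o : Outcome D k w f) where

    -- After a load change the old bit of `k` asserts nothing. Restarting it from `true` makes
    -- `TakenOver` vacuous and costs at most one unit of slack.
    replay-update : ∀ {Done Done′ l B} → Step Done Done′ k →
      Kinetic Done Done (suc l) B D → Kinetic Done′ Done′ l B (replay D k w f)
    replay-update {l = l} st K = record
      { leaves = replay-leaves (Step.k<N st) leaves
      ; side = side [ k ↦ sideAfter true o ]
      ; nodes = replay-nodes leaves nodes st o true
      ; takeovers = replay-takeovers leaves nodes st o true
          (λ 1≤u d u≢k → proj₁ (Step.earlier st 1≤u d u≢k)) (λ ()) takeovers
      ; bound = ≤-trans (+-monoˡ-≤ l (count-↦ side k (sideAfter true o) m))
                  (≤-trans (≤-reflexive (sym (+-suc _ l))) bound) }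
      where open Kinetic K

    -- No load has changed, so the bit of `k` is still valid and can only fall; no slack is spent.
    replay-advance : ∀ {Done Done′ l B} → Step Done Done′ k →
      Kinetic Done Everywhere l B D → Kinetic Done′ Everywhere l B (replay D k w f)
    replay-advance {l = l} st K = record
      { leaves = replay-leaves (Step.k<N st) leaves
      ; side = side [ k ↦ sideAfter (side k) o ]
      ; nodes = replay-nodes leaves nodes st o (side k)
      ; takeovers = replay-takeovers leaves nodes st o (side k) (λ _ _ _ → tt) taken takeovers
      ; bound = ≤-trans (+-monoˡ-≤ l (replay-count leaves nodes st o taken)) bound }
      where
      open Kinetic K
      taken = takeovers (Step.1≤k st) (Step.k<N st) tt

    -- The bit of `k` falls from `true` to `false`. That it was set also shows that the bound `B` is
    -- positive.
    replay-event : ∀ {Done Done′ B} → Step Done Done′ k → Done k → 0# <ᶠ C.now D →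
      C.now D ≤ᶠ C.failure D k →
      ¬ C.now D ≤ᶠ C.failure D (k + k) → ¬ C.now D ≤ᶠ C.failure D (suc (k + k)) →
      Kinetic Done Everywhere 0 B D →
      ∃[ B′ ] B ≡ suc B′ × Kinetic Done′ Everywhere 0 B′ (replay D k w f)
    replay-event {B = B} st done 0<x x≤f x≰fl x≰fr K = lower B (≤-trans (+-monoˡ-≤ 0 dropped) bound)
      where
      open Kinetic K
      taken = takeovers (Step.1≤k st) (Step.k<N st) tt
      dropped = hand-over-count leaves nodes st o 0<x (Nodes.caused nodes (Step.1≤k st) (Step.k<N st) done) x≤f x≰fl x≰fr
      lower : ∀ B → suc (count (side [ k ↦ sideAfter (side k) o ]) m) + 0 ≤ B →
              ∃[ B′ ] B ≡ suc B′ × Kinetic _ Everywhere 0 B′ (replay D k w f)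
      lower (suc B′) (s≤s le) = B′ , refl , record
        { leaves = replay-leaves (Step.k<N st) leaves
        ; side = side [ k ↦ sideAfter (side k) o ]
        ; nodes = replay-nodes leaves nodes st o (side k)
        ; takeovers = replay-takeovers leaves nodes st o (side k) (λ _ _ _ → tt) taken takeovers
        ; bound = le }

  event-step : ∀ {k} → 1 ≤ k → k < m → Step Everywhere (Beside k) k
  event-step 1≤k k<m = record
    { 1≤k = 1≤k ; k<N = k<m ; left-done = tt ; right-done = tt
    ; earlier = λ {u} 1≤u beside u≢k → tt ,
        (λ eq → beside (subst (u ≼_) (sym (trans (cong ⌊_/2⌋ eq) (half-left u))) _≼_.here)) ,
        (λ eq → beside (subst (u ≼_) (sym (trans (cong ⌊_/2⌋ eq) (half-right u))) _≼_.here)) }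

  beside-root : ∀ {p u} → p < 2 → 1 ≤ u → Beside p u
  beside-root {0} _ 1≤u = ⋠0 1≤u
  beside-root {1} _ 1≤u = ⋠0 1≤u
  beside-root {suc (suc p)} (s≤s (s≤s ()))

  settle-nodes : ∀ {p Taken l B D} → p < 2 → Kinetic (Beside p) Taken l B D → Kinetic Everywhere Taken 0 B D
  settle-nodes {l = l} p<2 K = record
    { leaves = leaves ; side = side
    ; nodes = record { trusted = λ 1≤u u<m _ → Nodes.trusted nodes 1≤u u<m (beside-root p<2 1≤u)
                     ; caused = λ 1≤u u<m _ → Nodes.caused nodes 1≤u u<m (beside-root p<2 1≤u) }
    ; takeovers = takeovers
    ; bound = ≤-trans (+-monoʳ-≤ (count side m) z≤n) bound }
    where open Kinetic K

  settle-takeovers : ∀ {p Done l B D} → p < 2 → Kinetic Done (Beside p) l B D → Kinetic Done Everywhere l B D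
  settle-takeovers p<2 K = record
    { leaves = leaves ; side = side ; nodes = nodes ; bound = bound
    ; takeovers = λ 1≤u u<m _ → takeovers 1≤u u<m (beside-root p<2 1≤u) }
    where open Kinetic K

  module _ (R₀ : Rows) (G : ℕ → ℕ → Contest → Set (c ⊔ ℓ))
           (G-replay : ∀ {l p D w f} → 2 ≤ p → p < m + m → Outcome D ⌊ p /2⌋ w f →
                       G (suc l) p D → G l ⌊ p /2⌋ (replay D ⌊ p /2⌋ w f)) where

    run-ascendKinetic : ∀ l → ptr (view s) < 2 ^ l → ptr (view s) < m + m →
      rows (view s) ≡ R₀ → G l (ptr (view s)) (contest (view s)) →
      (∀ {l p s′} → p < 2 → rows (view s′) ≡ R₀ → G l p (contest (view s′)) → Q r s′) →
      Run (P.ascend P.replayKinetic) s (l * 13 + suc r) Q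
    run-ascendKinetic l p<2^l p<2m rows≡ g k = run-ascend P.replayKinetic 11 J run-replay l p<2^l
      (p<2m , rows≡ , g) λ p<2 (_ , rows≡′ , g′) → k p<2 rows≡′ g′
      where
      J : ℕ → State → Set (c ⊔ ℓ)
      J l s = ptr (view s) < m + m × rows (view s) ≡ R₀ × G l (ptr (view s)) (contest (view s))
      run-replay : ∀ {l s r q} {Q : ℕ → State → Set q} → J (suc l) s → 2 ≤ ptr (view s) →
        (∀ {s′} → ptr (view s′) ≡ ⌊ ptr (view s) /2⌋ → J l s′ → Q r s′) →
        Run P.replayKinetic ⟨ nats s [ 11 , 0 ≔ ⌊ ptr (view s) /2⌋ ] , nums s ⟩ (11 + r) Q
      run-replay {l} {s} (p<2m , rows≡ , g) 2≤p k = run-replayKinetic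
        λ {w} {f} {s′} ptr≡ rows≡′ contest≡ o → k ptr≡
          ( subst (_< m + m) (sym ptr≡) (≤-<-trans (⌊n/2⌋≤n (ptr (view s))) p<2m)
          , trans rows≡′ rows≡
          , subst₂ (G l) (sym ptr≡) (sym contest≡) (G-replay 2≤p p<2m o g) )

  run-updateAscend : ∀ l {B} → ptr (view s) < 2 ^ l → ptr (view s) < m + m →
    Kinetic (Beside (ptr (view s))) (Beside (ptr (view s))) l B (contest (view s)) →
    (∀ {s′} → rows (view s′) ≡ rows (view s) → Settled B (contest (view s′)) → Q r s′) →
    Run (P.ascend P.replayKinetic) s (l * 13 + suc r) Q
  run-updateAscend {s = s} l {B} p<2^l p<2m K k = run-ascendKinetic (rows (view s))
    (λ l p D → Kinetic (Beside p) (Beside p) l B D)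
    (λ 2≤p p<2m o → replay-update o (ascend-step 2≤p p<2m))
    l p<2^l p<2m refl K λ p<2 rows≡ K′ → k rows≡ (settle-takeovers p<2 (settle-nodes p<2 K′))

  run-advanceAscend : ∀ l {B} → ptr (view s) < 2 ^ l → ptr (view s) < m + m →
    Kinetic (Beside (ptr (view s))) Everywhere 0 B (contest (view s)) →
    (∀ {s′} → rows (view s′) ≡ rows (view s) → Settled B (contest (view s′)) → Q r s′) →
    Run (P.ascend P.replayKinetic) s (l * 13 + suc r) Q
  run-advanceAscend {s = s} l {B} p<2^l p<2m K k = run-ascendKinetic (rows (view s))
    (λ l p D → Kinetic (Beside p) Everywhere 0 B D)
    (λ 2≤p p<2m o → replay-advance o (ascend-step 2≤p p<2m))
    l p<2^l p<2m refl K λ p<2 rows≡ K′ → k rows≡ (settle-nodes p<2 K′)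

  run-buildKinetic : size# (view s) ≡ m → LeavesSet (contest (view s)) →
    (∀ {s′} → rows (view s′) ≡ rows (view s) → Settled (m + m) (contest (view s′)) → Q r s′) →
    Run (P.build P.replayKinetic) s (suc (m * 13 + suc r)) Q
  run-buildKinetic {s = s} size≡ L k = run-build P.replayKinetic 11 m J run-replay size≡ (LeavesSet.1≤N L)
    (≤-reflexive size≡ , refl , record
      -- Set bits claim no takeover, so nothing has to be known before the build. They count at most
      -- `m`, and another `m` is the slack for the replays.
      { leaves = L ; side = λ _ → true
      ; nodes = record { trusted = λ _ u<m m≤u → contradiction (subst (_≤ _) size≡ m≤u) (<⇒≱ u<m)
                       ; caused = λ _ u<m m≤u → contradiction (subst (_≤ _) size≡ m≤u) (<⇒≱ u<m) }
      ; takeovers = λ _ _ _ ()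
      ; bound = +-mono-≤ (count≤ _ m) (≤-reflexive size≡) })
    λ ptr≡1 (_ , rows≡ , K) → k rows≡ (finish ptr≡1 K)
    where
    J : State → Set (c ⊔ ℓ)
    J s′ = ptr (view s′) ≤ m × rows (view s′) ≡ rows (view s) ×
           Kinetic (ptr (view s′) ≤_) (ptr (view s′) ≤_) (ptr (view s′)) (m + m) (contest (view s′))
    finish : ∀ {p D} → p ≡ 1 → Kinetic (p ≤_) (p ≤_) p (m + m) D → Settled (m + m) D
    finish refl K = record
      { leaves = leaves ; side = side
      ; nodes = record { trusted = λ 1≤u u<m _ → Nodes.trusted nodes 1≤u u<m 1≤u
                       ; caused = λ 1≤u u<m _ → Nodes.caused nodes 1≤u u<m 1≤u }
      ; takeovers = λ 1≤u u<m _ → takeovers 1≤u u<m 1≤u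
      ; bound = ≤-trans (+-monoʳ-≤ (count side m) z≤n) bound }
      where open Kinetic K
    run-replay : ∀ {s r q} {Q : ℕ → State → Set q} → J s → 2 ≤ ptr (view s) →
      (∀ {s′} → ptr (view s′) ≡ ptr (view s) ∸ 1 → J s′ → Q r s′) →
      Run P.replayKinetic ⟨ nats s [ 11 , 0 ≔ ptr (view s) ∸ 1 ] , nums s ⟩ (11 + r) Q
    run-replay {s = s} (p≤m , rows≡ , K) 2≤p k = run-replayKinetic
      λ {w} {f} {s′} ptr≡ rows≡′ contest≡ o → k ptr≡
        ( ≤-trans (≤-reflexive ptr≡) (≤-trans (m∸n≤m (ptr (view s)) 1) p≤m)
        , trans rows≡′ rows≡
        , subst₂ (λ p D → Kinetic (p ≤_) (p ≤_) p (m + m) D) (sym ptr≡) (sym contest≡)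
            (replay-update o (build-step (≤-pred 2≤p′) (≤-trans (≤-reflexive 1+p-1) p≤m))
              (subst (λ p → Kinetic (p ≤_) (p ≤_) p (m + m) (contest (view s))) (sym 1+p-1) K)) )
      where
      1+p-1 : suc (ptr (view s) ∸ 1) ≡ ptr (view s)
      1+p-1 = sym (+-∸-assoc 1 (≤-trans (s≤s z≤n) 2≤p))
      2≤p′ : 2 ≤ suc (ptr (view s) ∸ 1)
      2≤p′ = subst (2 ≤_) (sym 1+p-1) 2≤p

  -- Leaves never fail, so the descent stops at an inner node.
  inner : ∀ {D p} → LeavesSet D → 0# <ᶠ C.now D → p < m + m → C.now D ≤ᶠ C.failure D p → p < m
  inner {D} {p} L 0<x p<2m x≤f with p <? m
  ... | yes lt = lt
  ... | no ≮ = contradiction (subst (C.now D ≤ᶠ_) (LeavesSet.failure≡0 L (≮⇒≥ ≮ , p<2m)) x≤f) (Fᴾ.<⇒≱ 0<x)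

  Lowest : State → Set ℓ
  Lowest s = let p = ptr (view s) ; x = now (view s) ; f = failure (view s) in
    x ≤ᶠ f p × ¬ x ≤ᶠ f (p + p) × ¬ x ≤ᶠ f (suc (p + p))

  module _ (D : Contest) (R₀ : Rows) (L : LeavesSet D) (0<x : 0# <ᶠ C.now D) where

    private
      DescentTo : (State → Set ℓ) → State → Set (c ⊔ ℓ)
      DescentTo X s = contest (view s) ≡ D × rows (view s) ≡ R₀ ×
        1 ≤ ptr (view s) × ptr (view s) < m × X s

    -- `m ≤ ptr * 2 ^ l` limits the descent to `l` levels: at `l = 0` the failing node would be a
    -- leaf.
    run-descend-loop : ∀ l → contest (view s) ≡ D → rows (view s) ≡ R₀ →
      1 ≤ ptr (view s) → ptr (view s) < m + m → now (view s) ≤ᶠ failure (view s) (ptr (view s)) →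
      m ≤ ptr (view s) * 2 ^ l →
      (∀ {s′} → DescentTo Lowest s′ → Q r s′) →
      Run (while ¬ₜ (¬ₜ (P.now ≤ᴿ P.failure P.leftOf) ∧ₜ ¬ₜ (P.now ≤ᴿ P.failure P.rightOf)) loop
            (when P.now ≤ᴿ P.failure P.leftOf
               then nat[ 11 , lit 0 ]≔ P.leftOf
               else (nat[ 11 , lit 0 ]≔ P.rightOf))) s (l * 3 + suc r) Q
    run-descend-loop {s = s} {r = r} l refl refl 1≤p p<2m x≤f m≤ k
      with now (view s) ≤? failure (view s) (ptr (view s) + ptr (view s))
         | now (view s) ≤? failure (view s) (suc (ptr (view s) + ptr (view s)))
    run-descend-loop {s = s} {r = r} l refl refl 1≤p p<2m x≤f m≤ k | no x≰fl | no x≰fr =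
      more-time (m≤n+m (suc r) (l * 3)) (run-exit
        (cong₂ (λ a b → not (not a ∧ not b)) (test-no x≰fl) (test-no x≰fr))
        (k (refl , refl , 1≤p , inner L 0<x p<2m x≤f , x≤f , x≰fl , x≰fr)))
    run-descend-loop {s = s} zero refl refl 1≤p p<2m x≤f m≤ k | _ | _ =
      contradiction (≤-trans m≤ (≤-reflexive (*-identityʳ (ptr (view s))))) (<⇒≱ (inner L 0<x p<2m x≤f))
    run-descend-loop {s = s} (suc l) refl refl 1≤p p<2m x≤f m≤ k | yes x≤fl | _ = run-again
      (cong (λ a → not (not a ∧ not (test (P.now ≤ᴿ P.failure P.rightOf) s))) (test-yes x≤fl))
      (run-then (test-yes x≤fl) (run-nat (run-descend-loop l refl refl
        (≤-trans 1≤p (m≤m+n p p)) (left<2N p<m) x≤fl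
        (≤-trans m≤ (≤-reflexive (*-2^suc p l))) k)))
      where
      p = ptr (view s)
      p<m = inner L 0<x p<2m x≤f
    run-descend-loop {s = s} (suc l) refl refl 1≤p p<2m x≤f m≤ k | no x≰fl | yes x≤fr = run-again
      (cong₂ (λ a b → not (not a ∧ not b)) (test-no x≰fl) (test-yes x≤fr))
      (run-else (test-no x≰fl) (run-nat (run-descend-loop l refl refl
        (s≤s z≤n) (right<2N p<m) x≤fr
        (≤-trans m≤ (≤-trans (≤-reflexive (*-2^suc p l)) (*-monoˡ-≤ (2 ^ l) (n≤1+n (p + p))))) k)))
      where
      p = ptr (view s)
      p<m = inner L 0<x p<2m x≤f

  module _ (1≤m : 1 ≤ m) {L : ℕ} (2m≤2^L : m + m ≤ 2 ^ L) where

    private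
      <2^L : ∀ {p} → p < m + m → p < 2 ^ L
      <2^L p<2m = <-≤-trans p<2m 2m≤2^L

    -- The loop in `advance` has already paid for its test, hence `pred`.
    run-event : ∀ {B} → Settled B (contest (view s)) → 0# <ᶠ now (view s) →
      now (view s) ≤ᶠ failure (view s) 1 →
      (∀ {B′ s′} → B ≡ suc B′ → rows (view s′) ≡ rows (view s) → Settled B′ (contest (view s′)) → Q r s′) →
      Run (P.descend ⨾ P.replayKinetic ⨾ P.ascend P.replayKinetic) s (pred (Time.event L) + r) Q
    run-event {s = s} {r = r} {B = B} K 0<x x≤f k = more-time (≤-reflexive (time (L * 3) (L * 13) r))
      (run-seq (run-seq (run-nat (run-descend-loop (contest (view s)) (rows (view s)) (Kinetic.leaves K) 0<x
        L refl refl ≤-refl (+-mono-≤ 1≤m 1≤m) x≤f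
        (≤-trans (≤-trans (m≤m+n m m) 2m≤2^L) (≤-reflexive (sym (*-identityˡ (2 ^ L)))))
        λ {s₁} (contest≡ , rows≡ , 1≤p , p<m , x≤fp , x≰fl , x≰fr) →
          run-seq (run-replayKinetic λ {w} {f} {s₂} ptr≡ rows≡′ contest≡′ o →
            finish s₁ s₂ ptr≡ (trans rows≡′ rows≡) contest≡′ p<m
              (replay-event o (event-step 1≤p p<m) tt
                (subst (λ D → 0# <ᶠ C.now D) (sym contest≡) 0<x) x≤fp x≰fl x≰fr
                (subst (Settled B) (sym contest≡) K)))))))
      where
      time : ∀ a b r → suc (a + suc (11 + (b + suc r))) ≡ suc (a + 1) + (11 + (b + 1)) + r
      time = solve-∀
      finish : ∀ s₁ s₂ {w f} → ptr (view s₂) ≡ ptr (view s₁) → rows (view s₂) ≡ rows (view s) →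
        contest (view s₂) ≡ replay (contest (view s₁)) (ptr (view s₁)) w f → ptr (view s₁) < m →
        ∃[ B′ ] B ≡ suc B′ × Kinetic (Beside (ptr (view s₁))) Everywhere 0 B′
                               (replay (contest (view s₁)) (ptr (view s₁)) w f) →
        Run (P.ascend P.replayKinetic) s₂ (L * 13 + suc r) _
      finish s₁ s₂ ptr≡ rows≡ contest≡ p<m (B′ , B≡ , K′) =
        run-advanceAscend L (<2^L p<2m) p<2m
          (subst₂ (λ p D → Kinetic (Beside p) Everywhere 0 B′ D) (sym ptr≡) (sym contest≡) K′)
          λ rows≡′ → k B≡ (trans rows≡′ rows≡)
        where p<2m = subst (_< m + m) (sym ptr≡) (<-≤-trans p<m (m≤m+n m m))

    -- Credit for one more event than the potential B allows: this way an event can be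
    -- run before it is known that B is positive.
    run-advance : ∀ B → Settled B (contest (view s)) → 0# <ᶠ now (view s) →
      (∀ {B′ s′} → rows (view s′) ≡ rows (view s) → Settled B′ (contest (view s′)) →
         ¬ now (view s′) ≤ᶠ failure (view s′) 1 → Q (suc B′ * Time.event L + r) s′) →
      Run P.advance s (suc B * Time.event L + suc r) Q
    run-advance {s = s} {r = r} B K 0<x k with now (view s) ≤? failure (view s) 1
    ... | no x≰f = more-time (≤-reflexive (sym (+-suc (suc B * Time.event L) r))) (run-exit (test-no x≰f) (k refl K x≰f))
    ... | yes x≤f = run-again (test-yes x≤f) (more-time (≤-reflexive (sym (+-assoc (pred (Time.event L)) (B * Time.event L) (suc r))))
      (run-event K 0<x x≤f continue))
      where
      continue : ∀ {B′ s′} → B ≡ suc B′ → rows (view s′) ≡ rows (view s) → Settled B′ (contest (view s′)) →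
                 Run P.advance s′ (B * Time.event L + suc r) _
      continue {B′} {s′} refl rows≡ K′ = run-advance B′ K′
        (subst (λ R → 0# <ᶠ Rows.now R) (sym rows≡) 0<x) λ rows≡′ → k (trans rows≡′ rows≡)

-- Assigning the jobs, and the makespan.

module LPTRuns {c ℓ} (F : OrderedField c ℓ) {n m : ℕ} (1≤m : 1 ℕ.≤ m)
               (I : Scheduling.Instance F n m) where
  open import Data.Fin.Base using (Fin; toℕ)
  open import Data.Fin.Properties using (toℕ-injective)
  open import Data.List.Base using (List; []; _∷_; length)
  open import Data.List.Membership.Propositional using (_∈_; _∉_)
  open import Data.List.Relation.Unary.All as All using (All; []; _∷_)
  open import Data.List.Relation.Unary.AllPairs using (AllPairs; []; _∷_)
  open import Data.List.Relation.Unary.Any using (here; there)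
  open import Data.List.Relation.Unary.Unique.Propositional using (Unique)
  open import Data.Nat.Base hiding (_/_; _⊔_)
  open import Data.Nat.Properties
  open import Data.Nat.Tactic.RingSolver using (solve-∀)
  open import Data.Vec.Functional using (Vector; updateAt)
  open import Data.Vec.Functional.Properties using (updateAt-updates; updateAt-minimal)
  open OrderedField F using (Carrier; 0#; _/_) renaming (_≤_ to _≤ᶠ_; _<_ to _<ᶠ_; _+_ to _+ᶠ_)
  private module Fᴾ = OrderedFieldProperties F
  open RealRAM F
  open Scheduling F hiding (Instance)
  open Scheduling.Instance I using (0<size; 0<speed) renaming (size to sizeOf; speed to speedOf)
  open TimedRuns F
  open Loops F
  open HeapTree using (Leaf; root≼)
  open Replaying m
  open Update
  open Sorting F using (Stored)
  open Placing F m 1≤m using (Placement)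
  open KineticTournament F m hiding (module Contest)
  private module C = KineticTournament.Contest
  open KineticRuns F m

  private variable
    q : Level
    Q : ℕ → State → Set q
    s : State
    r : ℕ

  record Input : Set c where
    field
      jobs machines : ℕ
      sizes speeds  : ℕ → Carrier
      order machine : ℕ → ℕ
      speed         : ℕ → Carrier

  input : View → Input
  input v = record
    { jobs = View.jobs v ; machines = View.machines v ; sizes = View.sizes v ; speeds = View.speeds v
    ; order = View.order v ; machine = View.machine v ; speed = View.speed v }

  inputOf : Rows → Input
  inputOf R = record
    { jobs = Rows.jobs R ; machines = Rows.machines R ; sizes = Rows.sizes R ; speeds = Rows.speeds R
    ; order = Rows.order R ; machine = Rows.machine R ; speed = Rows.speed R }

  record Ready (J : Input) : Set (c ⊔ ℓ) where
    field
      jobs≡     : Input.jobs J ≡ n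
      machines≡ : Input.machines J ≡ m
      sizes≡    : ∀ i → Input.sizes J (toℕ i) ≡ sizeOf i
      placement : Placement speedOf (Input.machine J) (Input.speed J)

  placed-leaves : ∀ v → Ready (input v) →
    (∀ {p} → Leaf m p → winner v p ≡ p) → (∀ {p} → Leaf m p → failure v p ≡ 0#) →
    LeavesSet (contest v)
  placed-leaves v R w≡ f≡ = record
    { 1≤N = 1≤m
    ; 0<speed = λ lp → let (j , _ , eq) = occupant lp in subst (0# <ᶠ_) (sym eq) (0<speed j)
    ; sorted = sorted ; winner≡ = w≡ ; failure≡0 = f≡ }
    where open Placement (Ready.placement R)

  record Resetting (J : Input) (i : ℕ) (s : State) : Set c where
    field
      input≡   : input (view s) ≡ J
      size≡    : size# (view s) ≡ m
      idx≡     : idx (view s) ≡ i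
      load≡    : ∀ {p} → m ≤ p → p < i → load (view s) p ≡ 0#
      winner≡  : ∀ {p} → m ≤ p → p < i → winner (view s) p ≡ p
      failure≡ : ∀ {p} → m ≤ p → p < i → failure (view s) p ≡ 0#

  run-reset : ∀ {J} → input (view s) ≡ J → Ready J →
    (∀ {s′} → input (view s′) ≡ J → (∀ {p} → Leaf m p → load (view s′) p ≡ 0#) →
       now (view s′) ≡ Input.sizes J (Input.order J 0) → size# (view s′) ≡ m →
       Settled (m + m) (contest (view s′)) → Q r s′) →
    Run P.resetTournament s (Time.reset m + r) Q
  run-reset {s = s} {r = r} {J = J} refl R k = more-time (≤-reflexive (time (m * 5) (m * 13) r))
    (run-seq (run-nat (run-seq (run-seq (run-nat
      (run-forUpTo (P.size# +ₙ P.size#) _ (m + m) 3 (Resetting J) Resetting.idx≡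
        (λ L → cong₂ _+_ (Resetting.size≡ L) (Resetting.size≡ L))
        body m refl start λ {s₁} L → run-seq (run-num (built s₁ L))))))))
    where
    time : ∀ a b r → suc (suc (a + suc (suc (suc (b + suc r))))) ≡ 2 + (a + (3 + (b + 1))) + r
    time = solve-∀
    start : Resetting J m ⟨ (nats s [ 10 , 0 ≔ nats s 1 0 ]) [ 12 , 0 ≔ nats s 1 0 ] , nums s ⟩
    start = record
      { input≡ = refl ; size≡ = Ready.machines≡ R ; idx≡ = Ready.machines≡ R
      ; load≡ = λ m≤p p<m → contradiction m≤p (<⇒≱ p<m)
      ; winner≡ = λ m≤p p<m → contradiction m≤p (<⇒≱ p<m)
      ; failure≡ = λ m≤p p<m → contradiction m≤p (<⇒≱ p<m) }
    body : ∀ {i s r q} {Q : ℕ → State → Set q} → Resetting J i s → i < m + m →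
      (∀ {s′} → Resetting J (suc i) ⟨ nats s′ [ 12 , 0 ≔ suc (idx (view s′)) ] , nums s′ ⟩ → Q r s′) →
      Run (num[ 10 , P.idx ]≔ zeroᴿ ⨾ nat[ 13 , P.idx ]≔ P.idx ⨾ num[ 12 , P.idx ]≔ zeroᴿ) s (3 + r) Q
    body {i} {s} L i< k = run-seq (run-num (run-seq (run-nat (run-num (k record
      { input≡ = input≡ ; size≡ = size≡ ; idx≡ = cong suc idx≡
      ; load≡ = grow load≡ (↦-at {f = load (view s)} _) (↦-off {f = load (view s)})
      ; winner≡ = grow winner≡ (↦-at {f = winner (view s)} _) (↦-off {f = winner (view s)})
      ; failure≡ = grow failure≡ (↦-at {f = failure (view s)} _) (↦-off {f = failure (view s)}) })))))
      where
      open Resetting L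
      grow : ∀ {a} {A : Set a} {f g h : ℕ → A} → (∀ {p} → m ≤ p → p < i → f p ≡ h p) →
        g (idx (view s)) ≡ h (idx (view s)) → (∀ {p} → idx (view s) ≢ p → g p ≡ f p) →
        ∀ {p} → m ≤ p → p < suc i → g p ≡ h p
      grow old at off {p} m≤p lt with idx (view s) ≟ p
      ... | yes refl = at
      ... | no ≢ = trans (off ≢) (old m≤p (≤∧≢⇒< (s≤s⁻¹ lt) λ eq → ≢ (trans idx≡ (sym eq))))
    built : ∀ s₁ → Resetting J (m + m) s₁ →
      Run (P.build P.replayKinetic)
        ⟨ nats s₁ , nums s₁ [ 13 , 0 ≔ sizes (view s₁) (order (view s₁) 0) ] ⟩ (suc (m * 13 + suc r)) _
    built s₁ L = run-buildKinetic size≡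
      (placed-leaves (record (view s₁) { now = sizes (view s₁) (order (view s₁) 0) }) (subst Ready (sym input≡) R) (λ (a , b) → winner≡ a b) (λ (a , b) → failure≡ a b))
      λ {s₂} rows≡ K → k (trans (cong inputOf rows≡) input≡)
        (λ {p} (a , b) → trans (cong (λ R → Rows.load R p) rows≡) (load≡ a b))
        (trans (cong Rows.now rows≡) (cong (λ J → Input.sizes J (Input.order J 0)) input≡))
        (trans (cong Rows.size# rows≡) size≡) K
      where open Resetting L

  module _ (L : ℕ) (2m≤2^L : m + m ≤ 2 ^ L) (J₀ : Input) (R₀ : Ready J₀) where

    private
      E = Time.event L

    open Placement (Ready.placement R₀)

    LoadsAre : (ℕ → Carrier) → Vector Carrier m → Set c
    LoadsAre load T = ∀ {p j} → Leaf m p → Input.machine J₀ p ≡ toℕ j → load p ≡ T j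

    -- The final `σ` is known only after the last job, so `greedy` is claimed for every `σ` that
    -- agrees with the memory. `kept` ensures that entries of earlier jobs are not overwritten.
    record Scheduled (is : List (Fin n)) (T : Vector Carrier m) (before : ℕ → ℕ) (s : State) : Set (c ⊔ ℓ) where
      field
        input≡   : input (view s) ≡ J₀
        size≡    : size# (view s) ≡ m
        loads    : Vector Carrier m
        loads≡   : LoadsAre (load (view s)) loads
        assigned : ∀ {i} → i ∈ is → Σ[ j ∈ Fin m ] schedule (view s) (toℕ i) ≡ toℕ j
        kept     : ∀ {i} → i ∉ is → schedule (view s) (toℕ i) ≡ before (toℕ i)
        greedy   : ∀ {σ} → (∀ {i} → i ∈ is → schedule (view s) (toℕ i) ≡ toℕ (σ i)) →
                   Greedy I σ is T loads

    LPTChoice : Fin n → Vector Carrier m → Fin m → Set ℓ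
    LPTChoice i T α = ∀ j → T α +ᶠ sizeOf i / speedOf α ≤ᶠ T j +ᶠ sizeOf i / speedOf j

    placeJob : Fin n → Vector Carrier m → Fin m → Vector Carrier m
    placeJob i T α = updateAt T α (_+ᶠ sizeOf i / speedOf α)

    -- Raising a load may raise the potential by one at each of at most `L` ancestors. The `L * E`
    -- in the credit is not spent here but passed on to pay for those events.
    run-assign : ∀ {B k i T} → input (view s) ≡ J₀ → size# (view s) ≡ m → idx (view s) ≡ k →
      order (view s) k ≡ toℕ i → sizeOf i ≤ᶠ now (view s) →
      LoadsAre (load (view s)) T → Settled B (contest (view s)) →
      (∀ {B′ s′} α → input (view s′) ≡ J₀ → size# (view s′) ≡ m → idx (view s′) ≡ k →
         now (view s′) ≡ sizeOf i → LPTChoice i T α → LoadsAre (load (view s′)) (placeJob i T α) →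
         schedule (view s′) ≡ schedule (view s) [ toℕ i ↦ toℕ α ] →
         Settled B′ (contest (view s′)) → Q (suc B′ * E + r) s′) →
      Run P.assign s (suc B * E + (L * E + (L * 13 + 6) + r)) Q
    run-assign {s = s} {r = r} {B} {k} {i} {T} refl size≡ refl order≡ size≤ loads≡ K q =
      more-time (≤-reflexive (time₁ (suc B * E) (L * E) (L * 13) r)) (run-seq (run-num (run-seq
        (run-advance 1≤m {L} 2m≤2^L B slowed (subst (0# <ᶠ_) (sym x≡) (0<size i)) λ {B′} {s₁} → choose {B′} {s₁}))))
      where
      x = sizes (view s) (order (view s) (idx (view s)))
      x≡ : x ≡ sizeOf i
      x≡ = trans (cong (sizes (view s)) order≡) (Ready.sizes≡ R₀ i)
      x≤ : x ≤ᶠ now (view s)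
      x≤ = Fᴾ.≤-trans (Fᴾ.≤-reflexive x≡) size≤
      slowed : Settled B (slowDown (contest (view s)) x)
      slowed = record
        { leaves = record { LeavesSet (Kinetic.leaves K) } ; side = Kinetic.side K
        ; nodes = slowDown-nodes x≤ (Kinetic.nodes K)
        ; takeovers = slowDown-takeovers {D = contest (view s)} x≤ {Everywhere} {Kinetic.side K} (Kinetic.takeovers K) ; bound = Kinetic.bound K }
      time₁ : ∀ e l a r → suc (e + suc (3 + (a + suc (l + r)))) ≡ e + (l + (a + 6) + r)
      time₁ = solve-∀
      time₂ : ∀ b e l a r → suc b * e + (3 + (a + suc (l * e + r))) ≡
                            suc (suc (suc (a + suc (suc (b + l) * e + r))))
      time₂ = solve-∀
      choose : ∀ {B′ s₁} → rows (view s₁) ≡ record (rows (view s)) { now = x } →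
        Settled B′ (contest (view s₁)) → ¬ now (view s₁) ≤ᶠ failure (view s₁) 1 →
        Run (nat[ 2 , P.order P.idx ]≔ P.machine (P.winner (lit 1)) ⨾
             num[ 10 , P.winner (lit 1) ]≔ P.finish (P.winner (lit 1)) ⨾
             nat[ 11 , lit 0 ]≔ P.winner (lit 1) ⨾
             P.ascend P.replayKinetic) s₁ (suc B′ * E + (3 + (L * 13 + suc (L * E + r)))) _
      choose {B′} {s₁} rows≡ K₁ x≰f with occupant (Trusted.leaf root)
        where
        root : Trusted (contest (view s₁)) 1
        root = trusted-node (Kinetic.leaves K₁) (Kinetic.nodes K₁) ≤-refl (+-mono-≤ 1≤m 1≤m) (λ _ → tt)
      ... | α , machine-p , speed-p = more-time (≤-reflexive (sym (time₂ B′ E L (L * 13) r)))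
        (run-seq (run-nat (run-seq (run-num (run-seq (run-nat
          (run-updateAscend L (<-≤-trans (proj₂ leaf-p) 2m≤2^L) (proj₂ leaf-p)
            raised λ {s₂} rows≡₂ K₂ → q {_} {s₂} α
              (trans (cong inputOf rows≡₂) input₁)
              (trans (cong Rows.size# rows≡₂) (trans (cong Rows.size# rows≡) size≡))
              (trans (cong Rows.idx rows≡₂) (cong Rows.idx rows≡))
              (trans (cong Rows.now rows≡₂) now₁)
              best
              (λ lq mq → trans (cong (λ R → Rows.load R _) rows≡₂) (placed lq mq))
              (trans (cong Rows.schedule rows≡₂) schedule≡)
              K₂)))))))
        where
        v₁ = view s₁
        p = winner v₁ 1
        root : Trusted (contest v₁) 1
        root = trusted-node (Kinetic.leaves K₁) (Kinetic.nodes K₁) ≤-refl (+-mono-≤ 1≤m 1≤m) (λ _ → tt)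
        leaf-p = Trusted.leaf root
        load₂ = load v₁ [ p ↦ load v₁ p +ᶠ now v₁ / speed v₁ p ]
        schedule₂ = schedule v₁ [ order v₁ (idx v₁) ↦ machine v₁ p ]
        input₁ : input v₁ ≡ J₀
        input₁ = cong inputOf rows≡
        now₁ : now v₁ ≡ sizeOf i
        now₁ = trans (cong Rows.now rows≡) x≡
        load₁ : ∀ {a j} → Leaf m a → Input.machine J₀ a ≡ toℕ j → load v₁ a ≡ T j
        load₁ la ma = trans (cong (λ R → Rows.load R _) rows≡) (loads≡ la ma)
        speed₁ : ∀ {a j} → Leaf m a → Input.machine J₀ a ≡ toℕ j → speed v₁ a ≡ speedOf j
        speed₁ la ma with occupant la
        ... | j′ , ma′ , sp = trans (cong (λ J → Input.speed J _) input₁)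
                (trans sp (cong speedOf (toℕ-injective (trans (sym ma′) ma))))
        val≡ : ∀ {a j} → Leaf m a → Input.machine J₀ a ≡ toℕ j →
               C.val (contest v₁) (now v₁) a ≡ T j +ᶠ sizeOf i / speedOf j
        val≡ la ma = cong₂ _+ᶠ_ (load₁ la ma) (cong₂ _/_ now₁ (speed₁ la ma))
        best : LPTChoice i T α
        -- `advance` has stopped with the failure size of the root below `now`, so the winner of the
        -- root is trusted at this very job size.
        best j with surjective j
        ... | a , la , ma = subst₂ _≤ᶠ_ (val≡ leaf-p machine-p) (val≡ la ma)
          (Trusted.best root (Fᴾ.≰⇒> x≰f) Fᴾ.≤-refl la (root≼ (≤-trans 1≤m (proj₁ la))))
        placed : LoadsAre load₂ (placeJob i T α)
        placed {a} {j} la ma with p ≟ a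
        ... | yes refl with toℕ-injective (trans (sym machine-p) ma)
        ...   | refl = trans (↦-at {f = load v₁} p) (trans (val≡ la ma) (sym (updateAt-updates α T)))
        placed {a} {j} la ma | no p≢a = trans (↦-off {f = load v₁} p≢a) (trans (load₁ la ma)
          (sym (updateAt-minimal j α T λ { refl → p≢a (injective leaf-p la (trans machine-p (sym ma))) })))
        schedule≡ : schedule₂ ≡ schedule (view s) [ toℕ i ↦ toℕ α ]
        schedule≡ = trans
          (cong₂ (λ a b → schedule v₁ [ a ↦ b ])
            (trans (cong₂ (λ J k → Input.order J k) input₁ (cong Rows.idx rows≡)) order≡)
            (trans (cong (λ J → Input.machine J p) input₁) machine-p))
          (cong (λ f → f [ toℕ i ↦ toℕ α ]) (cong Rows.schedule rows≡))
        raised : Kinetic (Beside p) (Beside p) L (B′ + L) (setLoad (contest v₁) p (load v₁ p +ᶠ now v₁ / speed v₁ p))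
        raised = record
          { leaves = setLoad-leaves leaves (proj₁ leaf-p)
          ; side = side
          ; nodes = setLoad-nodes leaves (proj₁ leaf-p) nodes
          ; takeovers = setLoad-takeovers leaves (proj₁ leaf-p) takeovers
          ; bound = +-monoˡ-≤ L (≤-trans (≤-reflexive (sym (+-identityʳ _))) bound) }
          where open Kinetic K₁

    Descending : List (Fin n) → Set ℓ
    Descending = AllPairs (λ i i′ → sizeOf i′ ≤ᶠ sizeOf i)

    -- That the remaining sizes are at most `now` is where the order of the jobs enters: the
    -- tournament can move to smaller sizes only.
    run-jobs : ∀ is {B k T} → input (view s) ≡ J₀ → size# (view s) ≡ m → idx (view s) ≡ k →
      k + length is ≡ n → Stored is k (Input.order J₀) → Descending is → Unique is →
      All (λ i → sizeOf i ≤ᶠ now (view s)) is →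
      LoadsAre (load (view s)) T → Settled B (contest (view s)) →
      (∀ {s′} → Scheduled is T (schedule (view s)) s′ → Q r s′) →
      Run (P.forUpTo nat[ 0 , lit 0 ] P.assign) s (suc B * E + (length is * Time.job L + suc r)) Q
    run-jobs {s = s} {r = r} [] {B} input≡ size≡ idx≡ k≡ _ _ _ _ loads≡ _ q =
      more-time (m≤n+m (suc r) (suc B * E)) (run-exit
        (trans (cong₂ (λ a b → suc a ≤ᵇ b) (trans idx≡ (trans (sym (+-identityʳ _)) k≡)) jobs≡n)
          (≰⇒test {suc n} {n} (<⇒≱ ≤-refl)))
        (q (record { input≡ = input≡ ; size≡ = size≡ ; loads = _ ; loads≡ = loads≡
                   ; assigned = λ () ; kept = λ _ → refl ; greedy = λ _ → [] })))
      where
      jobs≡n : jobs (view s) ≡ n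
      jobs≡n = trans (cong Input.jobs input≡) (Ready.jobs≡ R₀)
    run-jobs {s = s} {r = r} (i ∷ is) {B} {k} {T} input≡ size≡ idx≡ k≡ (order≡ , stored) (below ∷ desc) (i∉ ∷ distinct) (i≤ ∷ _) loads≡ K q =
      more-time (≤-reflexive (time (suc B * E) (L * E) (L * 13) (length is * Time.job L) r)) (run-again
        (trans (cong₂ (λ a b → suc a ≤ᵇ b) idx≡ jobs≡n)
          (≤⇒test (subst (suc k ≤_) k≡ (≤-trans (s≤s (m≤m+n k (length is))) (≤-reflexive (sym (+-suc k (length is))))))))
        (run-seq (run-assign input≡ size≡ idx≡ (trans (cong (λ J → Input.order J k) input≡) order≡) i≤ loads≡ K
          λ {B′} {s₁} α input₁ size₁ idx₁ now₁ best loads₁ schedule₁ K₁ →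
            more-time (≤-reflexive (sym (+-suc (suc B′ * E) (length is * Time.job L + suc r)))) (run-nat (run-jobs is input₁ size₁ (cong suc idx₁)
              (trans (sym (+-suc k (length is))) k≡) stored desc distinct
              (All.map (λ le → Fᴾ.≤-trans le (Fᴾ.≤-reflexive (sym now₁))) below)
              loads₁ K₁ λ {s₂} Sc → q (extend s₁ s₂ α best schedule₁ Sc))))))
      where
      jobs≡n : jobs (view s) ≡ n
      jobs≡n = trans (cong Input.jobs input≡) (Ready.jobs≡ R₀)
      time : ∀ e l a x r → suc (e + (l + (a + 6) + suc (x + suc r))) ≡ e + (l + (a + 8) + x + suc r)
      time = solve-∀
      extend : ∀ s₁ s₂ α → LPTChoice i T α → schedule (view s₁) ≡ schedule (view s) [ toℕ i ↦ toℕ α ] →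
        Scheduled is (placeJob i T α) (schedule (view s₁)) s₂ → Scheduled (i ∷ is) T (schedule (view s)) s₂
      extend s₁ s₂ α best schedule₁ Sc = record
        { input≡ = Scheduled.input≡ Sc ; size≡ = Scheduled.size≡ Sc ; loads = Scheduled.loads Sc ; loads≡ = Scheduled.loads≡ Sc
        ; assigned = assigned′ ; kept = kept′ ; greedy = greedy′ }
        where
        at-i : schedule (view s₂) (toℕ i) ≡ toℕ α
        -- The list has no repetitions, so no later job writes to the entry of `i`.
        at-i = trans (Scheduled.kept Sc λ i∈ → All.lookup i∉ i∈ refl)
          (trans (cong (λ f → f (toℕ i)) schedule₁) (↦-at {f = schedule (view s)} (toℕ i)))
        assigned′ : ∀ {i′} → i′ ∈ i ∷ is → Σ[ j ∈ Fin m ] schedule (view s₂) (toℕ i′) ≡ toℕ j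
        assigned′ (here refl) = α , at-i
        assigned′ (there i∈) = Scheduled.assigned Sc i∈
        kept′ : ∀ {i′} → i′ ∉ i ∷ is → schedule (view s₂) (toℕ i′) ≡ schedule (view s) (toℕ i′)
        kept′ {i′} i′∉ = trans (Scheduled.kept Sc (i′∉ ∘ there))
          (trans (cong (λ f → f (toℕ i′)) schedule₁)
                 (↦-off {f = schedule (view s)} λ eq → i′∉ (here (sym (toℕ-injective eq)))))
        greedy′ : ∀ {σ} → (∀ {i′} → i′ ∈ i ∷ is → schedule (view s₂) (toℕ i′) ≡ toℕ (σ i′)) →
                  Greedy I σ (i ∷ is) T (Scheduled.loads Sc)
        greedy′ {σ} agrees with toℕ-injective (trans (sym at-i) (agrees (here refl)))
        ... | refl = best ∷ Scheduled.greedy Sc (agrees ∘ there)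

  record Maximum (load : ℕ → Carrier) (i : ℕ) (x : Carrier) : Set (c ⊔ ℓ) where
    field
      upper    : ∀ {p} → m ≤ p → p < i → load p ≤ᶠ x
      attained : ∃[ p ] Leaf m p × x ≡ load p

  record Maximizing (v₀ : View) (i : ℕ) (s : State) : Set (c ⊔ ℓ) where
    field
      size≡     : size# (view s) ≡ m
      idx≡      : idx (view s) ≡ i
      m≤i       : m ≤ i
      load≡     : load (view s) ≡ load v₀
      schedule≡ : schedule (view s) ≡ schedule v₀
      maximum   : Maximum (load (view s)) i (makespan (view s))

  run-makespan : size# (view s) ≡ m →
    (∀ {s′} → load (view s′) ≡ load (view s) → schedule (view s′) ≡ schedule (view s) →
       Maximum (load (view s′)) (m + m) (makespan (view s′)) → Q r s′) →
    Run P.computeMakespan s (Time.makespan m + r) Q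
  run-makespan {s = s} {r = r} size≡ k = more-time (≤-reflexive (time (m * 4) r))
    (run-seq (run-num (run-seq (run-nat (run-forUpTo (P.size# +ₙ P.size#) _ (m + m) 2 (Maximizing (view s))
      Maximizing.idx≡ (λ M → cong₂ _+_ (Maximizing.size≡ M) (Maximizing.size≡ M)) body m refl
      (record { size≡ = size≡ ; idx≡ = size≡ ; m≤i = ≤-refl ; load≡ = refl ; schedule≡ = refl ; maximum = record
        { upper = λ m≤p p<m → contradiction m≤p (<⇒≱ p<m)
        ; attained = size# (view s) , subst (Leaf m) (sym size≡) (≤-refl , +-mono-≤ 1≤m ≤-refl) , refl } })
      λ M → k (Maximizing.load≡ M) (Maximizing.schedule≡ M) (Maximizing.maximum M)))))) 
    where
    time : ∀ a r → suc (suc (a + suc r)) ≡ 2 + (a + 1) + r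
    time = solve-∀
    body : ∀ {i s₁ r q} {Q : ℕ → State → Set q} → Maximizing (view s) i s₁ → i < m + m →
      (∀ {s′} → Maximizing (view s) (suc i) ⟨ nats s′ [ 12 , 0 ≔ suc (idx (view s′)) ] , nums s′ ⟩ → Q r s′) →
      Run (when num[ 2 , lit 0 ] ≤ᴿ P.load P.idx then num[ 2 , lit 0 ]≔ P.load P.idx else skip) s₁ (2 + r) Q
    body {i} {s₁} M i< k = run-whenᴿ
      (λ x≤ → run-num (k record { Maximizing M ; idx≡ = cong suc idx≡ ; m≤i = m≤n⇒m≤1+n m≤i ; maximum = record
        { upper = grow (λ m≤p p<i → Fᴾ.≤-trans (upper m≤p p<i) x≤) Fᴾ.≤-refl
        ; attained = idx (view s₁) , subst (Leaf m) (sym idx≡) (m≤i , i<) , refl } }))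
      (λ x≰ → run-skip (k record { Maximizing M ; idx≡ = cong suc idx≡ ; m≤i = m≤n⇒m≤1+n m≤i ; maximum = record
        { upper = grow upper (Fᴾ.≰⇒≥ x≰) ; attained = attained } }))
      where
      open Maximizing M
      open Maximum maximum
      grow : ∀ {x} → (∀ {p} → m ≤ p → p < i → load (view s₁) p ≤ᶠ x) → load (view s₁) (idx (view s₁)) ≤ᶠ x →
             ∀ {p} → m ≤ p → p < suc i → load (view s₁) p ≤ᶠ x
      grow old new {p} m≤p lt with idx (view s₁) ≟ p
      ... | yes refl = new
      ... | no ≢ = old m≤p (≤∧≢⇒< (s≤s⁻¹ lt) λ eq → ≢ (trans idx≡ (sym eq)))

-- The phases of the program put together.

module LPTCorrectness {c ℓ} (F : OrderedField c ℓ) {n m : ℕ} (1≤n : 1 ℕ.≤ n) (1≤m : 1 ℕ.≤ m)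
                      (I : Scheduling.Instance F n m) where
  open import Data.Fin.Base using (toℕ)
  open import Data.List.Base using ([]; _∷_; length; allFin)
  open import Data.List.Properties using (length-tabulate)
  open import Data.List.Membership.Propositional using (_∈_)
  open import Data.List.Membership.Propositional.Properties using (∈-allFin)
  open import Data.List.Relation.Binary.Permutation.Propositional using (_↭_; ↭-sym)
  open import Data.List.Relation.Binary.Permutation.Propositional.Properties using (↭-length; ∈-resp-↭)
  open import Data.List.Relation.Unary.All as All using (All; []; _∷_)
  open import Data.List.Relation.Unary.AllPairs using ([]; _∷_)
  open import Data.List.Relation.Unary.Linked.Properties using (AllPairs⇒Linked)
  open import Data.List.Relation.Unary.Unique.Propositional.Properties using (allFin⁺)
  open import Data.Nat.Base hiding (_/_; _⊔_)
  open import Data.Nat.Properties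
  open import Data.Vec.Functional using (replicate)
  open OrderedField F using (0#) renaming (_≤_ to _≤ᶠ_)
  private module Fᴾ = OrderedFieldProperties F
  open RealRAM F
  open Scheduling F hiding (Instance)
  open Scheduling.Instance I using (0<size; 0<speed) renaming (size to sizeOf; speed to speedOf)
  open TimedRuns F
  open Loops F
  open Sorting F
  open Placing F m 1≤m using (Base; base; Placed; Placement; placement; run-place)
  open KineticRuns F m using (Settled; contest)
  open LPTRuns F 1≤m I

  module SortMachines (s : State) (inp : InputIn I s) =
    SortRun 1 (frame (view s)) m 1≤m speedOf 0<speed
      (λ _ eq → trans (cong Frame.machines eq) (InputIn.m-cell inp))
      (λ _ eq j → trans (cong (λ f → Frame.speeds f (toℕ j)) eq) (InputIn.speeds inp j))

  module SortJobs (f₀ : Frame) (jobs≡ : Frame.jobs f₀ ≡ n) (sizes≡ : ∀ i → Frame.sizes f₀ (toℕ i) ≡ sizeOf i) =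
    SortRun 0 f₀ n 1≤n sizeOf 0<size
      (λ _ eq → trans (cong Frame.jobs eq) jobs≡)
      (λ _ eq i → trans (cong (λ f → Frame.sizes f (toℕ i)) eq) (sizes≡ i))

  output : ∀ {J₀ : Input} (R₀ : Ready J₀) L (2m≤2^L : m + m ≤ 2 ^ L) {xs before s₁ s₂} →
    xs ↭ allFin n → Descending L 2m≤2^L J₀ R₀ xs →
    Scheduled L 2m≤2^L J₀ R₀ xs (replicate m 0#) before s₁ →
    load (view s₂) ≡ load (view s₁) → schedule (view s₂) ≡ schedule (view s₁) →
    Maximum (load (view s₂)) (m + m) (makespan (view s₂)) →
    OutputIn I s₂
  output R₀ L 2m≤2^L {xs} {s₁ = s₁} {s₂} perm descending Sc load≡ schedule≡ M = record
    { σ = λ i → proj₁ (assigned (∈xs i))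
    ; schedule = λ i → trans (cong (λ f → f (toℕ i)) schedule≡) (proj₂ (assigned (∈xs i)))
    ; lpt = record
      { order = xs ; allJobs = perm ; nonIncreasing = AllPairs⇒Linked descending
      ; loads = loads
      ; greedy = greedy λ {i} i∈ → proj₂ (assigned (∈xs i))
      ; upperBound = upperBound ; attained = attained } }
    where
    open Scheduled Sc
    open Placement (Ready.placement R₀)
    ∈xs : ∀ i → i ∈ xs
    ∈xs i = ∈-resp-↭ (↭-sym perm) (∈-allFin i)
    upperBound : ∀ j → loads j ≤ᶠ makespan (view s₂)
    upperBound j with surjective j
    ... | p , lp , mp = subst (_≤ᶠ _) (trans (cong (λ f → f p) load≡) (loads≡ lp mp))
                          (Maximum.upper M (proj₁ lp) (proj₂ lp))
    attained : ∃[ j ] makespan (view s₂) ≡ loads j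
    attained with Maximum.attained M
    ... | p , lp , eq with occupant lp
    ...   | j , mp , _ = j , trans eq (trans (cong (λ f → f p) load≡) (loads≡ lp mp))

  module _ (Lₙ Lₘ : ℕ) (2n≤2^L : n + n ≤ 2 ^ Lₙ) (2m≤2^L : m + m ≤ 2 ^ Lₘ) where

    run-lpt : ∀ {s} → InputIn I s → Run P.lpt s (Time.lpt n m Lₙ Lₘ) (λ _ s′ → OutputIn I s′)
    run-lpt {s} inp = run-seq (SortMachines.run-sort s inp {Lₘ} 2m≤2^L refl
      λ {s₁} frame₁ size₁ sorted₁ → run-seq (run-place size₁
      λ {s₂} base₂ placed₂ → from-placement s₁ s₂ frame₁ sorted₁ base₂ placed₂))
      where
      from-placement : ∀ s₁ s₂ → frame (view s₁) ≡ frame (view s) → SortMachines.IsSorted s inp (order (view s₁)) →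
        base (view s₂) ≡ base (view s₁) → Placed (view s₂) →
        Run (P.sortDescending 0 ⨾ P.resetTournament ⨾ nat[ 12 , lit 0 ]≔ lit 0 ⨾
             P.forUpTo nat[ 0 , lit 0 ] P.assign ⨾ P.computeMakespan) s₂
            (Time.sort n Lₙ + (Time.reset m +
              suc (suc (m + m) * Time.event Lₘ + (n * Time.job Lₘ + suc (Time.makespan m)))))
            (λ _ s′ → OutputIn I s′)
      from-placement s₁ s₂ frame₁ (ys , ys↭ , ys-descending , ys-stored) base₂ placed₂ =
        run-seq (SortJobs.run-sort (frame (view s₂)) jobs₂ sizes₂ {Lₙ} 2n≤2^L refl
        λ {s₃} frame₃ _ sorted₃ → run-seq (run-reset refl (ready s₃ frame₃)
        λ {s₄} input₄ load₄ now₄ size₄ K₄ → schedule-jobs s₃ s₄ (ready s₃ frame₃) sorted₃ input₄ load₄ now₄ size₄ K₄))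
        where
        jobs₂ : jobs (view s₂) ≡ n
        jobs₂ = trans (cong Base.jobs base₂) (trans (cong Frame.jobs frame₁) (InputIn.n-cell inp))
        sizes₂ : ∀ i → sizes (view s₂) (toℕ i) ≡ sizeOf i
        sizes₂ i = trans (cong (λ b → Base.sizes b (toℕ i)) base₂)
          (trans (cong (λ f → Frame.sizes f (toℕ i)) frame₁) (InputIn.sizes inp i))
        speeds₂ : ∀ j → speeds (view s₂) (toℕ j) ≡ speedOf j
        speeds₂ j = trans (cong (λ b → Base.speeds b (toℕ j)) base₂)
          (trans (cong (λ f → Frame.speeds f (toℕ j)) frame₁) (InputIn.speeds inp j))
        placement₂ : Placement speedOf (machine (view s₂)) (speed (view s₂))
        placement₂ = placement speedOf {speeds (view s₂)} speeds₂ ys↭ ys-descending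
          (subst (λ b → Stored ys 0 (Base.order b)) (sym base₂) ys-stored)
          {h = Placed.h placed₂} (Placed.M≡ placed₂) (Placed.m≤M placed₂) (Placed.M<2m placed₂)
          (Placed.machine≡ placed₂) (Placed.speed≡ placed₂)
        ready : ∀ s₃ → frame (view s₃) ≡ frame (view s₂) → Ready (input (view s₃))
        ready s₃ frame₃ = record
          { jobs≡ = trans (cong Frame.jobs frame₃) jobs₂
          ; machines≡ = trans (cong Frame.machines frame₃) (trans (cong Base.machines base₂)
              (trans (cong Frame.machines frame₁) (InputIn.m-cell inp)))
          ; sizes≡ = λ i → trans (cong (λ f → Frame.sizes f (toℕ i)) frame₃) (sizes₂ i)
          ; placement = subst (λ f → Placement speedOf (Frame.machine f) (Frame.speed f)) (sym frame₃) placement₂ }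
        schedule-jobs : ∀ s₃ s₄ (R : Ready (input (view s₃))) →
          SortJobs.IsSorted (frame (view s₂)) jobs₂ sizes₂ (order (view s₃)) →
          input (view s₄) ≡ input (view s₃) → (∀ {p} → HeapTree.Leaf m p → load (view s₄) p ≡ 0#) →
          now (view s₄) ≡ sizes (view s₃) (order (view s₃) 0) → size# (view s₄) ≡ m →
          Settled (m + m) (contest (view s₄)) →
          Run (nat[ 12 , lit 0 ]≔ lit 0 ⨾ P.forUpTo nat[ 0 , lit 0 ] P.assign ⨾ P.computeMakespan) s₄
            (suc (suc (m + m) * Time.event Lₘ + (n * Time.job Lₘ + suc (Time.makespan m))))
            (λ _ s′ → OutputIn I s′)
        schedule-jobs s₃ s₄ R (xs , xs↭ , xs-descending , xs-stored) input₄ load₄ now₄ size₄ K₄ =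
          run-seq (run-nat (run-seq (more-time
            (≤-reflexive (cong (λ k → suc (m + m) * Time.event Lₘ + (k * Time.job Lₘ + suc (Time.makespan m))) length≡))
            (run-jobs Lₘ 2m≤2^L (input (view s₃)) R xs {T = replicate m 0#} input₄ size₄ refl length≡ xs-stored xs-descending
              (Unique-resp-↭ (↭-sym xs↭) (allFin⁺ n)) (first xs xs-stored xs-descending) (λ lp _ → load₄ lp) K₄
              λ {s₅} Sc → more-time (≤-reflexive (+-identityʳ (Time.makespan m))) (run-makespan (Scheduled.size≡ Sc)
              λ {s₆} load₆ schedule₆ M → output R Lₘ 2m≤2^L xs↭ xs-descending Sc load₆ schedule₆ M)))))
          where
          length≡ : length xs ≡ n
          length≡ = trans (↭-length xs↭) (length-tabulate id)
          -- The reset has set `now` to the size of the head of the sorted list, which bounds all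
          -- the others.
          first : ∀ xs → Stored xs 0 (order (view s₃)) → Descending Lₘ 2m≤2^L (input (view s₃)) R xs →
                  All (λ i → sizeOf i ≤ᶠ now (view s₄)) xs
          first [] _ _ = []
          first (x ∷ xs) (eq , _) (below ∷ _) = Fᴾ.≤-reflexive now≡ ∷ All.map (λ le → Fᴾ.≤-trans le (Fᴾ.≤-reflexive now≡)) below
            where
            now≡ : sizeOf x ≡ now (view s₄)
            now≡ = sym (trans now₄ (trans (cong (sizes (view s₃)) eq) (Ready.sizes≡ R x)))

-- The asymptotic running time.

module Asymptotics where
  open import Data.Nat.Base
  open import Data.Nat.Properties
  open import Data.Nat.Logarithm
  open import Data.Nat.Tactic.RingSolver using (solve-∀)

  -- Node numbers run up to twice the number of leaves, which takes one unit; the other makes up for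
  -- the rounding of the logarithm.
  height : ℕ → ℕ
  height n = 2 + ⌊log₂ n ⌋

  n+n≤2^height : ∀ n → n + n ≤ 2 ^ height n
  n+n≤2^height n = ≤-trans (+-mono-≤ n≤ n≤) (≤-reflexive (sym (HeapTree.2^suc (suc ⌊log₂ n ⌋))))
    where
    n≤ : n ≤ 2 ^ suc ⌊log₂ n ⌋
    n≤ with ≤-total n (2 ^ suc ⌊log₂ n ⌋)
    ... | inj₁ le = le
    ... | inj₂ ge = contradiction
      (subst (_≤ ⌊log₂ n ⌋) (⌊log₂[2^n]⌋≡n (suc ⌊log₂ n ⌋)) (⌊log₂⌋-mono-≤ ge)) (<-irrefl refl)

  lpt-time : ℕ → ℕ → ℕ
  lpt-time n m = Time.lpt n m (height n) (height m)

  module _ (n m a b : ℕ) (1≤Z : 1 ≤ a ^ 2 + b) (1≤S : 1 ≤ n + m) where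

    private
      Z = a ^ 2 + b
      X = (n + m) * Z
      A = 2 + a
      B = 2 + b

      a≤a² : ∀ a → a ≤ a ^ 2
      a≤a² zero    = z≤n
      a≤a² (suc a) = ≤-trans (≤-reflexive (sym (*-identityʳ (suc a))))
        (*-monoʳ-≤ (suc a) (s≤s z≤n))

      a≤Z : a ≤ Z
      a≤Z = ≤-trans (a≤a² a) (m≤m+n (a ^ 2) b)

      square : ∀ a → (2 + a) * (2 + a) ≡ 4 * 1 + (4 * a + a * (a * 1))
      square = solve-∀

      A≤ : A ≤ 3 * Z
      A≤ = ≤-trans (+-mono-≤ (+-mono-≤ 1≤Z 1≤Z) a≤Z) (≤-reflexive (three Z))
        where
        three : ∀ z → z + z + z ≡ 3 * z
        three = solve-∀

      B≤ : B ≤ 3 * Z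
      B≤ = ≤-trans (+-mono-≤ (+-mono-≤ 1≤Z 1≤Z) (m≤n+m b (a ^ 2))) (≤-reflexive (three Z))
        where
        three : ∀ z → z + z + z ≡ 3 * z
        three = solve-∀

      A²≤ : A * A ≤ 9 * Z
      A²≤ = ≤-trans (≤-reflexive (square a)) (≤-trans
        (+-mono-≤ (*-monoʳ-≤ 4 1≤Z) (+-mono-≤ (*-monoʳ-≤ 4 a≤Z) (m≤m+n (a ^ 2) b)))
        (≤-reflexive (nine Z)))
        where
        nine : ∀ z → 4 * z + (4 * z + z) ≡ 9 * z
        nine = solve-∀

      scale : ∀ {k x} c → k ≤ n + m → x ≤ c * Z → k * x ≤ c * X
      scale {k} {x} c k≤ x≤ = ≤-trans (*-mono-≤ k≤ x≤) (≤-reflexive (swap (n + m) c Z))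
        where
        swap : ∀ s c z → s * (c * z) ≡ c * (s * z)
        swap = solve-∀

      n≤ : n ≤ n + m
      n≤ = m≤m+n n m
      m≤ : m ≤ n + m
      m≤ = m≤n+m m n
      1≤1Z : 1 ≤ 1 * Z
      1≤1Z = ≤-trans 1≤Z (≤-reflexive (sym (*-identityˡ Z)))

      sort≤ : ∀ {k L} → k ≤ n + m → L ≤ 3 * Z → Time.sort k L ≤ 33 * X
      sort≤ {k} {L} k≤ L≤ = ≤-trans (≤-reflexive (expand k L)) (≤-trans
        (+-mono-≤ (*-monoʳ-≤ 7 (scale 1 1≤S 1≤1Z))
        (+-mono-≤ (*-monoʳ-≤ 14 (scale 1 k≤ 1≤1Z))
                  (*-monoʳ-≤ 4 (scale 3 k≤ L≤))))
        (≤-reflexive (collect X)))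
        where
        expand : ∀ k L → 2 + (k * 4 + (2 + (k * 4 + (2 + (k * (2 + (3 + (L * 4 + 1))) + 1))))) ≡
                         7 * (1 * 1) + (14 * (k * 1) + 4 * (k * L))
        expand = solve-∀
        collect : ∀ x → 7 * (1 * x) + (14 * (1 * x) + 4 * (3 * x)) ≡ 33 * x
        collect = solve-∀

      linear≤ : ∀ a b → a * (1 * 1) + b * (m * 1) ≤ (a + b) * X
      linear≤ a b = ≤-trans (+-mono-≤ (*-monoʳ-≤ a (scale 1 1≤S 1≤1Z)) (*-monoʳ-≤ b (scale 1 m≤ 1≤1Z)))
        (≤-reflexive (collect a b X))
        where
        collect : ∀ a b x → a * (1 * x) + b * (1 * x) ≡ (a + b) * x
        collect = solve-∀

      place≤ : Time.place m ≤ 12 * X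
      place≤ = ≤-trans (≤-reflexive (expand m)) (linear≤ 4 8)
        where
        expand : ∀ m → 1 + (m * 2 + (2 + (m * 6 + 1))) ≡ 4 * (1 * 1) + 8 * (m * 1)
        expand = solve-∀

      reset≤ : Time.reset m ≤ 24 * X
      reset≤ = ≤-trans (≤-reflexive (expand m)) (linear≤ 6 18)
        where
        expand : ∀ m → 2 + (m * 5 + (3 + (m * 13 + 1))) ≡ 6 * (1 * 1) + 18 * (m * 1)
        expand = solve-∀

      makespan≤ : suc (Time.makespan m) ≤ 8 * X
      makespan≤ = ≤-trans (≤-reflexive (expand m)) (linear≤ 4 4)
        where
        expand : ∀ m → 1 + (2 + (m * 4 + 1)) ≡ 4 * (1 * 1) + 4 * (m * 1)
        expand = solve-∀

      event≤ : Time.event A ≤ 63 * Z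
      event≤ = ≤-trans (≤-reflexive (expand A))
        (≤-trans (+-mono-≤ (*-monoʳ-≤ 15 1≤Z) (*-monoʳ-≤ 16 A≤)) (≤-reflexive (collect Z)))
        where
        expand : ∀ L → 1 + (1 + (L * 3 + 1) + (11 + (L * 13 + 1))) ≡ 15 * 1 + 16 * L
        expand = solve-∀
        collect : ∀ z → 15 * z + 16 * (3 * z) ≡ 63 * z
        collect = solve-∀

      job≤ : Time.job A ≤ 236 * Z
      job≤ = ≤-trans (≤-reflexive (expand A))
        (≤-trans (+-mono-≤ (*-monoʳ-≤ 8 1≤Z) (+-mono-≤ (*-monoʳ-≤ 28 A≤) (*-monoʳ-≤ 16 A²≤)))
          (≤-reflexive (collect Z)))
        where
        expand : ∀ L → L * (1 + (1 + (L * 3 + 1) + (11 + (L * 13 + 1)))) + (L * 13 + 8) ≡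
                       8 * 1 + (28 * L + 16 * (L * L))
        expand = solve-∀
        collect : ∀ z → 8 * z + (28 * (3 * z) + 16 * (9 * z)) ≡ 236 * z
        collect = solve-∀

      events≤ : suc (m + m) * Time.event A ≤ 189 * X
      events≤ = ≤-trans (*-mono-≤ (+-mono-≤ 1≤S (+-mono-≤ m≤ m≤)) event≤) (≤-reflexive (collect (n + m) Z))
        where
        collect : ∀ s z → (s + (s + s)) * (63 * z) ≡ 189 * (s * z)
        collect = solve-∀

    -- Each summand is at most a constant times `X`: `1 ≤ Z` absorbs additive constants and
    -- `a ≤ a ^ 2` single logarithms of `m`. The square comes from `job`, the logarithm of `n` from
    -- sorting the jobs. 536 is the sum of the eight coefficients.
    lpt-time-bound : Time.lpt n m B A ≤ 536 * X
    lpt-time-bound = ≤-trans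
      (+-mono-≤ (sort≤ m≤ A≤) (+-mono-≤ place≤ (+-mono-≤ (sort≤ n≤ B≤) (+-mono-≤ reset≤
        (+-mono-≤ (*-mono-≤ 1≤S 1≤Z) (+-mono-≤ events≤ (+-mono-≤ (scale 236 n≤ job≤) makespan≤)))))))
      (≤-reflexive (collect X))
      where
      collect : ∀ x → 33 * x + (12 * x + (33 * x + (24 * x + (x + (189 * x + (236 * x + 8 * x)))))) ≡ 536 * x
      collect = solve-∀

  -- With at least three jobs and machines in all there are two of one kind, whose logarithm is
  -- positive. At `n = m = 1` both logarithms vanish, hence the threshold 3.
  1≤logs : ∀ n m → 3 ≤ n + m → 1 ≤ ⌊log₂ m ⌋ ^ 2 + ⌊log₂ n ⌋
  1≤logs n m 3≤ with 2 ≤? n | 2 ≤? m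
  ... | yes 2≤n | _ = ≤-trans (⌊log₂⌋-mono-≤ 2≤n) (m≤n+m ⌊log₂ n ⌋ _)
  ... | no _ | yes 2≤m = ≤-trans (^-monoˡ-≤ 2 (⌊log₂⌋-mono-≤ 2≤m)) (m≤m+n _ ⌊log₂ n ⌋)
  ... | no n≱2 | no m≱2 = contradiction 3≤ (<⇒≱ (s≤s (+-mono-≤ (s≤s⁻¹ (≰⇒> n≱2)) (s≤s⁻¹ (≰⇒> m≱2)))))

  lpt-time-∈O : lpt-time ∈O (λ n m → (n + m) * (⌊log₂ m ⌋ ^ 2 + ⌊log₂ n ⌋))
  lpt-time-∈O = 536 , 3 , λ n m 3≤ →
    lpt-time-bound n m ⌊log₂ m ⌋ ⌊log₂ n ⌋ (1≤logs n m 3≤) (≤-trans (s≤s z≤n) 3≤)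

-- Correctness and running time combined.

open import Data.Nat.Base using (_+_; _*_; _^_)
open import Data.Nat.Logarithm using (⌊log₂_⌋)
open import Data.Nat.Properties using (m+n≤o⇒m≤o)

run⇒implements : ∀ {c ℓ} (F : OrderedField c ℓ) {n m T} (I : Scheduling.Instance F n m) {p s} →
  TimedRuns.Run F p s T (λ _ s′ → Scheduling.OutputIn F I s′) →
  ∃[ t ] ∃[ s′ ] (RealRAM._,_⇓[_]_ F p s t s′) × Scheduling.OutputIn F I s′ × t ℕ.≤ T
run⇒implements F I (t , s′ , r , run , t+r≤T , out) = t , s′ , run , out , m+n≤o⇒m≤o t t+r≤T

lpt-correct : ∀ {c ℓ} (F : OrderedField c ℓ) →
  Scheduling.ImplementsLPT_InTime_ F LPTProgram.lpt Asymptotics.lpt-time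
lpt-correct F n m I s inp = run⇒implements F I
  (LPTCorrectness.run-lpt F (ℕ.>-nonZero⁻¹ n) (ℕ.>-nonZero⁻¹ m) I
    (Asymptotics.height n) (Asymptotics.height m)
    (Asymptotics.n+n≤2^height n) (Asymptotics.n+n≤2^height m) inp)

theorem1 : ∀ {c ℓ} (F : OrderedField c ℓ) →
    let open Scheduling F in
    Σ[ p ∈ Program ] Σ[ f ∈ (ℕ → ℕ → ℕ) ]
      (ImplementsLPT p InTime f
       × f ∈O (λ n m → (n + m) * (⌊log₂ m ⌋ ^ 2 + ⌊log₂ n ⌋)))
theorem1 F = LPTProgram.lpt , Asymptotics.lpt-time , lpt-correct F , Asymptotics.lpt-time-∈O
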